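{- Let $a_1/b_1$ and $a_2/b_2$ be a Farey pair with $b_1>b_2$, and put $s=+1$ if $a_1/b_1<a_2/b_2$ and $s=-1$ otherwise. Let $i_{max}$ and $i$ be positive integers with $i<i_{max}$, let $N=b_1\,\mathrm{lcm}(1,2,\dots,i_{max})$, and let $q$ be an integer with $$\frac{N}{b_1(i+1)}<q\le\frac{N}{b_1i}.$$ Then $$I_N\left(\frac{a_1q+a_2}{b_1q+b_2}\right)=I_N\left(\frac{a_1}{b_1}\right)+s\,\frac{3}{\pi^2}\,q\left(\frac{N^2}{b_1^2q^2}-\left\{\frac{N}{b_1q}\right\}^2\right)+O(N\delta_A(i)).$$ In particular, for $a_1/b_1=0/1$ and $a_2/b_2=1/0$, $$I_N\left(\frac1q\right)=\frac{3}{\pi^2}\,q\left(\frac{N^2}{q^2}-\left\{\frac{N}{q}\right\}^2\right)+O(N\delta_A(i)),$$ and for $a_1/b_1=1/2$ and $a_2/b_2=1/1$, $$I_N\left(\frac{q+1}{2q+1}\right)=\frac{|F_N|}{2}+\frac{3}{\pi^2}\,q\left(\frac{N^2}{2^2q^2}-\left\{\frac{N}{2q}\right\}^2\right)+O(N\delta_A(i)).$$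
   Context: For a positive integer $N$, the Farey sequence $F_N$ is the ascending sequence of irreducible fractions in $[0,1]$ (including $0/1$ and $1/1$) whose denominators do not exceed $N$; $|F_N|$ is its number of elements. Fractions $a_1/b_1$, $a_2/b_2$ are written in lowest terms with nonnegative numerator and positive denominator (except for $1/0$ below). $I_N(x)$ is the position that $x$ occupies in $F_N$ (positions starting at $1$, so $I_N(0/1)=1$); equivalently $I_N(x)$ is the number of fractions of $F_N$ in $[0,x]$, and this is used as the definition for all $x\in[0,1]$. Two elements $a_1/b_1$ and $a_2/b_2$ of a Farey sequence form a Farey pair if $|a_1b_2-a_2b_1|=1$. Exceptionally, $0/1$ and $1/0$ are also allowed to form a Farey pair (with $a_1/b_1=0/1$, $a_2/b_2=1/0$, $1/0$ regarded as larger than $0/1$); this is the only case in which $b_2=0$. $\{x\}=x-\lfloor x\rfloor$ is the fractional part. For $A>0$, $$\delta_A(x)=\exp\left(-A\,\frac{(\log x)^{0.6}}{(\log\log x)^{0.2}}\right).$$ Here $A>0$ is a fixed constant for which the known estimate $E(x)=xH(x)+O(x\delta_A(x))$ holds, where, with $\varphi$ Euler's totient function, $E(x)=\sum_{k\le x}\varphi(k)-\frac{3}{\pi^2}x^2$ and $H(x)=\sum_{k\le x}\frac{\varphi(k)}{k}-\frac{6}{\pi^2}x$; such an $A$ is known to exist (Walfisz). The $O$-estimates are for $i\ge 3$ (so that $\delta_A(i)$ is defined), with implied constants absolute (for the fixed $A$). -}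

module Defs where

open import Data.Bool.Base using (if_then_else_)
open import Data.Integer.Base as ℤ using (ℤ; +_; -[1+_])
import Data.Integer.Properties as ℤₚ
open import Data.List.Base using (List; length; filter; map; foldr; concatMap; upTo)
import Data.List.Sort
open import Data.Nat.Base as ℕ using (ℕ; zero; suc; _!; z≤n; s≤s)
open import Data.Nat.Coprimality using (Coprime; coprime?)
open import Data.Nat.LCM using (lcm)
import Data.Nat.Properties as ℕₚ
open import Data.Product.Base using (Σ; ∃; _×_; _,_; proj₁; proj₂)
open import Data.Rational.Base
open import Data.Rational.Properties
open import Data.Rational.Solver
open import Data.Sum.Base using (_⊎_; inj₁; inj₂; [_,_]′)
open import Relation.Binary.PropositionalEquality
open import Relation.Nullary using (yes; no; does; contradiction)
open import Relation.Nullary.Decidable using (from-yes)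

open +-*-Solver

fromℕ : ℕ → ℚ
fromℕ n = + n / 1

-- Total reciprocal, with the junk value inv 0 = 0.
inv : ℚ → ℚ
inv p with p ≟ 0ℚ
... | yes _   = 0ℚ
... | no  p≢0 = 1/_ p {{≢-nonZero p≢0}}

-- The rational m / n; it is 0 if n = 0.
_÷ℕ_ : ℕ → ℕ → ℚ
m ÷ℕ n = fromℕ m * inv (fromℕ n)

infixl 7 _÷ℕ_

frac : ℚ → ℚ
frac p = p - floor p / 1

_^ℚ_ : ℚ → ℕ → ℚ
p ^ℚ zero  = 1ℚ
p ^ℚ suc n = p * p ^ℚ n

infixr 8 _^ℚ_

-- Σ[ n ] f = f 0 + f 1 + … + f (n - 1)
Σ[_] : ℕ → (ℕ → ℚ) → ℚ
Σ[ zero ]  f = 0ℚ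
Σ[ suc n ] f = Σ[ n ] f + f n

module ℚ-Lemmas where

  ≤-castˡ : ∀ {p q r} → p ≡ q → p ≤ r → q ≤ r
  ≤-castˡ refl p≤r = p≤r

  ≤-castʳ : ∀ {p q r} → q ≡ r → p ≤ q → p ≤ r
  ≤-castʳ refl p≤q = p≤q

  0≤+ : ∀ {p q} → 0ℚ ≤ p → 0ℚ ≤ q → 0ℚ ≤ p + q
  0≤+ a b = ≤-castˡ (+-identityˡ 0ℚ) (+-mono-≤ a b)

  *ˡ-mono : ∀ {r p q} → 0ℚ ≤ r → p ≤ q → r * p ≤ r * q
  *ˡ-mono {r} 0≤r = *-monoˡ-≤-nonNeg r {{nonNegative 0≤r}}

  *ʳ-mono : ∀ {r p q} → 0ℚ ≤ r → p ≤ q → p * r ≤ q * r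
  *ʳ-mono {r} 0≤r = *-monoʳ-≤-nonNeg r {{nonNegative 0≤r}}

  *-mono : ∀ {p q r s} → 0ℚ ≤ p → 0ℚ ≤ s → p ≤ q → r ≤ s → p * r ≤ q * s
  *-mono 0≤p 0≤s p≤q r≤s = ≤-trans (*ˡ-mono 0≤p r≤s) (*ʳ-mono 0≤s p≤q)

  0≤* : ∀ {p q} → 0ℚ ≤ p → 0ℚ ≤ q → 0ℚ ≤ p * q
  0≤* {p} 0≤p 0≤q = ≤-castˡ (*-zeroʳ p) (*ˡ-mono 0≤p 0≤q)

  0<* : ∀ {p q} → 0ℚ < p → 0ℚ < q → 0ℚ < p * q
  0<* {p} {q} 0<p 0<q =
    positive⁻¹ _ {{pos*pos⇒pos p {{positive 0<p}} q {{positive 0<q}}}}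

  0<+ : ∀ {p q} → 0ℚ < p → 0ℚ ≤ q → 0ℚ < p + q
  0<+ a b = <-respˡ-≡ (+-identityˡ 0ℚ) (+-mono-<-≤ a b)

  p≤p+q : ∀ {p q} → 0ℚ ≤ q → p ≤ p + q
  p≤p+q {p} 0≤q = ≤-castˡ (+-identityʳ p) (+-monoʳ-≤ p 0≤q)

  p≤q⇒0≤q-p : ∀ {p q} → p ≤ q → 0ℚ ≤ q - p
  p≤q⇒0≤q-p {p} {q} h = ≤-castˡ (+-inverseʳ p) (+-monoˡ-≤ (- p) h)

  0≤q-p⇒p≤q : ∀ {p q} → 0ℚ ≤ q - p → p ≤ q
  0≤q-p⇒p≤q {p} {q} h = subst₂ _≤_ (+-identityˡ p)
    (solve 2 (λ p q → q :+ :- p :+ p := q) refl p q) (+-monoˡ-≤ p h)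

  p<q⇒0<q-p : ∀ {p q} → p < q → 0ℚ < q - p
  p<q⇒0<q-p {p} {q} h = <-respˡ-≡ (+-inverseʳ p) (+-monoˡ-< (- p) h)

  p≤∣p∣ : ∀ p → p ≤ ∣ p ∣
  p≤∣p∣ p with ≤-total 0ℚ p
  ... | inj₁ h = ≤-reflexive (sym (0≤p⇒∣p∣≡p h))
  ... | inj₂ h = ≤-trans h (0≤∣p∣ p)

  ∣p∣≤ : ∀ {p q} → p ≤ q → - p ≤ q → ∣ p ∣ ≤ q
  ∣p∣≤ {p} {q} h h′ = [ (λ e → subst (_≤ q) (sym e) h) , (λ e → subst (_≤ q) (sym e) h′) ]′
    (∣p∣≡p∨∣p∣≡-p p)

  ∣-swap∣ : ∀ p q → ∣ p - q ∣ ≡ ∣ q - p ∣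
  ∣-swap∣ p q = trans (sym (∣-p∣≡∣p∣ (p - q)))
    (cong ∣_∣ (solve 2 (λ p q → :- (p :+ :- q) := q :+ :- p) refl p q))

  ∣∣-triangle : ∀ p q r → ∣ p - r ∣ ≤ ∣ p - q ∣ + ∣ q - r ∣
  ∣∣-triangle p q r = ≤-castˡ
    (cong ∣_∣ (solve 3 (λ p q r → (p :+ :- q) :+ (q :+ :- r) := p :+ :- r) refl p q r))
    (∣p+q∣≤∣p∣+∣q∣ (p - q) (q - r))

  ∣p∣≤∣q∣+∣p-q∣ : ∀ p q → ∣ p ∣ ≤ ∣ q ∣ + ∣ p - q ∣
  ∣p∣≤∣q∣+∣p-q∣ p q = ≤-castˡ
    (cong ∣_∣ (solve 2 (λ p q → q :+ (p :+ :- q) := p) refl p q))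
    (∣p+q∣≤∣p∣+∣q∣ q (p - q))

  arch : ∀ p → ∃ λ n → p ≤ fromℕ n
  arch (mkℚ (+ n) d c) = n , toℚᵘ-cancel-≤ (ℚᵘₚ.≤-respʳ-≃ (ℚᵘₚ.≃-sym (toℚᵘ-fromℚᵘ (mkℚᵘ (+ n) 0)))
      (ℚᵘ.*≤* (ℤₚ.*-monoˡ-≤-nonNeg (+ n) (ℤ.+≤+ (s≤s z≤n)))))
    where
    import Data.Rational.Unnormalised.Properties as ℚᵘₚ
    import Data.Rational.Unnormalised.Base as ℚᵘ
    open ℚᵘ using (mkℚᵘ)
  arch p@(mkℚ -[1+ n ] d c) = 0 , <⇒≤ (negative⁻¹ p)

  fromℕ-+ : ∀ m n → fromℕ (m ℕ.+ n) ≡ fromℕ m + fromℕ n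
  fromℕ-+ m n = trans (cong (_/ 1) (cong₂ ℤ._+_ (sym (ℤₚ.*-identityʳ (+ m))) (sym (ℤₚ.*-identityʳ (+ n)))))
     (toℚᵘ-injective (ℚᵘₚ.≃-trans (toℚᵘ-fromℚᵘ (mkℚᵘ (+ m ℤ.* + 1 ℤ.+ + n ℤ.* + 1) 0))
       (ℚᵘₚ.≃-sym (ℚᵘₚ.≃-trans (toℚᵘ-homo-+ (fromℕ m) (fromℕ n))
         (ℚᵘₚ.+-cong (toℚᵘ-fromℚᵘ (mkℚᵘ (+ m) 0)) (toℚᵘ-fromℚᵘ (mkℚᵘ (+ n) 0)))))))
    where
    import Data.Rational.Unnormalised.Properties as ℚᵘₚ
    open import Data.Rational.Unnormalised.Base using (mkℚᵘ)

  0≤fromℕ : ∀ n → 0ℚ ≤ fromℕ n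
  0≤fromℕ n = nonNegative⁻¹ _ {{normalize-nonNeg n 1}}

  fromℕ-suc : ∀ n → fromℕ (suc n) ≡ fromℕ n + 1ℚ
  fromℕ-suc n = trans (cong fromℕ (ℕₚ.+-comm 1 n)) (fromℕ-+ n 1)

  fromℕ-mono : ∀ {m n} → m ℕ.≤ n → fromℕ m ≤ fromℕ n
  fromℕ-mono {m} {n} m≤n = subst (λ k → fromℕ m ≤ fromℕ k) (ℕₚ.m+[n∸m]≡n m≤n)
    (subst (fromℕ m ≤_) (sym (fromℕ-+ m (n ℕ.∸ m))) (p≤p+q (0≤fromℕ (n ℕ.∸ m))))

  inv-inverseʳ : ∀ {p} → p ≢ 0ℚ → p * inv p ≡ 1ℚ
  inv-inverseʳ {p} p≢0 with p ≟ 0ℚ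
  ... | yes p≡0  = contradiction p≡0 p≢0
  ... | no  p≢0′ = *-inverseʳ p {{≢-nonZero p≢0′}}

  0<⇒≢0 : ∀ {p} → 0ℚ < p → p ≢ 0ℚ
  0<⇒≢0 0<p p≡0 = <-irrefl (sym p≡0) 0<p

  pos*inv : ∀ {p} → 0ℚ < p → p * inv p ≡ 1ℚ
  pos*inv 0<p = inv-inverseʳ (0<⇒≢0 0<p)

  inv-pos : ∀ {p} → 0ℚ < p → 0ℚ < inv p
  inv-pos {p} 0<p = *-cancelˡ-<-nonNeg p {{nonNegative (<⇒≤ 0<p)}}
    (subst₂ _<_ (sym (*-zeroʳ p)) (sym (pos*inv 0<p)) (from-yes (0ℚ <? 1ℚ)))

  inv-antimono : ∀ {p q} → 0ℚ < p → p ≤ q → inv q ≤ inv p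
  inv-antimono {p} {q} 0<p p≤q = subst₂ _≤_ eq₁ eq₂
    (*ˡ-mono (<⇒≤ (inv-pos 0<q)) (*ʳ-mono (<⇒≤ (inv-pos 0<p)) p≤q))
    where
    0<q : 0ℚ < q
    0<q = <-≤-trans 0<p p≤q
    eq₁ : inv q * (p * inv p) ≡ inv q
    eq₁ = trans (cong (inv q *_) (pos*inv 0<p)) (*-identityʳ (inv q))
    eq₂ : inv q * (q * inv p) ≡ inv p
    eq₂ = trans (sym (*-assoc (inv q) q (inv p)))
      (trans (cong (_* inv p) (trans (*-comm (inv q) q) (pos*inv 0<q))) (*-identityˡ (inv p)))

  arch₂ : ∀ p {ε} → 0ℚ < ε → ∃ λ n → p ≤ fromℕ (suc n) * ε
  arch₂ p {ε} 0<ε = proj₁ A , ≤-castˡ eq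
    (*ʳ-mono (<⇒≤ 0<ε) (≤-trans (proj₂ A) (fromℕ-mono (ℕₚ.n≤1+n (proj₁ A)))))
    where
    A = arch (p * inv ε)
    eq : p * inv ε * ε ≡ p
    eq = trans (*-assoc p (inv ε) ε)
      (trans (cong (p *_) (trans (*-comm (inv ε) ε) (pos*inv 0<ε))) (*-identityʳ p))

  0≤^ : ∀ {p} → 0ℚ ≤ p → ∀ n → 0ℚ ≤ p ^ℚ n
  0≤^ 0≤p zero    = from-yes (0ℚ ≤? 1ℚ)
  0≤^ 0≤p (suc n) = 0≤* 0≤p (0≤^ 0≤p n)

  ∣^∣≤ : ∀ {p ρ} → ∣ p ∣ ≤ ρ → ∀ n → ∣ p ^ℚ n ∣ ≤ ρ ^ℚ n
  ∣^∣≤ h zero    = ≤-refl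
  ∣^∣≤ {p} {ρ} h (suc n) = ≤-castˡ (sym (∣p*q∣≡∣p∣*∣q∣ p (p ^ℚ n)))
    (*-mono (0≤∣p∣ p) (0≤^ (≤-trans (0≤∣p∣ p) h) n) h (∣^∣≤ h n))

  -- (1 - r) n rⁿ ≤ 1 and (1 - r) (1 + r + … + rⁿ⁻¹) ≤ 1 for 0 ≤ r ≤ 1
  module Geometric {r : ℚ} (0≤r : 0ℚ ≤ r) (r≤1 : r ≤ 1ℚ) where

    G : ℕ → ℚ
    G n = Σ[ n ] (r ^ℚ_)

    0≤G : ∀ n → 0ℚ ≤ G n
    0≤G zero    = ≤-refl
    0≤G (suc n) = 0≤+ (0≤G n) (0≤^ 0≤r n)

    closed : ∀ n → (1ℚ - r) * G n ≡ 1ℚ - r ^ℚ n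
    closed zero    = trans (*-zeroʳ (1ℚ - r)) (sym (+-inverseʳ 1ℚ))
    closed (suc n) = trans (*-distribˡ-+ (1ℚ - r) (G n) (r ^ℚ n))
      (trans (cong (_+ (1ℚ - r) * r ^ℚ n) (closed n))
        (solve 2 (λ r t → (con 1ℚ :+ :- t) :+ (con 1ℚ :+ :- r) :* t := con 1ℚ :+ :- (r :* t))
          refl r (r ^ℚ n)))

    sum≤1 : ∀ n → (1ℚ - r) * G n ≤ 1ℚ
    sum≤1 n = ≤-castˡ (sym (closed n))
      (0≤q-p⇒p≤q (≤-castʳ (solve 1 (λ t → t := con 1ℚ :+ :- (con 1ℚ :+ :- t)) refl (r ^ℚ n))
        (0≤^ 0≤r n)))

    n*rⁿ≤G : ∀ n → fromℕ n * r ^ℚ n ≤ G n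
    n*rⁿ≤G zero    = ≤-reflexive (*-zeroˡ 1ℚ)
    n*rⁿ≤G (suc n) = ≤-castˡ eq (+-mono-≤ (≤-trans step (n*rⁿ≤G n)) rⁿ⁺¹≤rⁿ)
      where
      rⁿ⁺¹≤rⁿ : r * r ^ℚ n ≤ r ^ℚ n
      rⁿ⁺¹≤rⁿ = ≤-castʳ (*-identityˡ (r ^ℚ n)) (*ʳ-mono (0≤^ 0≤r n) r≤1)
      step : fromℕ n * (r * r ^ℚ n) ≤ fromℕ n * r ^ℚ n
      step = *ˡ-mono (0≤fromℕ n) rⁿ⁺¹≤rⁿ
      eq : fromℕ n * (r * r ^ℚ n) + r * r ^ℚ n ≡ fromℕ (suc n) * (r * r ^ℚ n)
      eq = trans (solve 2 (λ a b → a :* b :+ b := (a :+ con 1ℚ) :* b) refl (fromℕ n) (r * r ^ℚ n))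
        (cong (_* (r * r ^ℚ n)) (sym (fromℕ-suc n)))

open ℚ-Lemmas

Eventually : (ℕ → Set) → Set
Eventually P = ∃ λ N → ∀ n → N ℕ.≤ n → P n

Cauchy : (ℕ → ℚ) → Set
Cauchy f = ∀ ε → 0ℚ < ε → ∃ λ N → ∀ m n → N ℕ.≤ m → N ℕ.≤ n → ∣ f m - f n ∣ ≤ ε

record ℝ : Set where
  constructor mkℝ
  field
    seq      : ℕ → ℚ
    isCauchy : Cauchy seq

open ℝ public

infix 4 _≤ʳ_ _<ʳ_

_≤ʳ_ : ℝ → ℝ → Set
x ≤ʳ y = ∀ ε → 0ℚ < ε → Eventually λ n → seq x n ≤ seq y n + ε

_<ʳ_ : ℝ → ℝ → Set
x <ʳ y = ∃ λ ε → 0ℚ < ε × Eventually λ n → seq x n + ε ≤ seq y n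

module ℝ-Lemmas where

  infixr 5 _⟪_⟫_

  _⟪_⟫_ : ∀ {P Q R : ℕ → Set} → Eventually P → (∀ n → P n → Q n → R n) → Eventually Q → Eventually R
  (M , p) ⟪ f ⟫ (N , q) = M ℕ.⊔ N , λ n h →
    f n (p n (ℕₚ.m⊔n≤o⇒m≤o M N h)) (q n (ℕₚ.m⊔n≤o⇒n≤o M N h))

  mapᵉ : ∀ {P Q : ℕ → Set} → (∀ n → P n → Q n) → Eventually P → Eventually Q
  mapᵉ f (N , p) = N , λ n h → f n (p n h)

  -- It suffices to bound the oscillation by a fixed multiple of ε.
  cauchyᴷ : ∀ f K → 0ℚ ≤ K →
            (∀ ε → 0ℚ < ε → ∃ λ N → ∀ m n → N ℕ.≤ m → N ℕ.≤ n → ∣ f m - f n ∣ ≤ K * ε) →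
            Cauchy f
  cauchyᴷ f K 0≤K h ε 0<ε = proj₁ H , λ m n hm hn → ≤-trans (proj₂ H m n hm hn) Kη≤ε
    where
    0<K+1 : 0ℚ < 1ℚ + K
    0<K+1 = 0<+ (from-yes (0ℚ <? 1ℚ)) 0≤K
    η : ℚ
    η = inv (1ℚ + K) * ε
    0<η : 0ℚ < η
    0<η = 0<* (inv-pos 0<K+1) 0<ε
    H = h η 0<η
    eq : (1ℚ + K) * η ≡ ε
    eq = trans (sym (*-assoc (1ℚ + K) (inv (1ℚ + K)) ε))
      (trans (cong (_* ε) (pos*inv 0<K+1)) (*-identityˡ ε))
    Kη≤ε : K * η ≤ ε
    Kη≤ε = ≤-castʳ eq (*ʳ-mono {η} {K} (<⇒≤ 0<η) (≤-castʳ (+-comm K 1ℚ) (p≤p+q {K} (from-yes (0ℚ ≤? 1ℚ)))))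

  bounded : ∀ {f} → Cauchy f → ∃ λ B → 0ℚ < B × Eventually λ n → ∣ f n ∣ ≤ B
  bounded {f} cf = 1ℚ + ∣ f N ∣ , 0<+ (from-yes (0ℚ <? 1ℚ)) (0≤∣p∣ (f N)) , N , λ n h →
    ≤-trans (∣p∣≤∣q∣+∣p-q∣ (f n) (f N))
      (≤-castʳ (+-comm ∣ f N ∣ 1ℚ) (+-monoʳ-≤ ∣ f N ∣ (proj₂ C n N h ℕₚ.≤-refl)))
    where
    C = cf 1ℚ (from-yes (0ℚ <? 1ℚ))
    N = proj₁ C

  cauchy-const : ∀ p → Cauchy λ _ → p
  cauchy-const p ε 0<ε = 0 , λ _ _ _ _ → ≤-castˡ (cong ∣_∣ (sym (+-inverseʳ p))) (<⇒≤ 0<ε)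

  cauchy-+ : ∀ {f g} → Cauchy f → Cauchy g → Cauchy λ n → f n + g n
  cauchy-+ {f} {g} cf cg = cauchyᴷ (λ n → f n + g n) (1ℚ + 1ℚ) (from-yes (0ℚ ≤? 1ℚ + 1ℚ)) λ ε 0<ε →
    let (M , p) = cf ε 0<ε; (N , q) = cg ε 0<ε in
    M ℕ.⊔ N , λ m n hm hn →
      ≤-castʳ (solve 1 (λ e → e :+ e := (con 1ℚ :+ con 1ℚ) :* e) refl ε)
        (≤-trans
          (≤-castˡ (cong ∣_∣ (solve 4 (λ a b c d → (a :+ :- c) :+ (b :+ :- d) := (a :+ b) :+ :- (c :+ d))
                     refl (f m) (g m) (f n) (g n)))
            (∣p+q∣≤∣p∣+∣q∣ (f m - f n) (g m - g n)))
          (+-mono-≤ (p m n (ℕₚ.m⊔n≤o⇒m≤o M N hm) (ℕₚ.m⊔n≤o⇒m≤o M N hn))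
                    (q m n (ℕₚ.m⊔n≤o⇒n≤o M N hm) (ℕₚ.m⊔n≤o⇒n≤o M N hn))))

  cauchy-neg : ∀ {f} → Cauchy f → Cauchy λ n → - f n
  cauchy-neg {f} cf ε 0<ε = let (N , p) = cf ε 0<ε in N , λ m n hm hn →
    ≤-castˡ (trans (sym (∣-p∣≡∣p∣ (f m - f n))) (cong ∣_∣ (neg-distrib-+ (f m) (- f n)))) (p m n hm hn)

  cauchy-∣∣ : ∀ {f} → Cauchy f → Cauchy λ n → ∣ f n ∣
  cauchy-∣∣ {f} cf ε 0<ε = let (N , p) = cf ε 0<ε in N , λ m n hm hn →
    ∣p∣≤ (half (f m) (f n) (p m n hm hn))
      (≤-castˡ (solve 2 (λ a b → b :+ :- a := :- (a :+ :- b)) refl ∣ f m ∣ ∣ f n ∣)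
        (half (f n) (f m) (p n m hn hm)))
    where
    half : ∀ a b → ∣ a - b ∣ ≤ ε → ∣ a ∣ - ∣ b ∣ ≤ ε
    half a b h = ≤-castʳ (solve 2 (λ b e → b :+ e :+ :- b := e) refl ∣ b ∣ ε)
      (+-monoˡ-≤ (- ∣ b ∣) (≤-trans (∣p∣≤∣q∣+∣p-q∣ a b) (+-monoʳ-≤ ∣ b ∣ h)))

  cauchy-* : ∀ {f g} → Cauchy f → Cauchy g → Cauchy λ n → f n * g n
  cauchy-* {f} {g} cf cg =
    let (B , 0<B , N₁ , bf) = bounded {f} cf; (D , 0<D , N₂ , bg) = bounded {g} cg in
    cauchyᴷ (λ n → f n * g n) (B + D) (0≤+ (<⇒≤ 0<B) (<⇒≤ 0<D)) λ ε 0<ε →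
    let (N₃ , p) = cf ε 0<ε; (N₄ , q) = cg ε 0<ε
        M = N₁ ℕ.⊔ N₂; M′ = N₃ ℕ.⊔ N₄ in
    M ℕ.⊔ M′ , λ m n hm hn →
      let hM = ℕₚ.m⊔n≤o⇒m≤o M M′ hm; hN = ℕₚ.m⊔n≤o⇒m≤o M M′ hn
          hM′ = ℕₚ.m⊔n≤o⇒n≤o M M′ hm; hN′ = ℕₚ.m⊔n≤o⇒n≤o M M′ hn
      in ≤-castʳ (solve 3 (λ b d e → b :* e :+ e :* d := (b :+ d) :* e) refl B D ε)
        (≤-trans
          (≤-castˡ (cong ∣_∣ (solve 4 (λ a b c d → a :* (b :+ :- d) :+ (a :+ :- c) :* d := a :* b :+ :- (c :* d))
                     refl (f m) (g m) (f n) (g n)))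
            (∣p+q∣≤∣p∣+∣q∣ (f m * (g m - g n)) ((f m - f n) * g n)))
          (+-mono-≤
            (≤-castˡ (sym (∣p*q∣≡∣p∣*∣q∣ (f m) (g m - g n)))
              (*-mono (0≤∣p∣ (f m)) (<⇒≤ 0<ε) (bf m (ℕₚ.m⊔n≤o⇒m≤o N₁ N₂ hM))
                (q m n (ℕₚ.m⊔n≤o⇒n≤o N₃ N₄ hM′) (ℕₚ.m⊔n≤o⇒n≤o N₃ N₄ hN′))))
            (≤-castˡ (sym (∣p*q∣≡∣p∣*∣q∣ (f m - f n) (g n)))
              (*-mono (0≤∣p∣ (f m - f n)) (<⇒≤ 0<D)
                (p m n (ℕₚ.m⊔n≤o⇒m≤o N₃ N₄ hM′) (ℕₚ.m⊔n≤o⇒m≤o N₃ N₄ hN′))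
                (bg n (ℕₚ.m⊔n≤o⇒n≤o N₁ N₂ hN))))))

  cauchy-inv : ∀ {f e} → 0ℚ < e → Eventually (λ n → e ≤ f n) → Cauchy f → Cauchy λ n → inv (f n)
  cauchy-inv {f} {e} 0<e (N₁ , e≤f) cf =
    cauchyᴷ (λ n → inv (f n)) (inv e * inv e) (0≤* (<⇒≤ 0<1/e) (<⇒≤ 0<1/e)) λ ε 0<ε →
    let (N₂ , p) = cf ε 0<ε in
    N₁ ℕ.⊔ N₂ , λ m n hm hn →
      let e≤fm = e≤f m (ℕₚ.m⊔n≤o⇒m≤o N₁ N₂ hm); e≤fn = e≤f n (ℕₚ.m⊔n≤o⇒m≤o N₁ N₂ hn) in
      ≤-castʳ (*-comm ε (inv e * inv e)) (≤-trans (lip {f m} {f n} e≤fm e≤fn)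
        (*ʳ-mono (0≤* (<⇒≤ 0<1/e) (<⇒≤ 0<1/e))
          (p m n (ℕₚ.m⊔n≤o⇒n≤o N₁ N₂ hm) (ℕₚ.m⊔n≤o⇒n≤o N₁ N₂ hn))))
    where
    0<1/e : 0ℚ < inv e
    0<1/e = inv-pos 0<e
    lip : ∀ {a b} → e ≤ a → e ≤ b → ∣ inv a - inv b ∣ ≤ ∣ a - b ∣ * (inv e * inv e)
    lip {a} {b} e≤a e≤b = ≤-castˡ (sym eq)
      (*ˡ-mono (0≤∣p∣ (a - b)) (*-mono (<⇒≤ 0<1/a) (<⇒≤ 0<1/e) (inv-antimono 0<e e≤a) (inv-antimono 0<e e≤b)))
      where
      0<a = <-≤-trans 0<e e≤a
      0<b = <-≤-trans 0<e e≤b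
      0<1/a = inv-pos 0<a
      0<1/b = inv-pos 0<b
      eq₀ : inv a - inv b ≡ (b - a) * (inv a * inv b)
      eq₀ = begin
        inv a - inv b
          ≡⟨ cong₂ _-_ (sym (*-identityʳ (inv a))) (sym (*-identityʳ (inv b))) ⟩
        inv a * 1ℚ - inv b * 1ℚ
          ≡⟨ cong₂ (λ s t → inv a * s - inv b * t) (sym (pos*inv 0<b)) (sym (pos*inv 0<a)) ⟩
        inv a * (b * inv b) - inv b * (a * inv a)
          ≡⟨ solve 4 (λ a b a′ b′ → a′ :* (b :* b′) :+ :- (b′ :* (a :* a′)) := (b :+ :- a) :* (a′ :* b′))
               refl a b (inv a) (inv b) ⟩
        (b - a) * (inv a * inv b) ∎
        where open ≡-Reasoning
      eq : ∣ inv a - inv b ∣ ≡ ∣ a - b ∣ * (inv a * inv b)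
      eq = trans (cong ∣_∣ eq₀) (trans (∣p*q∣≡∣p∣*∣q∣ (b - a) (inv a * inv b))
        (cong₂ _*_ (∣-swap∣ b a) (0≤p⇒∣p∣≡p (0≤* (<⇒≤ 0<1/a) (<⇒≤ 0<1/b)))))

open ℝ-Lemmas

fromℚ : ℚ → ℝ
fromℚ p = mkℝ (λ _ → p) (cauchy-const p)

0ʳ 1ʳ : ℝ
0ʳ = fromℚ 0ℚ
1ʳ = fromℚ 1ℚ

infixl 6 _+ʳ_ _-ʳ_
infixl 7 _*ʳ_
infix  8 -ʳ_

_+ʳ_ : ℝ → ℝ → ℝ
x +ʳ y = mkℝ (λ n → seq x n + seq y n) (cauchy-+ {seq x} {seq y} (isCauchy x) (isCauchy y))

-ʳ_ : ℝ → ℝ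
-ʳ x = mkℝ (λ n → - seq x n) (cauchy-neg {seq x} (isCauchy x))

_-ʳ_ : ℝ → ℝ → ℝ
x -ʳ y = x +ʳ (-ʳ y)

_*ʳ_ : ℝ → ℝ → ℝ
x *ʳ y = mkℝ (λ n → seq x n * seq y n) (cauchy-* {seq x} {seq y} (isCauchy x) (isCauchy y))

∣_∣ʳ : ℝ → ℝ
∣ x ∣ʳ = mkℝ (λ n → ∣ seq x n ∣) (cauchy-∣∣ {seq x} (isCauchy x))

-- The finitely many terms at which inv may take its junk value do not
-- affect the real number.
recip : (x : ℝ) → 0ʳ <ʳ x → ℝ
recip x (ε , 0<ε , ev) = mkℝ (λ n → inv (seq x n))
  (cauchy-inv {seq x} 0<ε (mapᵉ (λ n → ≤-castˡ (+-identityˡ ε)) ev) (isCauchy x))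

partialSum : (ℕ → ℚ) → ℚ → ℕ → ℚ
partialSum c z n = Σ[ n ] λ k → c k * z ^ℚ k

-- A bound for x, and a geometric majorant of the derived series at that
-- bound; this makes the partial sums at x a Cauchy sequence.
record Dominated (c : ℕ → ℚ) (x : ℝ) : Set where
  field
    ρ M r : ℚ
    0≤ρ   : 0ℚ ≤ ρ
    0≤M   : 0ℚ ≤ M
    0≤r   : 0ℚ ≤ r
    r<1   : r < 1ℚ
    bound : Eventually λ n → ∣ seq x n ∣ ≤ ρ
    coeff : ∀ k → fromℕ (suc k) * ∣ c (suc k) ∣ * ρ ^ℚ k ≤ M * r ^ℚ k

module PowerSeries {c : ℕ → ℚ} {x : ℝ} (D : Dominated c x) where
  open Dominated D
  open Geometric 0≤r (<⇒≤ r<1)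

  T : ℚ
  T = inv (1ℚ - r)

  0<1-r : 0ℚ < 1ℚ - r
  0<1-r = p<q⇒0<q-p r<1

  0<T : 0ℚ < T
  0<T = inv-pos 0<1-r

  ≤T* : ∀ {p q} → (1ℚ - r) * p ≤ q → p ≤ T * q
  ≤T* {p} {q} h = ≤-castˡ eq (*ˡ-mono (<⇒≤ 0<T) h)
    where
    eq : T * ((1ℚ - r) * p) ≡ p
    eq = trans (sym (*-assoc T (1ℚ - r) p))
      (trans (cong (_* p) (trans (*-comm T (1ℚ - r)) (pos*inv 0<1-r))) (*-identityˡ p))

  G≤T : ∀ n → G n ≤ T
  G≤T n = ≤-castʳ (*-identityʳ T) (≤T* (sum≤1 n))

  G-tail : ∀ j N → G (j ℕ.+ N) - G N ≤ T * r ^ℚ N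
  G-tail j N = ≤T* (≤-castˡ (sym eq)
    (0≤q-p⇒p≤q (≤-castʳ (solve 2 (λ s t → s := t :+ :- (t :+ :- s)) refl (r ^ℚ (j ℕ.+ N)) (r ^ℚ N))
      (0≤^ 0≤r (j ℕ.+ N)))))
    where
    eq : (1ℚ - r) * (G (j ℕ.+ N) - G N) ≡ r ^ℚ N - r ^ℚ (j ℕ.+ N)
    eq = trans (solve 3 (λ u a b → u :* (a :+ :- b) := u :* a :+ :- (u :* b)) refl (1ℚ - r) (G (j ℕ.+ N)) (G N))
      (trans (cong₂ _-_ (closed (j ℕ.+ N)) (closed N))
        (solve 2 (λ s t → (con 1ℚ :+ :- s) :+ :- (con 1ℚ :+ :- t) := t :+ :- s) refl (r ^ℚ (j ℕ.+ N)) (r ^ℚ N)))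

  pow-lip : ∀ {a b} → ∣ a ∣ ≤ ρ → ∣ b ∣ ≤ ρ → ∀ k →
            ∣ a ^ℚ suc k - b ^ℚ suc k ∣ ≤ ∣ a - b ∣ * (fromℕ (suc k) * ρ ^ℚ k)
  pow-lip {a} {b} ha hb zero = ≤-reflexive
    (trans (cong₂ (λ s t → ∣ s - t ∣) (*-identityʳ a) (*-identityʳ b)) (sym (*-identityʳ ∣ a - b ∣)))
  pow-lip {a} {b} ha hb (suc k) =
    ≤-castˡ (cong ∣_∣ (solve 4 (λ a b s t → a :* (s :+ :- t) :+ (a :+ :- b) :* t := a :* s :+ :- (b :* t))
              refl a b (a ^ℚ suc k) (b ^ℚ suc k)))
    (≤-trans (∣p+q∣≤∣p∣+∣q∣ (a * (a ^ℚ suc k - b ^ℚ suc k)) ((a - b) * b ^ℚ suc k))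
    (≤-castʳ eq (+-mono-≤
      (≤-castˡ (sym (∣p*q∣≡∣p∣*∣q∣ a (a ^ℚ suc k - b ^ℚ suc k)))
        (*-mono (0≤∣p∣ a) (0≤* (0≤∣p∣ (a - b)) (0≤* (0≤fromℕ (suc k)) (0≤^ 0≤ρ k))) ha (pow-lip ha hb k)))
      (≤-castˡ (sym (∣p*q∣≡∣p∣*∣q∣ (a - b) (b ^ℚ suc k)))
        (*ˡ-mono (0≤∣p∣ (a - b)) (∣^∣≤ hb (suc k)))))))
    where
    d = ∣ a - b ∣
    eq : ρ * (d * (fromℕ (suc k) * ρ ^ℚ k)) + d * (ρ * ρ ^ℚ k) ≡ d * (fromℕ (suc (suc k)) * (ρ * ρ ^ℚ k))
    eq = trans (solve 4 (λ ρ d n s → ρ :* (d :* (n :* s)) :+ d :* (ρ :* s) := d :* ((n :+ con 1ℚ) :* (ρ :* s)))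
                 refl ρ d (fromℕ (suc k)) (ρ ^ℚ k))
      (cong (λ n → d * (n * (ρ * ρ ^ℚ k))) (sym (fromℕ-suc (suc k))))

  P : ℚ → ℕ → ℚ
  P = partialSum c

  P-lip : ∀ {a b} → ∣ a ∣ ≤ ρ → ∣ b ∣ ≤ ρ → ∀ n →
          ∣ P a (suc n) - P b (suc n) ∣ ≤ ∣ a - b ∣ * (M * G n)
  P-lip {a} {b} ha hb zero = ≤-castˡ (cong ∣_∣ (sym (+-inverseʳ (P b 1))))
    (0≤* (0≤∣p∣ (a - b)) (0≤* 0≤M ≤-refl))
  P-lip {a} {b} ha hb (suc n) =
    ≤-castˡ (cong ∣_∣ (solve 5 (λ x y c s t → (x :+ :- y) :+ c :* (s :+ :- t) := (x :+ c :* s) :+ :- (y :+ c :* t))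
              refl (P a (suc n)) (P b (suc n)) (c (suc n)) (a ^ℚ suc n) (b ^ℚ suc n)))
    (≤-trans (∣p+q∣≤∣p∣+∣q∣ (P a (suc n) - P b (suc n)) (c (suc n) * (a ^ℚ suc n - b ^ℚ suc n)))
    (≤-castʳ (solve 4 (λ d m g t → d :* (m :* g) :+ d :* (m :* t) := d :* (m :* (g :+ t))) refl d M (G n) (r ^ℚ n))
      (+-mono-≤ (P-lip ha hb n)
      (≤-castˡ (sym (∣p*q∣≡∣p∣*∣q∣ (c (suc n)) (a ^ℚ suc n - b ^ℚ suc n)))
      (≤-trans (*ˡ-mono (0≤∣p∣ (c (suc n))) (pow-lip ha hb n))
      (≤-castˡ (solve 4 (λ d n c s → d :* (n :* c :* s) := c :* (d :* (n :* s)))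
                  refl d (fromℕ (suc n)) ∣ c (suc n) ∣ (ρ ^ℚ n))
        (*ˡ-mono (0≤∣p∣ (a - b)) (coeff n))))))))
    where d = ∣ a - b ∣

  term-bound : ∀ {a} → ∣ a ∣ ≤ ρ → ∀ k → ∣ c (suc k) * a ^ℚ suc k ∣ ≤ ρ * M * r ^ℚ k
  term-bound {a} ha k = ≤-castˡ (sym (∣p*q∣≡∣p∣*∣q∣ (c (suc k)) (a ^ℚ suc k)))
    (≤-trans (*ˡ-mono (0≤∣p∣ (c (suc k))) (∣^∣≤ ha (suc k)))
    (≤-trans (≤-castˡ (*-identityˡ _)
               (*ʳ-mono (0≤* (0≤∣p∣ (c (suc k))) (0≤^ 0≤ρ (suc k))) (fromℕ-mono (s≤s (z≤n {k})))))
    (subst₂ _≤_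
      (solve 4 (λ ρ n c s → ρ :* (n :* c :* s) := n :* (c :* (ρ :* s)))
        refl ρ (fromℕ (suc k)) ∣ c (suc k) ∣ (ρ ^ℚ k))
      (sym (*-assoc ρ M (r ^ℚ k)))
      (*ˡ-mono 0≤ρ (coeff k)))))

  P-tail : ∀ {a} → ∣ a ∣ ≤ ρ → ∀ j N →
           ∣ P a (suc (j ℕ.+ N)) - P a (suc N) ∣ ≤ ρ * M * (G (j ℕ.+ N) - G N)
  P-tail {a} ha zero N = ≤-reflexive (trans (cong ∣_∣ (+-inverseʳ (P a (suc N))))
    (sym (trans (cong (ρ * M *_) (+-inverseʳ (G N))) (*-zeroʳ (ρ * M)))))
  P-tail {a} ha (suc j) N =
    ≤-castˡ (cong ∣_∣ (solve 3 (λ x y t → (x :+ :- y) :+ t := (x :+ t) :+ :- y)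
              refl (P a (suc (j ℕ.+ N))) (P a (suc N)) (c (suc (j ℕ.+ N)) * a ^ℚ suc (j ℕ.+ N))))
    (≤-trans (∣p+q∣≤∣p∣+∣q∣ (P a (suc (j ℕ.+ N)) - P a (suc N)) (c (suc (j ℕ.+ N)) * a ^ℚ suc (j ℕ.+ N)))
    (≤-castʳ (solve 4 (λ k g g′ t → k :* (g :+ :- g′) :+ k :* t := k :* ((g :+ t) :+ :- g′))
               refl (ρ * M) (G (j ℕ.+ N)) (G N) (r ^ℚ (j ℕ.+ N)))
      (+-mono-≤ (P-tail ha j N) (term-bound ha (j ℕ.+ N)))))

  P-tail′ : ∀ {a} → ∣ a ∣ ≤ ρ → ∀ {m N ε} → N ℕ.≤ m → r ^ℚ N ≤ ε →
            ∣ P a (suc m) - P a (suc N) ∣ ≤ ρ * M * (T * ε)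
  P-tail′ {a} ha {m} {N} N≤m rᴺ≤ε =
    subst (λ k → ∣ P a (suc k) - P a (suc N) ∣ ≤ _) (ℕₚ.m∸n+n≡m N≤m)
      (≤-trans (P-tail ha (m ℕ.∸ N) N)
        (*ˡ-mono (0≤* 0≤ρ 0≤M) (≤-trans (G-tail (m ℕ.∸ N) N) (*ˡ-mono (<⇒≤ 0<T) rᴺ≤ε))))

  rᴺ-small : ∀ ε → 0ℚ < ε → ∃ λ N → r ^ℚ N ≤ ε
  rᴺ-small ε 0<ε = let (n , h) = arch₂ T 0<ε in suc n ,
    *-cancelˡ-≤-pos (fromℕ (suc n)) {{normalize-pos (suc n) 1}}
      (≤-trans (n*rⁿ≤G (suc n)) (≤-trans (G≤T (suc n)) h))

  cauchy : Cauchy λ n → P (seq x n) (suc n)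
  cauchy = cauchyᴷ (λ n → P (seq x n) (suc n)) K (0≤+ (0≤+ 0≤ρMT (0≤* 0≤M (<⇒≤ 0<T))) 0≤ρMT) λ ε 0<ε →
    let (N₁ , hb) = bound; (N₂ , hr) = rᴺ-small ε 0<ε; (N₃ , hc) = isCauchy x ε 0<ε
        N = N₁ ℕ.⊔ (N₂ ℕ.⊔ N₃)
        h₁ : ∀ {n} → N ℕ.≤ n → N₁ ℕ.≤ n
        h₁ = ℕₚ.m⊔n≤o⇒m≤o N₁ (N₂ ℕ.⊔ N₃)
        h₂ : ∀ {n} → N ℕ.≤ n → N₂ ℕ.≤ n
        h₂ h = ℕₚ.m⊔n≤o⇒m≤o N₂ N₃ (ℕₚ.m⊔n≤o⇒n≤o N₁ (N₂ ℕ.⊔ N₃) h)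
        h₃ : ∀ {n} → N ℕ.≤ n → N₃ ℕ.≤ n
        h₃ h = ℕₚ.m⊔n≤o⇒n≤o N₂ N₃ (ℕₚ.m⊔n≤o⇒n≤o N₁ (N₂ ℕ.⊔ N₃) h)
    in N , λ m n hm hn →
      let a = seq x m; b = seq x n
          ha = hb m (h₁ hm); hb′ = hb n (h₁ hn)
      in ≤-castʳ (solve 4 (λ ρ M T ε → ρ :* M :* (T :* ε) :+ ε :* (M :* T) :+ ρ :* M :* (T :* ε)
                                    := (ρ :* M :* T :+ M :* T :+ ρ :* M :* T) :* ε) refl ρ M T ε)
        (≤-trans (∣∣-triangle (P a (suc m)) (P b (suc N₂)) (P b (suc n)))
          (+-mono-≤
            (≤-trans (∣∣-triangle (P a (suc m)) (P a (suc N₂)) (P b (suc N₂)))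
              (+-mono-≤ (P-tail′ ha (h₂ hm) hr)
                (≤-trans (P-lip ha hb′ N₂)
                  (*-mono (0≤∣p∣ (a - b)) (0≤* 0≤M (<⇒≤ 0<T)) (hc m n (h₃ hm) (h₃ hn))
                    (*ˡ-mono 0≤M (G≤T N₂))))))
            (≤-castˡ (∣-swap∣ (P b (suc n)) (P b (suc N₂))) (P-tail′ hb′ (h₂ hn) hr))))
    where
    K = ρ * M * T + M * T + ρ * M * T
    0≤ρMT : 0ℚ ≤ ρ * M * T
    0≤ρMT = 0≤* (0≤* 0≤ρ 0≤M) (<⇒≤ 0<T)

powerSeries : (c : ℕ → ℚ) (x : ℝ) → Dominated c x → ℝ
powerSeries c x D = mkℝ (λ n → partialSum c (seq x n) (suc n)) (PowerSeries.cauchy D)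

expCoeff : ℕ → ℚ
expCoeff k = 1 ÷ℕ (k !)

module ExpLemmas where

  fromℕ-* : ∀ m n → fromℕ (m ℕ.* n) ≡ fromℕ m * fromℕ n
  fromℕ-* zero    n = sym (*-zeroˡ (fromℕ n))
  fromℕ-* (suc m) n = trans (fromℕ-+ n (m ℕ.* n)) (trans (cong (λ t → fromℕ n + t) (fromℕ-* m n))
    (trans (solve 2 (λ m n → n :+ m :* n := (m :+ con 1ℚ) :* n) refl (fromℕ m) (fromℕ n))
      (cong (_* fromℕ n) (sym (fromℕ-suc m)))))

  0<fromℕ : ∀ {n} → 0 ℕ.< n → 0ℚ < fromℕ n
  0<fromℕ {n} 0<n = <-≤-trans (from-yes (0ℚ <? 1ℚ)) (fromℕ-mono 0<n)

  0<1÷ : ∀ {n} → 0 ℕ.< n → 0ℚ < 1 ÷ℕ n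
  0<1÷ {n} 0<n = 0<* (from-yes (0ℚ <? 1ℚ)) (inv-pos (0<fromℕ 0<n))

  n*1÷n : ∀ {n} → 0 ℕ.< n → fromℕ n * (1 ÷ℕ n) ≡ 1ℚ
  n*1÷n {n} 0<n = trans (cong (fromℕ n *_) (*-identityˡ (inv (fromℕ n)))) (pos*inv (0<fromℕ 0<n))

  0<! : ∀ k → 0 ℕ.< k !
  0<! k = ℕₚ.1≤n! k

  0≤expCoeff : ∀ k → 0ℚ ≤ expCoeff k
  0≤expCoeff k = <⇒≤ (0<1÷ (0<! k))

  expCoeff-suc : ∀ k → fromℕ (suc k) * expCoeff (suc k) ≡ expCoeff k
  expCoeff-suc k = begin
    s * e′             ≡⟨ sym (*-identityˡ (s * e′)) ⟩
    1ℚ * (s * e′)      ≡⟨ cong (_* (s * e′)) (sym (n*1÷n (0<! k))) ⟩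
    f * e * (s * e′)   ≡⟨ solve 4 (λ f e s e′ → f :* e :* (s :* e′) := e :* (s :* f :* e′)) refl f e s e′ ⟩
    e * (s * f * e′)   ≡⟨ cong (λ t → e * (t * e′)) (sym (fromℕ-* (suc k) (k !))) ⟩
    e * (fromℕ (suc k !) * e′) ≡⟨ cong (e *_) (n*1÷n (0<! (suc k))) ⟩
    e * 1ℚ             ≡⟨ *-identityʳ e ⟩
    e                  ∎
    where
    open ≡-Reasoning
    s = fromℕ (suc k)
    f = fromℕ (k !)
    e = expCoeff k
    e′ = expCoeff (suc k)

  *-^ : ∀ p q n → (p * q) ^ℚ n ≡ p ^ℚ n * q ^ℚ n
  *-^ p q zero    = refl
  *-^ p q (suc n) = trans (cong (p * q *_) (*-^ p q n))
    (solve 4 (λ p q s t → p :* q :* (s :* t) := (p :* s) :* (q :* t)) refl p q (p ^ℚ n) (q ^ℚ n))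

  Σ-nonneg : ∀ {f} → (∀ k → 0ℚ ≤ f k) → ∀ n → 0ℚ ≤ Σ[ n ] f
  Σ-nonneg 0≤f zero    = ≤-refl
  Σ-nonneg 0≤f (suc n) = 0≤+ (Σ-nonneg 0≤f n) (0≤f n)

  Σ-mono : ∀ {f} → (∀ k → 0ℚ ≤ f k) → ∀ m j → Σ[ m ] f ≤ Σ[ j ℕ.+ m ] f
  Σ-mono 0≤f m zero    = ≤-refl
  Σ-mono 0≤f m (suc j) = ≤-trans (Σ-mono 0≤f m j) (p≤p+q (0≤f (j ℕ.+ m)))

  term≤Σ : ∀ {f} → (∀ k → 0ℚ ≤ f k) → ∀ k j → f k ≤ Σ[ j ℕ.+ suc k ] f
  term≤Σ {f} 0≤f k j = ≤-trans
    (≤-castʳ (+-comm (f k) (Σ[ k ] f)) (p≤p+q {f k} (Σ-nonneg 0≤f k)))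
    (Σ-mono 0≤f (suc k) j)

  -- Bᵏ / k! is nonincreasing from k = B on
  module Majorant (B : ℕ) where

    t : ℕ → ℚ
    t k = expCoeff k * fromℕ B ^ℚ k

    0≤t : ∀ k → 0ℚ ≤ t k
    0≤t k = 0≤* (0≤expCoeff k) (0≤^ (0≤fromℕ B) k)

    M : ℚ
    M = Σ[ suc B ] t

    t-step : ∀ k → B ℕ.≤ suc k → t (suc k) ≤ t k
    t-step k B≤k = *-cancelˡ-≤-pos (fromℕ (suc k)) {{normalize-pos (suc k) 1}}
      (≤-castˡ (sym eq) (*ʳ-mono (0≤t k) (fromℕ-mono B≤k)))
      where
      eq : fromℕ (suc k) * t (suc k) ≡ fromℕ B * t k
      eq = trans (solve 4 (λ s e b p → s :* (e :* (b :* p)) := b :* ((s :* e) :* p))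
                   refl (fromℕ (suc k)) (expCoeff (suc k)) (fromℕ B) (fromℕ B ^ℚ k))
             (cong (λ e → fromℕ B * (e * fromℕ B ^ℚ k)) (expCoeff-suc k))

    t-late : ∀ j → t (j ℕ.+ B) ≤ M
    t-late zero    = term≤Σ 0≤t B 0
    t-late (suc j) = ≤-trans (t-step (j ℕ.+ B) (ℕₚ.m≤n⇒m≤1+n (ℕₚ.m≤n+m B j))) (t-late j)

    t≤M : ∀ k → t k ≤ M
    t≤M k with ℕₚ.≤-total B k
    ... | inj₁ B≤k = subst (λ m → t m ≤ M) (ℕₚ.m∸n+n≡m B≤k) (t-late (k ℕ.∸ B))
    ... | inj₂ k≤B = subst (λ m → t k ≤ Σ[ m ] t) (ℕₚ.m∸n+n≡m (s≤s k≤B)) (term≤Σ 0≤t k (B ℕ.∸ k))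

open ExpLemmas

exp-dominated : ∀ x → Dominated expCoeff x
exp-dominated x = record
  { ρ = ½ * fromℕ B ; M = M ; r = ½
  ; 0≤ρ = 0≤* 0≤½ (0≤fromℕ B)
  ; 0≤M = Σ-nonneg 0≤t (suc B)
  ; 0≤r = 0≤½
  ; r<1 = from-yes (½ <? 1ℚ)
  ; bound = mapᵉ (λ n h → ≤-trans h C≤ρ) ev
  ; coeff = λ k → ≤-castˡ (sym (eq k)) (*ʳ-mono (0≤^ 0≤½ k) (t≤M k))
  }
  where
  0≤½ : 0ℚ ≤ ½
  0≤½ = from-yes (0ℚ ≤? ½)
  bnd : ∃ λ B → 0ℚ < B × Eventually λ n → ∣ seq x n ∣ ≤ B
  bnd = bounded {seq x} (isCauchy x)
  C : ℚ
  C = proj₁ bnd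
  ev : Eventually λ n → ∣ seq x n ∣ ≤ C
  ev = proj₂ (proj₂ bnd)
  A : ∃ λ n → C + C ≤ fromℕ n
  A = arch (C + C)
  B : ℕ
  B = proj₁ A
  open Majorant B
  C≤ρ : C ≤ ½ * fromℕ B
  C≤ρ = ≤-castˡ (solve 1 (λ c → con ½ :* (c :+ c) := c) refl C) (*ˡ-mono 0≤½ (proj₂ A))
  eq : ∀ k → fromℕ (suc k) * ∣ expCoeff (suc k) ∣ * (½ * fromℕ B) ^ℚ k ≡ t k * ½ ^ℚ k
  eq k = begin
    fromℕ (suc k) * ∣ expCoeff (suc k) ∣ * (½ * fromℕ B) ^ℚ k
      ≡⟨ cong₂ (λ e p → fromℕ (suc k) * e * p) (0≤p⇒∣p∣≡p (0≤expCoeff (suc k))) (*-^ ½ (fromℕ B) k) ⟩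
    fromℕ (suc k) * expCoeff (suc k) * (½ ^ℚ k * fromℕ B ^ℚ k)
      ≡⟨ cong (_* (½ ^ℚ k * fromℕ B ^ℚ k)) (expCoeff-suc k) ⟩
    expCoeff k * (½ ^ℚ k * fromℕ B ^ℚ k)
      ≡⟨ solve 3 (λ e h b → e :* (h :* b) := e :* b :* h) refl (expCoeff k) (½ ^ℚ k) (fromℕ B ^ℚ k) ⟩
    t k * ½ ^ℚ k ∎
    where open ≡-Reasoning

exp : ℝ → ℝ
exp x = powerSeries expCoeff x (exp-dominated x)

-- log x = 2 artanh ((x - 1) / (x + 1))  for x > 0  and
-- artanh z = z Σ_k (z²)ᵏ / (2k + 1)  for |z| < 1

artanhCoeff : ℕ → ℚ
artanhCoeff k = 1 ÷ℕ (2 ℕ.* k ℕ.+ 1)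

module LogLemmas where

  0<2k+1 : ∀ k → 0 ℕ.< 2 ℕ.* k ℕ.+ 1
  0<2k+1 k = ℕₚ.m≤n+m 1 (2 ℕ.* k)

  0≤artanhCoeff : ∀ k → 0ℚ ≤ artanhCoeff k
  0≤artanhCoeff k = <⇒≤ (0<1÷ (0<2k+1 k))

  artanh-dominated : ∀ z ρ → 0ℚ ≤ ρ → ρ < 1ℚ → Eventually (λ n → ∣ seq z n ∣ ≤ ρ) →
                     Dominated artanhCoeff z
  artanh-dominated z ρ 0≤ρ ρ<1 ev = record
    { ρ = ρ ; M = 1ℚ ; r = ρ
    ; 0≤ρ = 0≤ρ ; 0≤M = from-yes (0ℚ ≤? 1ℚ) ; 0≤r = 0≤ρ ; r<1 = ρ<1
    ; bound = ev
    ; coeff = λ k → *ʳ-mono (0≤^ 0≤ρ k) (coeff≤1 k)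
    }
    where
    k+1≤ : ∀ k → suc k ℕ.≤ 2 ℕ.* suc k ℕ.+ 1
    k+1≤ k = ℕₚ.≤-trans (ℕₚ.m≤n*m (suc k) 2) (ℕₚ.m≤m+n (2 ℕ.* suc k) 1)
    coeff≤1 : ∀ k → fromℕ (suc k) * ∣ artanhCoeff (suc k) ∣ ≤ 1ℚ
    coeff≤1 k = ≤-castˡ (cong (fromℕ (suc k) *_) (sym (0≤p⇒∣p∣≡p (0≤artanhCoeff (suc k)))))
      (≤-castʳ (n*1÷n (0<2k+1 (suc k)))
        (*ʳ-mono (0≤artanhCoeff (suc k)) (fromℕ-mono (k+1≤ k))))

  x+1-pos : ∀ x → 0ʳ <ʳ x → 0ʳ <ʳ x +ʳ 1ʳ
  x+1-pos x (ε , 0<ε , ev) = ε , 0<ε , mapᵉ (λ n h → ≤-trans h (p≤p+q (from-yes (0ℚ ≤? 1ℚ)))) ev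

  möbius : (x : ℝ) → 0ʳ <ʳ x → ℝ
  möbius x 0<x = (x -ʳ 1ʳ) *ʳ recip (x +ʳ 1ʳ) (x+1-pos x 0<x)

  -- For ε ≤ x ≤ B one has |x - 1| / (x + 1) ≤ 1 - (ε ⊓ 1) / (B + 1).
  möbius<1 : ∀ x 0<x → ∃ λ ρ → 0ℚ ≤ ρ × ρ < 1ℚ × Eventually λ n → ∣ seq (möbius x 0<x) n ∣ ≤ ρ
  möbius<1 x (ε , 0<ε , ev) = ρ , 0≤ρ , ρ<1 , (ev ⟪ (λ n h h′ → step (≤-castˡ (+-identityˡ ε) h) h′) ⟫ evB)
    where
    0≤1 = from-yes (0ℚ ≤? 1ℚ)
    0<1 = from-yes (0ℚ <? 1ℚ)
    bnd = bounded {seq x} (isCauchy x)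
    B   = proj₁ bnd
    0<B = proj₁ (proj₂ bnd)
    evB = proj₂ (proj₂ bnd)
    e   = ε ⊓ 1ℚ
    0<e : 0ℚ < e
    0<e with ≤-total ε 1ℚ
    ... | inj₁ h = subst (0ℚ <_) (sym (p≤q⇒p⊓q≡p h)) 0<ε
    ... | inj₂ h = subst (0ℚ <_) (sym (p≥q⇒p⊓q≡q h)) 0<1
    0<B+1 : 0ℚ < B + 1ℚ
    0<B+1 = 0<+ 0<B 0≤1
    c   = e * inv (B + 1ℚ)
    0<c : 0ℚ < c
    0<c = 0<* 0<e (inv-pos 0<B+1)
    ρ   = 1ℚ - c
    c≤1 : c ≤ 1ℚ
    c≤1 = ≤-trans (*ʳ-mono (<⇒≤ (inv-pos 0<B+1)) (≤-trans (p⊓q≤q ε 1ℚ) (≤-castʳ (+-comm 1ℚ B) (p≤p+q {1ℚ} (<⇒≤ 0<B)))))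
            (≤-reflexive (pos*inv 0<B+1))
    0≤ρ : 0ℚ ≤ ρ
    0≤ρ = p≤q⇒0≤q-p c≤1
    ρ<1 : ρ < 1ℚ
    ρ<1 = subst (ρ <_) (+-identityʳ 1ℚ) (+-monoʳ-< 1ℚ (neg-antimono-< 0<c))
    step : ∀ {a} → ε ≤ a → ∣ a ∣ ≤ B → ∣ (a - 1ℚ) * inv (a + 1ℚ) ∣ ≤ ρ
    step {a} ε≤a a≤B = ≤-castˡ (sym (trans (∣p*q∣≡∣p∣*∣q∣ (a - 1ℚ) i) (cong (∣ a - 1ℚ ∣ *_) (0≤p⇒∣p∣≡p 0≤i))))
      (≤-trans (*ʳ-mono 0≤i ∣a-1∣≤)
      (≤-castˡ (sym (trans (solve 3 (λ a e i → ((a :+ con 1ℚ) :+ :- e) :* i := (a :+ con 1ℚ) :* i :+ :- (e :* i)) refl a e i)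
                      (cong (_- e * i) (pos*inv 0<a+1))))
        (+-monoʳ-≤ 1ℚ (neg-antimono-≤ (*ˡ-mono (<⇒≤ 0<e)
          (inv-antimono 0<a+1 (+-monoˡ-≤ 1ℚ (≤-trans (p≤∣p∣ a) a≤B))))))))
      where
      0<a+1 : 0ℚ < a + 1ℚ
      0<a+1 = 0<+ (<-≤-trans 0<ε ε≤a) 0≤1
      i = inv (a + 1ℚ)
      0≤i : 0ℚ ≤ i
      0≤i = <⇒≤ (inv-pos 0<a+1)
      ∣a-1∣≤ : ∣ a - 1ℚ ∣ ≤ a + 1ℚ - e
      ∣a-1∣≤ = ∣p∣≤
        (0≤q-p⇒p≤q (≤-castʳ (solve 2 (λ a e → (con 1ℚ :+ :- e) :+ con 1ℚ := ((a :+ con 1ℚ) :+ :- e) :+ :- (a :+ :- con 1ℚ)) refl a e)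
          (0≤+ (p≤q⇒0≤q-p (p⊓q≤q ε 1ℚ)) 0≤1)))
        (0≤q-p⇒p≤q (≤-castʳ (solve 2 (λ a e → (a :+ :- e) :+ a := ((a :+ con 1ℚ) :+ :- e) :+ :- (:- (a :+ :- con 1ℚ))) refl a e)
          (0≤+ (p≤q⇒0≤q-p (≤-trans (p⊓q≤p ε 1ℚ) ε≤a)) (≤-trans (<⇒≤ 0<ε) ε≤a))))

  möbius²-dominated : ∀ x 0<x → Dominated artanhCoeff (möbius x 0<x *ʳ möbius x 0<x)
  möbius²-dominated x 0<x = let (ρ , 0≤ρ , ρ<1 , ev) = möbius<1 x 0<x in
    artanh-dominated (möbius x 0<x *ʳ möbius x 0<x) ρ 0≤ρ ρ<1
      (mapᵉ (λ n h → ≤-castˡ (sym (∣p*q∣≡∣p∣*∣q∣ (seq (möbius x 0<x) n) (seq (möbius x 0<x) n)))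
        (≤-trans (*-mono (0≤∣p∣ (seq (möbius x 0<x) n)) 0≤ρ h h)
          (≤-castʳ (*-identityʳ ρ) (*ˡ-mono 0≤ρ (<⇒≤ ρ<1))))) ev)

open LogLemmas

log : (x : ℝ) → 0ʳ <ʳ x → ℝ
log x 0<x = fromℚ (fromℕ 2) *ʳ
  (möbius x 0<x *ʳ powerSeries artanhCoeff (möbius x 0<x *ʳ möbius x 0<x) (möbius²-dominated x 0<x))

infixr 8 _^ʳ_⟨_⟩

_^ʳ_⟨_⟩ : (x : ℝ) → ℚ → 0ʳ <ʳ x → ℝ
x ^ʳ r ⟨ 0<x ⟩ = exp (fromℚ r *ʳ log x 0<x)

module LogPositivity where

  series≥ : ∀ {w} → 0ℚ ≤ w → ∀ n → 1 ℕ.≤ n → 1ℚ + (1 ÷ℕ 3) * w ≤ partialSum artanhCoeff w (suc n)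
  series≥ {w} 0≤w (suc n) _ = ≤-trans (≤-reflexive eq)
    (subst (λ m → Σ[ 2 ] f ≤ Σ[ m ] f) (ℕₚ.+-comm n 2) (Σ-mono 0≤f 2 n))
    where
    f : ℕ → ℚ
    f k = artanhCoeff k * w ^ℚ k
    0≤f : ∀ k → 0ℚ ≤ f k
    0≤f k = 0≤* (0≤artanhCoeff k) (0≤^ 0≤w k)
    eq : 1ℚ + (1 ÷ℕ 3) * w ≡ 0ℚ + 1ℚ * 1ℚ + (1 ÷ℕ 3) * (w * 1ℚ)
    eq = solve 2 (λ c w → con 1ℚ :+ c :* w := con 0ℚ :+ con 1ℚ :* con 1ℚ :+ c :* (w :* con 1ℚ)) refl (1 ÷ℕ 3) w

  log-bound : ∀ x 0<x ζ → 0ℚ ≤ ζ → Eventually (λ n → ζ ≤ seq (möbius x 0<x) n) →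
              Eventually λ n → fromℕ 2 * (ζ * (1ℚ + (1 ÷ℕ 3) * (ζ * ζ))) ≤ seq (log x 0<x) n
  log-bound x 0<x ζ 0≤ζ ev = ev ⟪ step ⟫ (1 , λ n h → h)
    where
    step : ∀ n → ζ ≤ seq (möbius x 0<x) n → 1 ℕ.≤ n → _
    step n h 1≤n = *ˡ-mono (0≤fromℕ 2) (*-mono 0≤ζ 0≤S h
      (≤-trans (+-monoʳ-≤ 1ℚ (*ˡ-mono 0≤⅓ (*-mono 0≤ζ 0≤z h h))) S≥))
      where
      z   = seq (möbius x 0<x) n
      0≤⅓ = from-yes (0ℚ ≤? 1 ÷ℕ 3)
      0≤z = ≤-trans 0≤ζ h
      S≥  = series≥ (0≤* 0≤z 0≤z) n 1≤n
      0≤S = ≤-trans (0≤+ (from-yes (0ℚ ≤? 1ℚ)) (0≤* 0≤⅓ (0≤* 0≤z 0≤z))) S≥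

  1<⇒0< : ∀ x → 1ʳ <ʳ x → 0ʳ <ʳ x
  1<⇒0< x (ε , 0<ε , ev) = ε , 0<ε , mapᵉ (λ n → ≤-trans (+-monoˡ-≤ ε (from-yes (0ℚ ≤? 1ℚ)))) ev

  1<⇒0<log : ∀ x 0<x → 1ʳ <ʳ x → 0ʳ <ʳ log x 0<x
  1<⇒0<log x 0<x (ε , 0<ε , ev) = _ , 0<* (from-yes (0ℚ <? fromℕ 2)) (0<* 0<ζ (0<+ (from-yes (0ℚ <? 1ℚ)) 0≤⅓ζ²)) ,
    mapᵉ (λ n → ≤-castˡ (sym (+-identityˡ _))) (log-bound x 0<x ζ (<⇒≤ 0<ζ) (ev ⟪ (λ n → step) ⟫ evB))
    where
    bnd : ∃ λ B → 0ℚ < B × Eventually λ n → ∣ seq x n ∣ ≤ B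
    bnd = bounded {seq x} (isCauchy x)
    B : ℚ
    B = proj₁ bnd
    0<B : 0ℚ < B
    0<B = proj₁ (proj₂ bnd)
    evB : Eventually λ n → ∣ seq x n ∣ ≤ B
    evB = proj₂ (proj₂ bnd)
    ζ : ℚ
    ζ = ε * inv (B + 1ℚ)
    0<ζ : 0ℚ < ζ
    0<ζ = 0<* 0<ε (inv-pos (0<+ 0<B (from-yes (0ℚ ≤? 1ℚ))))
    0≤⅓ζ² : 0ℚ ≤ (1 ÷ℕ 3) * (ζ * ζ)
    0≤⅓ζ² = 0≤* (from-yes (0ℚ ≤? 1 ÷ℕ 3)) (0≤* (<⇒≤ 0<ζ) (<⇒≤ 0<ζ))
    step : ∀ {a} → 1ℚ + ε ≤ a → ∣ a ∣ ≤ B → ζ ≤ (a - 1ℚ) * inv (a + 1ℚ)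
    step {a} h a≤B = *-mono (<⇒≤ 0<ε) (<⇒≤ (inv-pos 0<a+1))
      (≤-castˡ (solve 1 (λ e → con 1ℚ :+ e :+ :- con 1ℚ := e) refl ε) (+-monoˡ-≤ (- 1ℚ) h))
      (inv-antimono 0<a+1 (+-monoˡ-≤ 1ℚ (≤-trans (p≤∣p∣ a) a≤B)))
      where
      0<a+1 : 0ℚ < a + 1ℚ
      0<a+1 = 0<+ (<-≤-trans (0<+ (from-yes (0ℚ <? 1ℚ)) (<⇒≤ 0<ε)) h) (from-yes (0ℚ ≤? 1ℚ))

  -- x eventually exceeds 29/10, where (x - 1) / (x + 1) ≥ 19/39.
  3≤⇒ev : ∀ x → fromℚ (fromℕ 3) ≤ʳ x → Eventually λ n → 29 ÷ℕ 10 ≤ seq x n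
  3≤⇒ev x h = mapᵉ (λ n h′ → ≤-castʳ (solve 2 (λ a e → a :+ e :+ :- e := a) refl (seq x n) (1 ÷ℕ 10))
                      (≤-castˡ (from-yes (fromℕ 3 - 1 ÷ℕ 10 ≟ 29 ÷ℕ 10)) (+-monoˡ-≤ (- (1 ÷ℕ 10)) h′)))
    (h (1 ÷ℕ 10) (from-yes (0ℚ <? 1 ÷ℕ 10)))

  3≤⇒0< : ∀ x → fromℚ (fromℕ 3) ≤ʳ x → 0ʳ <ʳ x
  3≤⇒0< x h = 29 ÷ℕ 10 , from-yes (0ℚ <? 29 ÷ℕ 10) , mapᵉ (λ n → ≤-castˡ (sym (+-identityˡ (29 ÷ℕ 10)))) (3≤⇒ev x h)

  3≤⇒1<log : ∀ x 0<x → fromℚ (fromℕ 3) ≤ʳ x → 1ʳ <ʳ log x 0<x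
  3≤⇒1<log x 0<x h = 1 ÷ℕ 100 , from-yes (0ℚ <? 1 ÷ℕ 100) ,
    mapᵉ (λ n → ≤-trans (from-yes (1ℚ + 1 ÷ℕ 100 ≤? fromℕ 2 * (ζ * (1ℚ + (1 ÷ℕ 3) * (ζ * ζ))))))
      (log-bound x 0<x ζ (from-yes (0ℚ ≤? ζ)) (mapᵉ (λ n → step) (3≤⇒ev x h)))
    where
    ζ : ℚ
    ζ = 19 ÷ℕ 39
    step : ∀ {a} → 29 ÷ℕ 10 ≤ a → ζ ≤ (a - 1ℚ) * inv (a + 1ℚ)
    step {a} h = ≤-castˡ eq (*ʳ-mono (<⇒≤ (inv-pos 0<a+1)) ineq)
      where
      0<a+1 : 0ℚ < a + 1ℚ
      0<a+1 = 0<+ (<-≤-trans (from-yes (0ℚ <? 29 ÷ℕ 10)) h) (from-yes (0ℚ ≤? 1ℚ))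
      eq : ζ * (a + 1ℚ) * inv (a + 1ℚ) ≡ ζ
      eq = trans (*-assoc ζ (a + 1ℚ) (inv (a + 1ℚ))) (trans (cong (ζ *_) (pos*inv 0<a+1)) (*-identityʳ ζ))
      ineq : ζ * (a + 1ℚ) ≤ a - 1ℚ
      ineq = 0≤q-p⇒p≤q (≤-castʳ
        (solve 1 (λ a → con (20 ÷ℕ 39) :* (a :+ :- con (29 ÷ℕ 10))
                     := (a :+ :- con 1ℚ) :+ :- (con ζ :* (a :+ con 1ℚ))) refl a)
        (0≤* (from-yes (0ℚ ≤? 20 ÷ℕ 39)) (p≤q⇒0≤q-p h)))

open LogPositivity

-- π = 4 (1 - 1/3 + 1/5 - …)

leibniz : ℕ → ℚ
leibniz n = Σ[ n ] λ k → (- 1ℚ) ^ℚ k * (1 ÷ℕ (2 ℕ.* k ℕ.+ 1))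

module LeibnizLemmas where

  a : ℕ → ℚ
  a k = 1 ÷ℕ (2 ℕ.* k ℕ.+ 1)

  a-antimono : ∀ {j k} → j ℕ.≤ k → a k ≤ a j
  a-antimono {j} {k} j≤k = *ˡ-mono (from-yes (0ℚ ≤? 1ℚ)) (inv-antimono (0<fromℕ (0<2k+1 j))
    (fromℕ-mono (ℕₚ.+-monoˡ-≤ 1 (ℕₚ.*-monoʳ-≤ 2 j≤k))))

  -- a j - a (j + 1) + … with n terms
  t : ℕ → ℕ → ℚ
  t j zero    = 0ℚ
  t j (suc n) = a j - t (suc j) n

  split : ∀ n j → leibniz (n ℕ.+ j) ≡ leibniz j + (- 1ℚ) ^ℚ j * t j n
  split zero    j = sym (trans (cong (λ t → leibniz j + t) (*-zeroʳ ((- 1ℚ) ^ℚ j))) (+-identityʳ (leibniz j)))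
  split (suc n) j = trans (cong leibniz (sym (ℕₚ.+-suc n j))) (trans (split n (suc j))
    (solve 4 (λ l s a t → l :+ s :* a :+ (con (- 1ℚ) :* s) :* t := l :+ s :* (a :+ :- t))
      refl (leibniz j) ((- 1ℚ) ^ℚ j) (a j) (t (suc j) n)))

  t-bounds : ∀ n j → 0ℚ ≤ t j n × t j n ≤ a j
  t-bounds zero    j = ≤-refl , 0≤artanhCoeff j
  t-bounds (suc n) j = let (lo , hi) = t-bounds n (suc j) in
    p≤q⇒0≤q-p (≤-trans hi (a-antimono (ℕₚ.n≤1+n j))) ,
    ≤-castʳ (+-identityʳ (a j)) (+-monoʳ-≤ (a j) (neg-antimono-≤ lo))

  ∣±1∣ : ∀ j → ∣ (- 1ℚ) ^ℚ j ∣ ≤ 1ℚ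
  ∣±1∣ j = ≤-trans (∣^∣≤ { - 1ℚ} {1ℚ} (from-yes (∣ - 1ℚ ∣ ≤? 1ℚ)) j) (≤-reflexive (1^ j))
    where
    1^ : ∀ n → 1ℚ ^ℚ n ≡ 1ℚ
    1^ zero    = refl
    1^ (suc n) = trans (*-identityˡ (1ℚ ^ℚ n)) (1^ n)

  tail : ∀ {m N} → N ℕ.≤ m → ∣ leibniz m - leibniz N ∣ ≤ a N
  tail {m} {N} N≤m = subst (λ k → ∣ leibniz k - leibniz N ∣ ≤ a N) (ℕₚ.m∸n+n≡m N≤m)
    (≤-castˡ (sym (trans (cong ∣_∣ (trans (cong (_- leibniz N) (split n N))
                 (solve 2 (λ l u → l :+ u :+ :- l := u) refl (leibniz N) ((- 1ℚ) ^ℚ N * t N n))))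
               (∣p*q∣≡∣p∣*∣q∣ ((- 1ℚ) ^ℚ N) (t N n))))
      (≤-trans (*-mono (0≤∣p∣ ((- 1ℚ) ^ℚ N)) (0≤artanhCoeff N) (∣±1∣ N)
                 (≤-castˡ (sym (0≤p⇒∣p∣≡p (proj₁ (t-bounds n N)))) (proj₂ (t-bounds n N))))
        (≤-reflexive (*-identityˡ (a N)))))
    where n = m ℕ.∸ N

  a-small : ∀ ε → 0ℚ < ε → ∃ λ N → a N ≤ ε
  a-small ε 0<ε = let (n , h) = arch₂ 1ℚ 0<ε in suc n ,
    *-cancelˡ-≤-pos (fromℕ (suc n)) {{normalize-pos (suc n) 1}}
      (≤-trans (≤-castʳ (n*1÷n (0<2k+1 (suc n)))
        (*ʳ-mono (0≤artanhCoeff (suc n)) (fromℕ-mono (ℕₚ.≤-trans (ℕₚ.m≤n*m (suc n) 2) (ℕₚ.m≤m+n (2 ℕ.* suc n) 1)))))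
        h)

  leibniz-cauchy : Cauchy leibniz
  leibniz-cauchy = cauchyᴷ leibniz (1ℚ + 1ℚ) (from-yes (0ℚ ≤? 1ℚ + 1ℚ)) λ ε 0<ε →
    let (N , h) = a-small ε 0<ε in N , λ m n hm hn →
      ≤-castʳ (solve 1 (λ e → e :+ e := (con 1ℚ :+ con 1ℚ) :* e) refl ε)
        (≤-trans (∣∣-triangle (leibniz m) (leibniz N) (leibniz n))
          (+-mono-≤ (≤-trans (tail hm) h)
            (≤-castˡ (∣-swap∣ (leibniz n) (leibniz N)) (≤-trans (tail hn) h))))

  leibniz≥½ : ∀ n → 1 ℕ.≤ n → ½ ≤ leibniz n
  leibniz≥½ (suc n) _ = ≤-trans (from-yes (½ ≤? a 0 - a 1))
    (≤-trans (+-monoʳ-≤ (a 0) (neg-antimono-≤ (proj₂ (t-bounds n 1))))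
      (≤-reflexive (sym (trans (cong leibniz (sym (ℕₚ.+-identityʳ (suc n)))) (trans (split (suc n) 0)
        (trans (+-identityˡ (1ℚ * t 0 (suc n))) (*-identityˡ (t 0 (suc n)))))))))

open LeibnizLemmas using (leibniz-cauchy; leibniz≥½)

π : ℝ
π = fromℚ (fromℕ 4) *ʳ mkℝ leibniz leibniz-cauchy

0<π : 0ʳ <ʳ π
0<π = fromℕ 4 * ½ , from-yes (0ℚ <? fromℕ 4 * ½) , 1 , λ n h →
  ≤-castˡ (sym (+-identityˡ (fromℕ 4 * ½))) (*ˡ-mono (0≤fromℕ 4) (leibniz≥½ n h))

3/π² : ℝ
3/π² = fromℚ (fromℕ 3) *ʳ (recip π 0<π *ʳ recip π 0<π)

-- exp (- A (log x)^0.6 / (log log x)^0.2), the division being written as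
-- multiplication by the power -0.2.  For x ≥ 3 both log x and log log x are
-- positive; the sequence does not depend on the proof of 3 ≤ x.

δ : (A x : ℝ) → fromℚ (fromℕ 3) ≤ʳ x → ℝ
δ A x 3≤x = exp (-ʳ (A *ʳ (L ^ʳ (+ 3 / 5) ⟨ 0<L ⟩ *ʳ L₂ ^ʳ (- (+ 1 / 5)) ⟨ 0<L₂ ⟩)))
  where
  0<x : 0ʳ <ʳ x
  0<x = 3≤⇒0< x 3≤x
  L : ℝ
  L = log x 0<x
  1<L : 1ʳ <ʳ L
  1<L = 3≤⇒1<log x 0<x 3≤x
  0<L : 0ʳ <ʳ L
  0<L = 1<⇒0< L 1<L
  L₂ : ℝ
  L₂ = log L 0<L
  0<L₂ : 0ʳ <ʳ L₂
  0<L₂ = 1<⇒0<log L 0<L 1<L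

fromℕ-mono-≤ʳ : ∀ {m n} → m ℕ.≤ n → fromℚ (fromℕ m) ≤ʳ fromℚ (fromℕ n)
fromℕ-mono-≤ʳ m≤n ε 0<ε = 0 , λ _ _ → ≤-trans (fromℕ-mono m≤n) (p≤p+q (<⇒≤ 0<ε))

φ : ℕ → ℕ
φ n = length (filter (λ k → coprime? k n) (map suc (upTo n)))

-- E(x) and H(x) for a real x whose integer part is n
E : ℝ → ℕ → ℝ
E x n = fromℚ (Σ[ n ] λ k → fromℕ (φ (suc k))) -ʳ 3/π² *ʳ (x *ʳ x)

H : ℝ → ℕ → ℝ
H x n = fromℚ (Σ[ n ] λ k → φ (suc k) ÷ℕ suc k) -ʳ fromℚ (fromℕ 2) *ʳ 3/π² *ʳ x

-- E(x) = x H(x) + O(x δ_A(x)).  The integer part of a real number is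
-- not computable, so it is passed as n with n ≤ x < n + 1.
WalfiszEstimate : ℝ → Set
WalfiszEstimate A = ∃ λ C →
  ∀ (x : ℝ) (n : ℕ) (3≤x : fromℚ (fromℕ 3) ≤ʳ x) →
  fromℚ (fromℕ n) ≤ʳ x → x <ʳ fromℚ (fromℕ (suc n)) →
  ∣ E x n -ʳ x *ʳ H x n ∣ʳ ≤ʳ C *ʳ (x *ʳ δ A x 3≤x)

open Data.List.Sort ≤-decTotalOrder using (sort)

Farey : ℕ → List ℚ
Farey N = sort (concatMap
  (λ b → map (_÷ℕ b) (filter (λ a → coprime? a b) (upTo (suc b))))
  (map suc (upTo N)))

-- I_N(x), the number of fractions of the Farey sequence in [0, x]
rank : ℕ → ℚ → ℕ
rank N x = length (filter (_≤? x) (Farey N))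

IsFareyFraction : ℕ → ℕ → Set
IsFareyFraction a b = 0 ℕ.< b × a ℕ.≤ b × Coprime a b

-- The second alternative is the exceptional pair 0/1, 1/0.
FareyPair : (a₁ b₁ a₂ b₂ : ℕ) → Set
FareyPair a₁ b₁ a₂ b₂ =
  (IsFareyFraction a₁ b₁ × IsFareyFraction a₂ b₂ × ℕ.∣ a₁ ℕ.* b₂ - a₂ ℕ.* b₁ ∣ ≡ 1)
  ⊎ (a₁ ≡ 0 × b₁ ≡ 1 × a₂ ≡ 1 × b₂ ≡ 0)

-- +1 if a₁/b₁ < a₂/b₂ and -1 otherwise; cross-multiplication also gives
-- 0/1 < 1/0.
side : (a₁ b₁ a₂ b₂ : ℕ) → ℚ
side a₁ b₁ a₂ b₂ = if does (a₁ ℕ.* b₂ ℕₚ.<? a₂ ℕ.* b₁) then 1ℚ else - 1ℚ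

lcmUpTo : ℕ → ℕ
lcmUpTo n = foldr lcm 1 (map suc (upTo n))

-- (3/π²) q (N²/(b²q²) - {N/(bq)}²)
mainTerm : (b q N : ℕ) → ℝ
mainTerm b q N = 3/π² *ʳ fromℚ (fromℕ q *
  ((N ℕ.^ 2) ÷ℕ (b ℕ.^ 2 ℕ.* q ℕ.^ 2) - frac (N ÷ℕ (b ℕ.* q)) ^ℚ 2))

{-# OPTIONS --safe #-}
module Submission where

-- Write 3/π² = p and N = b₁ L.  The fractions of F_N between a₁/b₁ and
-- (a₁ q + a₂)/(b₁ q + b₂) are (a₁ m + a₂ n)/(b₁ m + b₂ n) with m, n coprime,
-- m ≥ q n and b₁ m + b₂ n ≤ N.  This forces n ≤ i, so n divides L and the
-- number of admissible m is φ(n) (L/n - q) up to O(n).  With S = Σ φ(n) and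
-- T = Σ φ(n)/n over n ≤ i, the count is L T - q S + O(i²).
--
-- On [i, i + 1) the function E(x) - x H(x) is the quadratic polynomial
-- f(x) = S - x T + p x², and for x = L/q
--   L T - q S - p q (x² - (x - i)²) = q ((x - i) (T - 2 p i) - f(i)).
-- The bounds for f at i, i + ¼ and i + ½ provided by Walfisz's estimate control
-- f(i) and T - 2 p i = 6 f(i) - 8 f(i + ¼) + 2 f(i + ½), while the second
-- difference f(i) - 2 f(i + ¼) + f(i + ½) = p/8 shows that i δ(i) is bounded
-- below.  As (i - 1) i (i + 1) divides 2 L, this absorbs the error O(i²).
--
-- All that is needed of δ is δ(x) = O(δ(i)) for x ≥ i.
open import Defs

-- The lcm makes each column exact: from q n to L there is a whole number of periods modulo n, and
-- only boundary terms are lost. Their total O(i²) has nothing to do with δ, so a lower bound for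
-- δ(i) is needed to absorb it. It is extracted from Walfisz's estimate itself: a quadratic whose
-- leading coefficient is fixed cannot be small at three separated points, and this spares any
-- comparison of δ with powers of i. The three points stay inside [i, i + 1) because S and T jump at
-- i + 1; quarter steps leave room there. They bring in δ(i + ¼) and δ(i + ½), and this is why δ has
-- to be compared at different arguments. As δ is not antitone on the whole of [3, ∞), the
-- comparison costs a constant. Reals are Cauchy sequences compared up to ε at large indices. The
-- final algebra therefore takes place over ℚ at one large index n, with the n-th approximation of
-- 3/π² as p; the polynomial identities hold for every p, and of its value only a lower bound
-- matters.

-- Order on the Cauchy reals and the exponential function

module Analysis where

  open import Data.Nat.Base as ℕ using (ℕ; zero; suc; _∸_; z≤n; s≤s)
  import Data.Nat.Properties as ℕₚ
  open import Data.Product.Base using (_,_)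
  open import Data.Rational.Base
  open import Data.Rational.Properties
  open import Data.Rational.Solver
  open import Data.Sum.Base using (inj₁; inj₂)
  open import Relation.Binary.PropositionalEquality
  open import Relation.Nullary.Decidable using (from-yes)
  open +-*-Solver
  open ℚ-Lemmas
  open ℝ-Lemmas
  open ExpLemmas

  0≤1 : 0ℚ ≤ 1ℚ
  0≤1 = from-yes (0ℚ ≤? 1ℚ)

  0<1 : 0ℚ < 1ℚ
  0<1 = from-yes (0ℚ <? 1ℚ)

  ≤-by : ∀ {p q r} → 0ℚ ≤ r → r ≡ q - p → p ≤ q
  ≤-by 0≤r eq = 0≤q-p⇒p≤q (≤-castʳ eq 0≤r)

  ∣p∣≤⇒-q≤p : ∀ {p q} → ∣ p ∣ ≤ q → - q ≤ p
  ∣p∣≤⇒-q≤p {p} {q} h = ≤-by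
    (p≤q⇒0≤q-p (≤-trans (≤-trans (p≤∣p∣ (- p)) (≤-reflexive (∣-p∣≡∣p∣ p))) h))
    (solve 2 (λ p q → q :+ :- (:- p) := p :+ :- (:- q)) refl p q)

  ∣p∣≤⇒p≤q : ∀ {p q} → ∣ p ∣ ≤ q → p ≤ q
  ∣p∣≤⇒p≤q {p} h = ≤-trans (p≤∣p∣ p) h

  ⊓-pos : ∀ {p} → 0ℚ < p → 0ℚ < p ⊓ 1ℚ
  ⊓-pos {p} 0<p with ≤-total p 1ℚ
  ... | inj₁ h = subst (0ℚ <_) (sym (p≤q⇒p⊓q≡p h)) 0<p
  ... | inj₂ h = subst (0ℚ <_) (sym (p≥q⇒p⊓q≡q h)) 0<1

  0≤p² : ∀ p → 0ℚ ≤ p * p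
  0≤p² p with ≤-total 0ℚ p
  ... | inj₁ 0≤p = 0≤* 0≤p 0≤p
  ... | inj₂ p≤0 = ≤-castʳ (solve 1 (λ p → (:- p) :* (:- p) := p :* p) refl p)
                     (0≤* (neg-antimono-≤ p≤0) (neg-antimono-≤ p≤0))

  -- The order on ℝ

  -- Equality in ℝ. It is needed because `exp x *ʳ exp y` and `exp (x +ʳ y)` are given by different
  -- sequences: a product of two partial sums is not a partial sum.
  _≈ʳ_ : ℝ → ℝ → Set
  x ≈ʳ y = ∀ ε → 0ℚ < ε → Eventually λ n → ∣ seq x n - seq y n ∣ ≤ ε

  infix 4 _≈ʳ_

  always : ∀ {P : ℕ → Set} → (∀ n → P n) → Eventually P
  always p = 0 , λ n _ → p n

  ≤ʳ-eventually : ∀ x y → Eventually (λ n → seq x n ≤ seq y n) → x ≤ʳ y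
  ≤ʳ-eventually x y ev ε 0<ε = mapᵉ (λ n h → ≤-trans h (p≤p+q (<⇒≤ 0<ε))) ev

  ≤ʳ-pointwise : ∀ x y → (∀ n → seq x n ≤ seq y n) → x ≤ʳ y
  ≤ʳ-pointwise x y h = ≤ʳ-eventually x y (always h)

  -- Lets a proof lose a fixed factor in the slack. The slack is divided by `K + 1ℚ` since `K` may
  -- be 0.
  ≤ʳᴷ : ∀ x y K → 0ℚ ≤ K →
        (∀ ε → 0ℚ < ε → Eventually λ n → seq x n ≤ seq y n + K * ε) → x ≤ʳ y
  ≤ʳᴷ x y K 0≤K h ε 0<ε = mapᵉ (λ n e → ≤-trans e (+-monoʳ-≤ (seq y n) Kη≤ε)) (h η 0<η)
    where
    0<K+1 : 0ℚ < K + 1ℚ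
    0<K+1 = subst (0ℚ <_) (+-comm 1ℚ K) (0<+ 0<1 0≤K)
    η : ℚ
    η = inv (K + 1ℚ) * ε
    0<η : 0ℚ < η
    0<η = 0<* (inv-pos 0<K+1) 0<ε
    Kη≤ε : K * η ≤ ε
    Kη≤ε = ≤-castʳ (trans (sym (*-assoc (K + 1ℚ) (inv (K + 1ℚ)) ε))
        (trans (cong (_* ε) (pos*inv 0<K+1)) (*-identityˡ ε)))
      (*ʳ-mono {η} (<⇒≤ 0<η) (p≤p+q {K} 0≤1))

  ≤ʳ-trans : ∀ x y z → x ≤ʳ y → y ≤ʳ z → x ≤ʳ z
  ≤ʳ-trans x y z h h′ = ≤ʳᴷ x z (1ℚ + 1ℚ) (from-yes (0ℚ ≤? 1ℚ + 1ℚ)) λ ε 0<ε →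
    h ε 0<ε ⟪ (λ n a b → ≤-castʳ
      (solve 2 (λ z e → z :+ e :+ e := z :+ (con 1ℚ :+ con 1ℚ) :* e) refl (seq z n) ε)
      (≤-trans a (+-monoˡ-≤ ε b))) ⟫ h′ ε 0<ε

  ≈ʳ⇒≤ʳ : ∀ x y → x ≈ʳ y → x ≤ʳ y
  ≈ʳ⇒≤ʳ x y h ε 0<ε = mapᵉ (λ n e → ≤-by (p≤q⇒0≤q-p (∣p∣≤⇒p≤q e))
    (solve 3 (λ x y e → e :+ :- (x :+ :- y) := y :+ e :+ :- x) refl (seq x n) (seq y n) ε)) (h ε 0<ε)

  ≈ʳ-sym : ∀ x y → x ≈ʳ y → y ≈ʳ x
  ≈ʳ-sym x y h ε 0<ε = mapᵉ (λ n → ≤-castˡ (∣-swap∣ (seq x n) (seq y n))) (h ε 0<ε)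

  -- The approximations are only known to be at least -ε. Expanding (x + ε)(y + ε) ≥ 0 leaves the
  -- error ε (x + y) + ε², which the upper bounds `B`, `D` and ε ≤ 1 make linear in ε.
  0≤ʳ* : ∀ x y → 0ʳ ≤ʳ x → 0ʳ ≤ʳ y → 0ʳ ≤ʳ x *ʳ y
  0≤ʳ* x y 0≤x 0≤y =
    let (B , 0<B , evB) = bounded {seq x} (isCauchy x)
        (D , 0<D , evD) = bounded {seq y} (isCauchy y) in
    ≤ʳᴷ 0ʳ (x *ʳ y) (B + D + (1ℚ + 1ℚ)) (0≤+ (0≤+ (<⇒≤ 0<B) (<⇒≤ 0<D)) (from-yes (0ℚ ≤? 1ℚ + 1ℚ))) λ ε₀ 0<ε₀ →
      let ε = ε₀ ⊓ 1ℚ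
          0<ε = ⊓-pos 0<ε₀ in
      (0≤x ε 0<ε ⟪ (λ n a b → a , b) ⟫ 0≤y ε 0<ε) ⟪ (λ n → λ { (a , b) (c , d) → ≤-trans
        (≤-by (0≤+ (0≤+ (0≤+ (0≤* a b)
            (0≤* (<⇒≤ 0<ε) (p≤q⇒0≤q-p (∣p∣≤⇒p≤q c))))
            (0≤* (<⇒≤ 0<ε) (p≤q⇒0≤q-p (∣p∣≤⇒p≤q d))))
            (0≤* (<⇒≤ 0<ε) (0≤+ (p≤q⇒0≤q-p (p⊓q≤q ε₀ 1ℚ)) 0≤1)))
          (solve 5 (λ x y e B D → (x :+ e) :* (y :+ e) :+ e :* (B :+ :- x) :+ e :* (D :+ :- y) :+ e :* (con 1ℚ :+ :- e :+ con 1ℚ)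
             := x :* y :+ (B :+ D :+ (con 1ℚ :+ con 1ℚ)) :* e :+ :- con 0ℚ) refl (seq x n) (seq y n) ε B D))
        (+-monoʳ-≤ (seq x n * seq y n) (*ˡ-mono (0≤+ (0≤+ (<⇒≤ 0<B) (<⇒≤ 0<D)) (from-yes (0ℚ ≤? 1ℚ + 1ℚ))) (p⊓q≤p ε₀ 1ℚ)))})
        ⟫ (evB ⟪ (λ n a b → a , b) ⟫ evD)

  x≤y⇒0≤y-x : ∀ x y → x ≤ʳ y → 0ʳ ≤ʳ y -ʳ x
  x≤y⇒0≤y-x x y h ε 0<ε = mapᵉ (λ n e → ≤-by (p≤q⇒0≤q-p e)
    (solve 3 (λ x y e → y :+ e :+ :- x := y :+ :- x :+ e :+ :- con 0ℚ) refl (seq x n) (seq y n) ε)) (h ε 0<ε)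

  0≤y-x⇒x≤y : ∀ x y → 0ʳ ≤ʳ y -ʳ x → x ≤ʳ y
  0≤y-x⇒x≤y x y h ε 0<ε = mapᵉ (λ n e → ≤-by e
    (solve 3 (λ x y e → y :+ :- x :+ e := y :+ e :+ :- x) refl (seq x n) (seq y n) ε)) (h ε 0<ε)

  *ʳ-monoˡ : ∀ z x y → 0ʳ ≤ʳ z → x ≤ʳ y → z *ʳ x ≤ʳ z *ʳ y
  *ʳ-monoˡ z x y 0≤z x≤y = 0≤y-x⇒x≤y (z *ʳ x) (z *ʳ y)
    (≤ʳ-trans 0ʳ (z *ʳ (y -ʳ x)) (z *ʳ y -ʳ z *ʳ x)
      (0≤ʳ* z (y -ʳ x) 0≤z (x≤y⇒0≤y-x x y x≤y))
      (≤ʳ-pointwise (z *ʳ (y -ʳ x)) (z *ʳ y -ʳ z *ʳ x) λ n → ≤-reflexive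
        (solve 3 (λ z x y → z :* (y :+ :- x) := z :* y :+ :- (z :* x)) refl (seq z n) (seq x n) (seq y n))))

  *ʳ-monoʳ : ∀ z x y → 0ʳ ≤ʳ z → x ≤ʳ y → x *ʳ z ≤ʳ y *ʳ z
  *ʳ-monoʳ z x y 0≤z x≤y = ≤ʳ-trans (x *ʳ z) (z *ʳ y) (y *ʳ z)
    (≤ʳ-trans (x *ʳ z) (z *ʳ x) (z *ʳ y)
      (≤ʳ-pointwise (x *ʳ z) (z *ʳ x) λ n → ≤-reflexive (*-comm (seq x n) (seq z n)))
      (*ʳ-monoˡ z x y 0≤z x≤y))
    (≤ʳ-pointwise (z *ʳ y) (y *ʳ z) λ n → ≤-reflexive (*-comm (seq z n) (seq y n)))

  -ʳ-antimono : ∀ x y → x ≤ʳ y → -ʳ y ≤ʳ -ʳ x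
  -ʳ-antimono x y h ε 0<ε = mapᵉ (λ n e → ≤-by (p≤q⇒0≤q-p e)
    (solve 3 (λ x y e → y :+ e :+ :- x := :- x :+ e :+ :- (:- y)) refl (seq x n) (seq y n) ε)) (h ε 0<ε)

  <ʳ⇒≤ʳ : ∀ x y → x <ʳ y → x ≤ʳ y
  <ʳ⇒≤ʳ x y (ε , 0<ε , ev) = ≤ʳ-eventually x y (mapᵉ (λ n → ≤-trans (p≤p+q (<⇒≤ 0<ε))) ev)

  -- Finite sums

  Σ-cong : ∀ {f g} n → (∀ j → j ℕ.< n → f j ≡ g j) → Σ[ n ] f ≡ Σ[ n ] g
  Σ-cong zero    h = refl
  Σ-cong (suc n) h = cong₂ _+_ (Σ-cong n λ j j<n → h j (ℕₚ.m≤n⇒m≤1+n j<n)) (h n ℕₚ.≤-refl)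

  Σ-+ : ∀ f g n → Σ[ n ] (λ j → f j + g j) ≡ Σ[ n ] f + Σ[ n ] g
  Σ-+ f g zero    = refl
  Σ-+ f g (suc n) = trans (cong (_+ (f n + g n)) (Σ-+ f g n))
    (solve 4 (λ a b c d → a :+ b :+ (c :+ d) := a :+ c :+ (b :+ d)) refl (Σ[ n ] f) (Σ[ n ] g) (f n) (g n))

  Σ-*ˡ : ∀ c f n → Σ[ n ] (λ j → c * f j) ≡ c * Σ[ n ] f
  Σ-*ˡ c f zero    = sym (*-zeroʳ c)
  Σ-*ˡ c f (suc n) = trans (cong (_+ c * f n) (Σ-*ˡ c f n)) (sym (*-distribˡ-+ c (Σ[ n ] f) (f n)))

  Σ-*ʳ : ∀ c f n → Σ[ n ] (λ j → f j * c) ≡ Σ[ n ] f * c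
  Σ-*ʳ c f n = trans (Σ-cong n λ j _ → *-comm (f j) c) (trans (Σ-*ˡ c f n) (*-comm c (Σ[ n ] f)))

  Σ-front : ∀ f n → Σ[ suc n ] f ≡ f 0 + Σ[ n ] (λ j → f (suc j))
  Σ-front f zero    = +-comm 0ℚ (f 0)
  Σ-front f (suc n) = trans (cong (_+ f (suc n)) (Σ-front f n)) (+-assoc (f 0) _ (f (suc n)))

  Σ-≤ : ∀ {f g} n → (∀ j → j ℕ.< n → f j ≤ g j) → Σ[ n ] f ≤ Σ[ n ] g
  Σ-≤ zero    h = ≤-refl
  Σ-≤ (suc n) h = +-mono-≤ (Σ-≤ n λ j j<n → h j (ℕₚ.m≤n⇒m≤1+n j<n)) (h n ℕₚ.≤-refl)

  ∣Σ∣≤ : ∀ f n → ∣ Σ[ n ] f ∣ ≤ Σ[ n ] (λ j → ∣ f j ∣)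
  ∣Σ∣≤ f zero    = ≤-refl
  ∣Σ∣≤ f (suc n) = ≤-trans (∣p+q∣≤∣p∣+∣q∣ (Σ[ n ] f) (f n)) (+-monoˡ-≤ ∣ f n ∣ (∣Σ∣≤ f n))

  fromℕ-cancelˡ : ∀ n {p q} → fromℕ (suc n) * p ≡ fromℕ (suc n) * q → p ≡ q
  fromℕ-cancelˡ n {p} {q} h = trans (sym (eq p)) (trans (cong ((1 ÷ℕ suc n) *_) h) (eq q))
    where
    eq : ∀ p → (1 ÷ℕ suc n) * (fromℕ (suc n) * p) ≡ p
    eq p = trans (solve 3 (λ i n p → i :* (n :* p) := n :* i :* p) refl (1 ÷ℕ suc n) (fromℕ (suc n)) p)
      (trans (cong (_* p) (n*1÷n {suc n} (s≤s z≤n))) (*-identityˡ p))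

  -- The exponential series

  expTerm : ℚ → ℕ → ℚ
  expTerm a k = expCoeff k * a ^ℚ k

  expSum : ℚ → ℕ → ℚ
  expSum a n = Σ[ n ] (expTerm a)

  expTerm-suc : ∀ a k → fromℕ (suc k) * expTerm a (suc k) ≡ a * expTerm a k
  expTerm-suc a k = trans
    (solve 4 (λ n c a s → n :* (c :* (a :* s)) := a :* (n :* c :* s)) refl (fromℕ (suc k)) (expCoeff (suc k)) a (a ^ℚ k))
    (cong (λ c → a * (c * a ^ℚ k)) (expCoeff-suc k))

  0≤expTerm : ∀ {a} → 0ℚ ≤ a → ∀ k → 0ℚ ≤ expTerm a k
  0≤expTerm 0≤a k = 0≤* (0≤expCoeff k) (0≤^ 0≤a k)

  ∣expTerm∣≤ : ∀ {a B} → ∣ a ∣ ≤ B → ∀ k → ∣ expTerm a k ∣ ≤ expTerm B k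
  ∣expTerm∣≤ {a} {B} h k = ≤-castˡ
    (sym (trans (∣p*q∣≡∣p∣*∣q∣ (expCoeff k) (a ^ℚ k)) (cong (_* ∣ a ^ℚ k ∣) (0≤p⇒∣p∣≡p (0≤expCoeff k)))))
    (*ˡ-mono (0≤expCoeff k) (∣^∣≤ h k))

  module CauchyProduct (a b : ℚ) where

    conv : ℕ → ℚ
    conv n = Σ[ suc n ] (λ j → expTerm a j * expTerm b (n ∸ j))

    conv-suc : ∀ n → fromℕ (suc n) * conv (suc n) ≡ (a + b) * conv n
    conv-suc n = begin
      fromℕ (suc n) * Σ[ suc (suc n) ] t
        ≡⟨ sym (Σ-*ˡ (fromℕ (suc n)) t (suc (suc n))) ⟩
      Σ[ suc (suc n) ] (λ j → fromℕ (suc n) * t j)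
        ≡⟨ Σ-cong (suc (suc n)) (λ j h → split j (ℕₚ.≤-pred h)) ⟩
      Σ[ suc (suc n) ] (λ j → l j + r j)
        ≡⟨ Σ-+ l r (suc (suc n)) ⟩
      Σ[ suc (suc n) ] l + Σ[ suc (suc n) ] r
        ≡⟨ cong₂ _+_ left right ⟩
      a * conv n + b * conv n
        ≡⟨ sym (*-distribʳ-+ (conv n) a b) ⟩
      (a + b) * conv n ∎
      where
      open ≡-Reasoning
      t l r s : ℕ → ℚ
      t j = expTerm a j * expTerm b (suc n ∸ j)
      l j = fromℕ j * t j
      r j = fromℕ (suc n ∸ j) * t j
      s j = expTerm a j * expTerm b (n ∸ j)
      split : ∀ j → j ℕ.≤ suc n → fromℕ (suc n) * t j ≡ l j + r j
      split j h = trans (cong (λ m → fromℕ m * t j) (sym (ℕₚ.m+[n∸m]≡n h)))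
        (trans (cong (_* t j) (fromℕ-+ j (suc n ∸ j))) (*-distribʳ-+ (t j) (fromℕ j) (fromℕ (suc n ∸ j))))
      left : Σ[ suc (suc n) ] l ≡ a * conv n
      left = trans (Σ-front l (suc n)) (trans (cong (_+ Σ[ suc n ] (λ j → l (suc j))) (*-zeroˡ (t 0)))
        (trans (+-identityˡ (Σ[ suc n ] (λ j → l (suc j))))
          (trans (Σ-cong (suc n) λ j _ → term j) (Σ-*ˡ a s (suc n)))))
        where
        term : ∀ j → l (suc j) ≡ a * s j
        term j = trans (sym (*-assoc (fromℕ (suc j)) (expTerm a (suc j)) (expTerm b (n ∸ j))))
          (trans (cong (_* expTerm b (n ∸ j)) (expTerm-suc a j)) (*-assoc a (expTerm a j) (expTerm b (n ∸ j))))
      right : Σ[ suc (suc n) ] r ≡ b * conv n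
      right = trans (cong₂ _+_ (Σ-cong (suc n) λ j h → term j (ℕₚ.≤-pred h)) last)
        (trans (+-identityʳ (Σ[ suc n ] (λ j → b * s j))) (Σ-*ˡ b s (suc n)))
        where
        last : r (suc n) ≡ 0ℚ
        last = trans (cong (λ k → fromℕ k * t (suc n)) (ℕₚ.n∸n≡0 n)) (*-zeroˡ (t (suc n)))
        term : ∀ j → j ℕ.≤ n → r j ≡ b * s j
        term j h = trans (cong (λ k → fromℕ k * (expTerm a j * expTerm b k)) (ℕₚ.+-∸-assoc 1 h))
          (trans (solve 3 (λ k x y → k :* (x :* y) := x :* (k :* y)) refl (fromℕ (suc (n ∸ j))) (expTerm a j) (expTerm b (suc (n ∸ j))))
            (trans (cong (expTerm a j *_) (expTerm-suc b (n ∸ j)))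
              (solve 3 (λ x b y → x :* (b :* y) := b :* (x :* y)) refl (expTerm a j) b (expTerm b (n ∸ j)))))

    conv≡expTerm : ∀ n → conv n ≡ expTerm (a + b) n
    conv≡expTerm zero    = refl
    conv≡expTerm (suc n) = fromℕ-cancelˡ n (trans (conv-suc n)
      (trans (cong ((a + b) *_) (conv≡expTerm n)) (sym (expTerm-suc (a + b) n))))

    triangle : ∀ n → Σ[ n ] (λ j → expTerm a j * expSum b (n ∸ j)) ≡ expSum (a + b) n
    triangle zero    = refl
    triangle (suc n) = begin
      Σ[ suc n ] (λ j → expTerm a j * expSum b (suc n ∸ j))
        ≡⟨ Σ-cong (suc n) (λ j h → trans (cong (λ k → expTerm a j * expSum b k) (ℕₚ.+-∸-assoc 1 (ℕₚ.≤-pred h)))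
             (*-distribˡ-+ (expTerm a j) (expSum b (n ∸ j)) (expTerm b (n ∸ j)))) ⟩
      Σ[ suc n ] (λ j → expTerm a j * expSum b (n ∸ j) + expTerm a j * expTerm b (n ∸ j))
        ≡⟨ Σ-+ (λ j → expTerm a j * expSum b (n ∸ j)) (λ j → expTerm a j * expTerm b (n ∸ j)) (suc n) ⟩
      Σ[ n ] (λ j → expTerm a j * expSum b (n ∸ j)) + expTerm a n * expSum b (n ∸ n) + conv n
        ≡⟨ cong₂ _+_ (cong₂ _+_ (triangle n) (trans (cong (λ k → expTerm a n * expSum b k) (ℕₚ.n∸n≡0 n)) (*-zeroʳ (expTerm a n)))) (conv≡expTerm n) ⟩
      expSum (a + b) n + 0ℚ + expTerm (a + b) n
        ≡⟨ cong (_+ expTerm (a + b) n) (+-identityʳ (expSum (a + b) n)) ⟩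
      expSum (a + b) n + expTerm (a + b) n ∎
      where open ≡-Reasoning

    -- The product of two partial sums runs over the square j, k < n, while `triangle` covers j + k
    -- < n. What remains is the corner j + k ≥ n.
    defect : ∀ n → expSum a n * expSum b n - expSum (a + b) n ≡ Σ[ n ] (λ j → expTerm a j * (expSum b n - expSum b (n ∸ j)))
    defect n = begin
      expSum a n * expSum b n - expSum (a + b) n
        ≡⟨ cong₂ _-_ (sym (Σ-*ʳ (expSum b n) (expTerm a) n)) (sym (triangle n)) ⟩
      Σ[ n ] f - Σ[ n ] g
        ≡⟨ solve 2 (λ f g → f :+ :- g := f :+ con (- 1ℚ) :* g) refl (Σ[ n ] f) (Σ[ n ] g) ⟩
      Σ[ n ] f + (- 1ℚ) * Σ[ n ] g
        ≡⟨ cong (λ t → Σ[ n ] f + t) (sym (Σ-*ˡ (- 1ℚ) g n)) ⟩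
      Σ[ n ] f + Σ[ n ] (λ j → (- 1ℚ) * g j)
        ≡⟨ sym (Σ-+ f (λ j → (- 1ℚ) * g j) n) ⟩
      Σ[ n ] (λ j → f j + (- 1ℚ) * g j)
        ≡⟨ Σ-cong n (λ j _ → solve 3 (λ x y z → x :* y :+ con (- 1ℚ) :* (x :* z) := x :* (y :+ :- z)) refl (expTerm a j) (expSum b n) (expSum b (n ∸ j))) ⟩
      Σ[ n ] (λ j → expTerm a j * (expSum b n - expSum b (n ∸ j))) ∎
      where
      open ≡-Reasoning
      f g : ℕ → ℚ
      f j = expTerm a j * expSum b n
      g j = expTerm a j * expSum b (n ∸ j)

  expSum-mono : ∀ {B} → 0ℚ ≤ B → ∀ {m n} → m ℕ.≤ n → expSum B m ≤ expSum B n
  expSum-mono {B} 0≤B {m} {n} m≤n = subst (λ k → expSum B m ≤ expSum B k) (ℕₚ.m∸n+n≡m m≤n) (Σ-mono (0≤expTerm 0≤B) m (n ∸ m))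

  ∣ΔexpSum∣≤ : ∀ {b B} → ∣ b ∣ ≤ B → ∀ {m n} → m ℕ.≤ n → ∣ expSum b n - expSum b m ∣ ≤ expSum B n - expSum B m
  ∣ΔexpSum∣≤ {b} {B} h {m} {n} m≤n = subst (λ k → ∣ expSum b k - expSum b m ∣ ≤ expSum B k - expSum B m) (ℕₚ.m∸n+n≡m m≤n) (go (n ∸ m))
    where
    go : ∀ k → ∣ expSum b (k ℕ.+ m) - expSum b m ∣ ≤ expSum B (k ℕ.+ m) - expSum B m
    go zero    = ≤-reflexive (trans (cong ∣_∣ (+-inverseʳ (expSum b m))) (sym (+-inverseʳ (expSum B m))))
    go (suc k) = ≤-castˡ (cong ∣_∣ (swap (expSum b (k ℕ.+ m)) (expSum b m) (expTerm b (k ℕ.+ m))))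
      (≤-castʳ (swap (expSum B (k ℕ.+ m)) (expSum B m) (expTerm B (k ℕ.+ m)))
        (≤-trans (∣p+q∣≤∣p∣+∣q∣ (expSum b (k ℕ.+ m) - expSum b m) (expTerm b (k ℕ.+ m)))
          (+-mono-≤ (go k) (∣expTerm∣≤ h (k ℕ.+ m)))))
      where
      swap : ∀ x y z → x - y + z ≡ x + z - y
      swap = solve 3 (λ x y z → x :+ :- y :+ z := x :+ z :+ :- y) refl

  -- Replacing `a` and `b` by `B` can only enlarge the corner terms in absolute value. For `B` the
  -- square of side n lies in the triangle of side 2 n, so the corner is at most a block of the
  -- series of exp (2 B), which becomes small because that series converges.
  expSum-*-defect : ∀ {a b B} → ∣ a ∣ ≤ B → ∣ b ∣ ≤ B → ∀ n →
             ∣ expSum a n * expSum b n - expSum (a + b) n ∣ ≤ expSum (B + B) (n ℕ.+ n) - expSum (B + B) n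
  expSum-*-defect {a} {b} {B} ha hb n = begin
    ∣ expSum a n * expSum b n - expSum (a + b) n ∣
      ≡⟨ cong ∣_∣ (CauchyProduct.defect a b n) ⟩
    ∣ Σ[ n ] (λ j → expTerm a j * (expSum b n - expSum b (n ∸ j))) ∣
      ≤⟨ ∣Σ∣≤ (λ j → expTerm a j * (expSum b n - expSum b (n ∸ j))) n ⟩
    Σ[ n ] (λ j → ∣ expTerm a j * (expSum b n - expSum b (n ∸ j)) ∣)
      ≤⟨ Σ-≤ n (λ j _ → ≤-castˡ (sym (∣p*q∣≡∣p∣*∣q∣ (expTerm a j) (expSum b n - expSum b (n ∸ j))))
           (*-mono (0≤∣p∣ (expTerm a j)) (p≤q⇒0≤q-p (expSum-mono 0≤B (ℕₚ.m∸n≤m n j))) (∣expTerm∣≤ ha j) (∣ΔexpSum∣≤ hb (ℕₚ.m∸n≤m n j)))) ⟩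
    Σ[ n ] (λ j → expTerm B j * (expSum B n - expSum B (n ∸ j)))
      ≡⟨ sym (CauchyProduct.defect B B n) ⟩
    expSum B n * expSum B n - expSum (B + B) n
      ≤⟨ +-monoˡ-≤ (- expSum (B + B) n) square ⟩
    expSum (B + B) (n ℕ.+ n) - expSum (B + B) n ∎
    where
    open ≤-Reasoning
    0≤B : 0ℚ ≤ B
    0≤B = ≤-trans (0≤∣p∣ a) ha
    square : expSum B n * expSum B n ≤ expSum (B + B) (n ℕ.+ n)
    square = begin
      expSum B n * expSum B n
        ≡⟨ sym (Σ-*ʳ (expSum B n) (expTerm B) n) ⟩
      Σ[ n ] (λ j → expTerm B j * expSum B n)
        ≤⟨ Σ-≤ n (λ j j<n → *ˡ-mono (0≤expTerm 0≤B j) (expSum-mono 0≤B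
             (subst (n ℕ.≤_) (sym (ℕₚ.+-∸-assoc n (ℕₚ.<⇒≤ j<n))) (ℕₚ.m≤m+n n (n ∸ j))))) ⟩
      Σ[ n ] (λ j → expTerm B j * expSum B (n ℕ.+ n ∸ j))
        ≤⟨ Σ-mono (λ j → 0≤* (0≤expTerm 0≤B j) (Σ-nonneg (0≤expTerm 0≤B) (n ℕ.+ n ∸ j))) n n ⟩
      Σ[ n ℕ.+ n ] (λ j → expTerm B j * expSum B (n ℕ.+ n ∸ j))
        ≡⟨ CauchyProduct.triangle B B (n ℕ.+ n) ⟩
      expSum (B + B) (n ℕ.+ n) ∎

  exp-+ : ∀ x y → exp x *ʳ exp y ≈ʳ exp (x +ʳ y)
  exp-+ x y ε 0<ε =
    let (B , 0<B , evB) = bounded {seq x} (isCauchy x)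
        (D , 0<D , evD) = bounded {seq y} (isCauchy y)
        C = B + D
        (N , h) = isCauchy (exp (fromℚ (C + C))) ε 0<ε in
    (N , λ n N≤n → N≤n) ⟪ (λ n → λ { N≤n (bx , by) →
      ≤-trans (expSum-*-defect (≤-trans bx (p≤p+q (<⇒≤ 0<D))) (≤-trans by (≤-castʳ (+-comm D B) (p≤p+q (<⇒≤ 0<B)))) (suc n))
        (≤-trans (p≤∣p∣ _) (h (n ℕ.+ suc n) n (ℕₚ.≤-trans N≤n (ℕₚ.m≤m+n n (suc n))) N≤n)) })
    ⟫ (evB ⟪ (λ n a b → a , b) ⟫ evD)

  exp-cong : ∀ x y → (∀ n → seq x n ≡ seq y n) → exp x ≤ʳ exp y
  exp-cong x y h = ≤ʳ-pointwise (exp x) (exp y) λ n → ≤-reflexive (cong (λ a → expSum a (suc n)) (h n))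

  -- Obtained from the square of exp (x / 2), since single partial sums at negative arguments can be
  -- negative.
  0≤exp : ∀ x → 0ʳ ≤ʳ exp x
  0≤exp x = ≤ʳ-trans 0ʳ (exp h *ʳ exp h) (exp x)
    (≤ʳ-pointwise 0ʳ (exp h *ʳ exp h) λ n → 0≤p² (seq (exp h) n))
    (≤ʳ-trans (exp h *ʳ exp h) (exp (h +ʳ h)) (exp x)
      (≈ʳ⇒≤ʳ (exp h *ʳ exp h) (exp (h +ʳ h)) (exp-+ h h))
      (exp-cong (h +ʳ h) x λ n → solve 1 (λ a → con ½ :* a :+ con ½ :* a := a) refl (seq x n)))
    where
    h : ℝ
    h = fromℚ ½ *ʳ x

  -- A nonnegative real may have slightly negative approximations h ≥ -η. If h is negative then |h|
  -- ≤ η ≤ 1, so each term past the first is at least -η times the same term at 1, and `M` bounds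
  -- the sum of those.
  1-Mη≤expSum : ∀ {h η M} n → 0ℚ ≤ η → η ≤ 1ℚ → expSum 1ℚ (suc n) ≤ M → - η ≤ h → 1ℚ - M * η ≤ expSum h (suc n)
  1-Mη≤expSum {h} {η} {M} n 0≤η η≤1 expSum≤M -η≤h = ≤-castʳ (sym (Σ-front (expTerm h) n)) (+-monoʳ-≤ 1ℚ bound)
    where
    term : ∀ k → - η * expTerm 1ℚ (suc k) ≤ expTerm h (suc k)
    term k with ≤-total 0ℚ h
    ... | inj₁ 0≤h = ≤-trans (≤-castˡ (neg-distribˡ-* η (expTerm 1ℚ (suc k))) (neg-antimono-≤ (0≤* 0≤η (0≤expTerm 0≤1 (suc k)))))
                       (0≤expTerm 0≤h (suc k))
    ... | inj₂ h≤0 = ≤-castˡ (neg-distribˡ-* η (expTerm 1ℚ (suc k))) (∣p∣≤⇒-q≤p (≤-castˡ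
          (sym (trans (∣p*q∣≡∣p∣*∣q∣ (expCoeff (suc k)) (h ^ℚ suc k))
            (cong₂ _*_ (0≤p⇒∣p∣≡p (0≤expCoeff (suc k))) (∣p*q∣≡∣p∣*∣q∣ h (h ^ℚ k)))))
          (≤-castʳ (solve 3 (λ c η s → c :* (η :* s) := η :* (c :* (con 1ℚ :* s))) refl (expCoeff (suc k)) η (1ℚ ^ℚ k))
            (*ˡ-mono (0≤expCoeff (suc k)) (*-mono (0≤∣p∣ h) (0≤^ 0≤1 k) ∣h∣≤η (∣^∣≤ (≤-trans ∣h∣≤η η≤1) k))))))
      where
      ∣h∣≤η : ∣ h ∣ ≤ η
      ∣h∣≤η = ∣p∣≤ (≤-trans h≤0 0≤η) (≤-by (p≤q⇒0≤q-p -η≤h) (solve 2 (λ h η → h :+ :- (:- η) := η :+ :- (:- h)) refl h η))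
    bound : - (M * η) ≤ Σ[ n ] (λ k → expTerm h (suc k))
    bound = ≤-trans (≤-castˡ (solve 2 (λ M η → :- η :* M := :- (M :* η)) refl M η)
        (≤-trans (≤-castˡ (neg-distribˡ-* η M) (≤-castʳ (neg-distribˡ-* η (Σ[ n ] (λ k → expTerm 1ℚ (suc k))))
          (neg-antimono-≤ (*ˡ-mono 0≤η (≤-trans (≤-castʳ (sym (Σ-front (expTerm 1ℚ) n))
             (≤-castʳ (+-comm (Σ[ n ] (λ k → expTerm 1ℚ (suc k))) 1ℚ) (p≤p+q 0≤1))) expSum≤M)))))
          (≤-reflexive (sym (Σ-*ˡ (- η) (λ k → expTerm 1ℚ (suc k)) n)))))
      (Σ-≤ n λ k _ → term k)

  1≤exp : ∀ x → 0ʳ ≤ʳ x → 1ʳ ≤ʳ exp x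
  1≤exp x 0≤x =
    let (M , 0<M , evM) = bounded {seq (exp 1ʳ)} (isCauchy (exp 1ʳ)) in
    ≤ʳᴷ 1ʳ (exp x) M (<⇒≤ 0<M) λ ε 0<ε →
      evM ⟪ (λ n m h → step n M ε (<⇒≤ 0<M) (<⇒≤ 0<ε) (≤-trans (p≤∣p∣ _) m) h) ⟫ 0≤x (ε ⊓ 1ℚ) (⊓-pos 0<ε)
    where
    step : ∀ n M ε → 0ℚ ≤ M → 0ℚ ≤ ε → expSum 1ℚ (suc n) ≤ M → 0ℚ ≤ seq x n + (ε ⊓ 1ℚ) → 1ℚ ≤ expSum (seq x n) (suc n) + M * ε
    step n M ε 0≤M 0≤ε m h = ≤-trans
      (≤-by (p≤q⇒0≤q-p (1-Mη≤expSum n (⊓-glb 0≤ε 0≤1) (p⊓q≤q ε 1ℚ) m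
         (≤-by h (solve 2 (λ x η → x :+ η := x :+ :- (:- η)) refl (seq x n) (ε ⊓ 1ℚ)))))
        (solve 3 (λ p M η → p :+ :- (con 1ℚ :+ :- (M :* η)) := p :+ M :* η :+ :- con 1ℚ) refl (expSum (seq x n) (suc n)) M (ε ⊓ 1ℚ)))
      (+-monoʳ-≤ (expSum (seq x n) (suc n)) (*ˡ-mono 0≤M (p⊓q≤p ε 1ℚ)))

  exp-mono : ∀ x y → x ≤ʳ y → exp x ≤ʳ exp y
  exp-mono x y x≤y = ≤ʳ-trans (exp x) (exp x *ʳ exp (y -ʳ x)) (exp y)
    (≤ʳ-trans (exp x) (exp x *ʳ 1ʳ) (exp x *ʳ exp (y -ʳ x))
      (≤ʳ-pointwise (exp x) (exp x *ʳ 1ʳ) λ n → ≤-reflexive (sym (*-identityʳ (seq (exp x) n))))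
      (*ʳ-monoˡ (exp x) 1ʳ (exp (y -ʳ x)) (0≤exp x) (1≤exp (y -ʳ x) (x≤y⇒0≤y-x x y x≤y))))
    (≤ʳ-trans (exp x *ʳ exp (y -ʳ x)) (exp (x +ʳ (y -ʳ x))) (exp y)
      (≈ʳ⇒≤ʳ (exp x *ʳ exp (y -ʳ x)) (exp (x +ʳ (y -ʳ x))) (exp-+ x (y -ʳ x)))
      (exp-cong (x +ʳ (y -ʳ x)) y λ n → solve 2 (λ x y → x :+ (y :+ :- x) := y) refl (seq x n) (seq y n)))

  expSum-0 : ∀ n → expSum 0ℚ (suc n) ≡ 1ℚ
  expSum-0 n = trans (Σ-front (expTerm 0ℚ) n) (trans (cong (1ℚ +_) (trans (Σ-cong n λ k _ → zero-term k) (Σ-*ˡ 0ℚ (λ _ → 0ℚ) n)))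
      (trans (cong (1ℚ +_) (*-zeroˡ (Σ[ n ] (λ _ → 0ℚ)))) (+-identityʳ 1ℚ)))
    where
    zero-term : ∀ k → expTerm 0ℚ (suc k) ≡ 0ℚ * 0ℚ
    zero-term k = trans (cong (expCoeff (suc k) *_) (*-zeroˡ (0ℚ ^ℚ k))) (*-zeroʳ (expCoeff (suc k)))

  exp≤1 : ∀ x → x ≤ʳ 0ʳ → exp x ≤ʳ 1ʳ
  exp≤1 x x≤0 = ≤ʳ-trans (exp x) (exp 0ʳ) 1ʳ (exp-mono x 0ʳ x≤0)
    (≤ʳ-pointwise (exp 0ʳ) 1ʳ λ n → ≤-reflexive (expSum-0 n))

  1≤exp*exp : ∀ y → 1ʳ ≤ʳ exp y *ʳ exp (-ʳ y)
  1≤exp*exp y = ≤ʳ-trans 1ʳ (exp (y -ʳ y)) (exp y *ʳ exp (-ʳ y))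
    (≤ʳ-pointwise 1ʳ (exp (y -ʳ y)) λ n → ≤-reflexive (sym (trans (cong (λ a → expSum a (suc n)) (+-inverseʳ (seq y n))) (expSum-0 n))))
    (≈ʳ⇒≤ʳ (exp (y -ʳ y)) (exp y *ʳ exp (-ʳ y))
      (≈ʳ-sym (exp y *ʳ exp (-ʳ y)) (exp (y -ʳ y)) (exp-+ y (-ʳ y))))

-- The logarithm and comparison of `δ` at different arguments

module Delta where

  open import Data.Nat.Base as ℕ using (ℕ; zero; suc; _∸_)
  import Data.Nat.Properties as ℕₚ
  open import Data.Integer.Base using (+_)
  open import Data.Product.Base using (∃; _×_; _,_; proj₁; proj₂)
  open import Data.Rational.Base
  open import Data.Rational.Properties
  open import Data.Rational.Solver
  open import Data.Sum.Base using (inj₁; inj₂)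
  open import Relation.Binary.PropositionalEquality
  open import Relation.Nullary using (Dec; yes; no; contradiction)
  open import Relation.Nullary.Decidable using (from-yes)
  open +-*-Solver
  open ℚ-Lemmas
  open ℝ-Lemmas
  open ExpLemmas
  open LogLemmas
  open LogPositivity
  open Analysis

  -- Monotonicity and Lipschitz continuity of the logarithm

  μ : ℚ → ℚ
  μ a = (a - 1ℚ) * inv (a + 1ℚ)

  -- The n-th term of the sequence representing log a
  Λ : ℕ → ℚ → ℚ
  Λ n a = fromℕ 2 * (μ a * partialSum artanhCoeff (μ a * μ a) (suc n))

  0<a+1 : ∀ {a} → 0ℚ ≤ a → 0ℚ < a + 1ℚ
  0<a+1 {a} 0≤a = subst (0ℚ <_) (+-comm 1ℚ a) (0<+ 0<1 0≤a)

  -- In this form monotonicity, 1 - μ² and differences of `μ` all become statements about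
  -- `inv (a + 1ℚ)`.
  μ-inv : ∀ {a} → 0ℚ ≤ a → μ a ≡ 1ℚ - (1ℚ + 1ℚ) * inv (a + 1ℚ)
  μ-inv {a} 0≤a = trans
    (solve 2 (λ a i → (a :+ :- con 1ℚ) :* i := (a :+ con 1ℚ) :* i :+ :- ((con 1ℚ :+ con 1ℚ) :* i)) refl a (inv (a + 1ℚ)))
    (cong (_- (1ℚ + 1ℚ) * inv (a + 1ℚ)) (pos*inv (0<a+1 0≤a)))

  μ-mono : ∀ {a b} → 0ℚ ≤ a → a ≤ b → μ a ≤ μ b
  μ-mono 0≤a a≤b = subst₂ _≤_ (sym (μ-inv 0≤a)) (sym (μ-inv (≤-trans 0≤a a≤b)))
    (+-monoʳ-≤ 1ℚ (neg-antimono-≤ (*ˡ-mono (from-yes (0ℚ ≤? 1ℚ + 1ℚ))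
      (inv-antimono (0<a+1 0≤a) (+-monoˡ-≤ 1ℚ a≤b)))))

  0≤μ : ∀ {a} → 1ℚ ≤ a → 0ℚ ≤ μ a
  0≤μ 1≤a = 0≤* (p≤q⇒0≤q-p 1≤a) (<⇒≤ (inv-pos (0<a+1 (≤-trans 0≤1 1≤a))))

  ^-mono : ∀ {p q} → 0ℚ ≤ p → p ≤ q → ∀ n → p ^ℚ n ≤ q ^ℚ n
  ^-mono 0≤p p≤q zero    = ≤-refl
  ^-mono 0≤p p≤q (suc n) = *-mono 0≤p (0≤^ (≤-trans 0≤p p≤q) n) p≤q (^-mono 0≤p p≤q n)

  -- For a ≥ 1 the argument `μ a` is nonnegative, so every term of the artanh series is monotone and
  -- the inequality holds at each stage n, without passing to the limit.
  Λ-mono : ∀ {a b} n → 1ℚ ≤ a → a ≤ b → Λ n a ≤ Λ n b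
  Λ-mono {a} {b} n 1≤a a≤b = *ˡ-mono (0≤fromℕ 2) (*-mono (0≤μ 1≤a)
      (Σ-nonneg (λ k → 0≤* (0≤artanhCoeff k) (0≤^ (0≤* 0≤μb 0≤μb) k)) (suc n))
      μa≤μb
      (Σ-≤ (suc n) λ k _ → *ˡ-mono (0≤artanhCoeff k) (^-mono (0≤* (0≤μ 1≤a) (0≤μ 1≤a)) (*-mono (0≤μ 1≤a) 0≤μb μa≤μb μa≤μb) k)))
    where
    μa≤μb : μ a ≤ μ b
    μa≤μb = μ-mono (≤-trans 0≤1 1≤a) a≤b
    0≤μb : 0ℚ ≤ μ b
    0≤μb = ≤-trans (0≤μ 1≤a) μa≤μb

  -- Compares differences of artanh with a geometric sum: where z² ≤ r the odd power of exponent
  -- 2k+1 has slope at most 2k+1 times the k-th power of r, and the series coefficient 1/(2k+1)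
  -- cancels the factor 2k+1.
  module OddPowers {a b r : ℚ} (a≤b : a ≤ b) (a²≤r : a * a ≤ r) (b²≤r : b * b ≤ r) where

    0≤r : 0ℚ ≤ r
    0≤r = ≤-trans (0≤p² a) a²≤r

    -- From 2 a b ≤ a² + b², whatever the signs of `a` and `b`.
    ab+a²≤2r : a * b + a * a ≤ r + r
    ab+a²≤2r = ≤-by (0≤+ (0≤+ (0≤* (from-yes (0ℚ ≤? ½)) (0≤p² (a - b)))
        (0≤* (from-yes (0ℚ ≤? 1ℚ + ½)) (p≤q⇒0≤q-p a²≤r))) (0≤* (from-yes (0ℚ ≤? ½)) (p≤q⇒0≤q-p b²≤r)))
      (solve 3 (λ a b r → con ½ :* ((a :+ :- b) :* (a :+ :- b)) :+ con (1ℚ + ½) :* (r :+ :- (a :* a)) :+ con ½ :* (r :+ :- (b :* b))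
         := r :+ r :+ :- (a :* b :+ a :* a)) refl a b r)

    odd : ℚ → ℕ → ℚ
    odd z k = z * (z * z) ^ℚ k

    odd-lip : ∀ k → odd b k - odd a k ≤ (b - a) * (fromℕ (2 ℕ.* k ℕ.+ 1) * r ^ℚ k)
    odd-lip zero    = ≤-reflexive (solve 2 (λ a b → b :* con 1ℚ :+ :- (a :* con 1ℚ) := (b :+ :- a) :* (con 1ℚ :* con 1ℚ)) refl a b)
    odd-lip (suc k) = begin
      b * (b * b * B) - a * (a * a * A)
        ≡⟨ solve 4 (λ a b A B → b :* (b :* b :* B) :+ :- (a :* (a :* a :* A))
             := b :* b :* (b :* B :+ :- (a :* A)) :+ (b :+ :- a) :* ((a :* b :+ a :* a) :* A)) refl a b A B ⟩
      b * b * (b * B - a * A) + (b - a) * ((a * b + a * a) * A)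
        ≤⟨ +-mono-≤
            (≤-trans (*ˡ-mono (0≤p² b) (odd-lip k))
              (*ʳ-mono (0≤* 0≤d (0≤* (0≤fromℕ (2 ℕ.* k ℕ.+ 1)) (0≤^ 0≤r k))) b²≤r))
            (*ˡ-mono 0≤d (≤-trans (*ʳ-mono (0≤^ (0≤p² a) k) ab+a²≤2r)
              (*ˡ-mono (0≤+ 0≤r 0≤r) (^-mono (0≤p² a) a²≤r k)))) ⟩
      r * ((b - a) * (fromℕ (2 ℕ.* k ℕ.+ 1) * R)) + (b - a) * ((r + r) * R)
        ≡⟨ solve 4 (λ r d m R → r :* (d :* (m :* R)) :+ d :* ((r :+ r) :* R) := d :* ((con (fromℕ 2) :+ m) :* (r :* R)))
             refl r (b - a) (fromℕ (2 ℕ.* k ℕ.+ 1)) R ⟩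
      (b - a) * ((fromℕ 2 + fromℕ (2 ℕ.* k ℕ.+ 1)) * (r * R))
        ≡⟨ cong (λ t → (b - a) * (t * (r * R))) (trans (sym (fromℕ-+ 2 (2 ℕ.* k ℕ.+ 1))) (cong (λ m → fromℕ (m ℕ.+ 1)) (sym (ℕₚ.*-suc 2 k)))) ⟩
      (b - a) * (fromℕ (2 ℕ.* suc k ℕ.+ 1) * (r * R)) ∎
      where
      open ≤-Reasoning
      A = (a * a) ^ℚ k
      B = (b * b) ^ℚ k
      R = r ^ℚ k
      0≤d : 0ℚ ≤ b - a
      0≤d = p≤q⇒0≤q-p a≤b

    artanh-lip : ∀ n → b * partialSum artanhCoeff (b * b) n - a * partialSum artanhCoeff (a * a) n
                       ≤ (b - a) * Σ[ n ] (r ^ℚ_)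
    artanh-lip zero    = ≤-reflexive (solve 2 (λ a b → b :* con 0ℚ :+ :- (a :* con 0ℚ) := (b :+ :- a) :* con 0ℚ) refl a b)
    artanh-lip (suc n) = begin
      b * (SB + c * B) - a * (SA + c * A)
        ≡⟨ solve 7 (λ a b SA SB c A B → b :* (SB :+ c :* B) :+ :- (a :* (SA :+ c :* A))
             := (b :* SB :+ :- (a :* SA)) :+ c :* (b :* B :+ :- (a :* A))) refl a b SA SB c A B ⟩
      (b * SB - a * SA) + c * (b * B - a * A)
        ≤⟨ +-mono-≤ (artanh-lip n) (*ˡ-mono (0≤artanhCoeff n) (odd-lip n)) ⟩
      (b - a) * Σ[ n ] (r ^ℚ_) + c * ((b - a) * (fromℕ (2 ℕ.* n ℕ.+ 1) * R))
        ≡⟨ solve 5 (λ d S c m R → d :* S :+ c :* (d :* (m :* R)) := d :* (S :+ m :* c :* R))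
             refl (b - a) (Σ[ n ] (r ^ℚ_)) c (fromℕ (2 ℕ.* n ℕ.+ 1)) R ⟩
      (b - a) * (Σ[ n ] (r ^ℚ_) + fromℕ (2 ℕ.* n ℕ.+ 1) * c * R)
        ≡⟨ cong (λ t → (b - a) * (Σ[ n ] (r ^ℚ_) + t)) (trans (cong (_* R) (n*1÷n (0<2k+1 n))) (*-identityˡ R)) ⟩
      (b - a) * (Σ[ n ] (r ^ℚ_) + R) ∎
      where
      open ≤-Reasoning
      SA = partialSum artanhCoeff (a * a) n
      SB = partialSum artanhCoeff (b * b) n
      c = artanhCoeff n
      A = (a * a) ^ℚ n
      B = (b * b) ^ℚ n
      R = r ^ℚ n

  -- The Lipschitz constant of log on [u, ∞) is 1/u ≤ 2.
  module _ {u v : ℚ} (½≤u : ½ ≤ u) (u≤v : u ≤ v) where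

    private
      0≤u : 0ℚ ≤ u
      0≤u = ≤-trans (from-yes (0ℚ ≤? ½)) ½≤u
      0≤v : 0ℚ ≤ v
      0≤v = ≤-trans 0≤u u≤v
      i j : ℚ
      i = inv (u + 1ℚ)
      j = inv (v + 1ℚ)
      0≤i : 0ℚ ≤ i
      0≤i = <⇒≤ (inv-pos (0<a+1 0≤u))
      0≤j : 0ℚ ≤ j
      0≤j = <⇒≤ (inv-pos (0<a+1 0≤v))
      j≤i : j ≤ i
      j≤i = inv-antimono (0<a+1 0≤u) (+-monoˡ-≤ 1ℚ u≤v)
      w*inv : ∀ {w} → 0ℚ ≤ w → w * inv (w + 1ℚ) ≡ 1ℚ - inv (w + 1ℚ)
      w*inv {w} 0≤w = trans (solve 2 (λ w i → w :* i := (w :+ con 1ℚ) :* i :+ :- i) refl w (inv (w + 1ℚ)))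
        (cong (_- inv (w + 1ℚ)) (pos*inv (0<a+1 0≤w)))
      ui≤vj : u * i ≤ v * j
      ui≤vj = subst₂ _≤_ (sym (w*inv 0≤u)) (sym (w*inv 0≤v)) (+-monoʳ-≤ 1ℚ (neg-antimono-≤ j≤i))
      1-μ² : ∀ {w} → 0ℚ ≤ w → 1ℚ - μ w * μ w ≡ fromℕ 4 * (w * inv (w + 1ℚ) * inv (w + 1ℚ))
      1-μ² {w} 0≤w = trans (cong (λ t → 1ℚ - t * t) (μ-inv 0≤w))
        (trans (solve 1 (λ i → con 1ℚ :+ :- ((con 1ℚ :+ :- ((con 1ℚ :+ con 1ℚ) :* i)) :* (con 1ℚ :+ :- ((con 1ℚ :+ con 1ℚ) :* i)))
               := con (fromℕ 4) :* ((con 1ℚ :+ :- i) :* i)) refl (inv (w + 1ℚ)))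
          (cong (λ t → fromℕ 4 * (t * inv (w + 1ℚ))) (sym (w*inv 0≤w))))
      Δμ : μ v - μ u ≡ fromℕ 2 * ((v - u) * (i * j))
      Δμ = trans (cong₂ _-_ (trans (μ-inv 0≤v) (cong (λ t → 1ℚ - (1ℚ + 1ℚ) * t) (expand j i (u + 1ℚ) (pos*inv (0<a+1 0≤u)))))
             (trans (μ-inv 0≤u) (cong (λ t → 1ℚ - (1ℚ + 1ℚ) * t) (expand i j (v + 1ℚ) (pos*inv (0<a+1 0≤v))))))
           (solve 4 (λ u v i j → con 1ℚ :+ :- ((con 1ℚ :+ con 1ℚ) :* (j :* ((u :+ con 1ℚ) :* i))) :+ :- (con 1ℚ :+ :- ((con 1ℚ :+ con 1ℚ) :* (i :* ((v :+ con 1ℚ) :* j))))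
              := con (fromℕ 2) :* ((v :+ :- u) :* (i :* j))) refl u v i j)
        where
        expand : ∀ s t w → w * t ≡ 1ℚ → s ≡ s * (w * t)
        expand s t w h = trans (sym (*-identityʳ s)) (cong (s *_) (sym h))

      lip : ∀ {r} n → r ≤ 1ℚ → μ u * μ u ≤ r → μ v * μ v ≤ r →
            fromℕ 4 * (u * i * j) ≤ 1ℚ - r → Λ n v - Λ n u ≤ fromℕ 2 * (v - u)
      lip {r} n r≤1 hu hv h = begin
        fromℕ 2 * Fv - fromℕ 2 * Fu
          ≡⟨ solve 2 (λ x y → con (fromℕ 2) :* x :+ :- (con (fromℕ 2) :* y) := con (fromℕ 2) :* (x :+ :- y)) refl Fv Fu ⟩
        fromℕ 2 * (Fv - Fu)
          ≤⟨ *ˡ-mono (0≤fromℕ 2) (artanh-lip (suc n)) ⟩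
        fromℕ 2 * ((μ v - μ u) * G)
          ≡⟨ cong (λ t → fromℕ 2 * (t * G)) Δμ ⟩
        fromℕ 2 * (fromℕ 2 * ((v - u) * (i * j)) * G)
          ≡⟨ solve 4 (λ d i j G → con (fromℕ 2) :* (con (fromℕ 2) :* (d :* (i :* j)) :* G)
                := con (fromℕ 2) :* d :* (con ½ :* (con (fromℕ 4) :* (i :* j) :* G))) refl (v - u) i j G ⟩
        fromℕ 2 * (v - u) * (½ * X)
          ≤⟨ *ˡ-mono (0≤* (0≤fromℕ 2) (p≤q⇒0≤q-p u≤v)) (≤-trans (*ʳ-mono 0≤X ½≤u) uX≤1) ⟩
        fromℕ 2 * (v - u) * 1ℚ
          ≡⟨ *-identityʳ (fromℕ 2 * (v - u)) ⟩
        fromℕ 2 * (v - u) ∎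
        where
        open ≤-Reasoning
        open OddPowers (μ-mono 0≤u u≤v) hu hv
        Fu = μ u * partialSum artanhCoeff (μ u * μ u) (suc n)
        Fv = μ v * partialSum artanhCoeff (μ v * μ v) (suc n)
        G = Σ[ suc n ] (r ^ℚ_)
        0≤G : 0ℚ ≤ G
        0≤G = Geometric.0≤G 0≤r r≤1 (suc n)
        X = fromℕ 4 * (i * j) * G
        0≤X : 0ℚ ≤ X
        0≤X = 0≤* (0≤* (0≤fromℕ 4) (0≤* 0≤i 0≤j)) 0≤G
        uX≤1 : u * X ≤ 1ℚ
        uX≤1 = ≤-trans (≤-castˡ (solve 4 (λ u i j G → con (fromℕ 4) :* (u :* i :* j) :* G := u :* (con (fromℕ 4) :* (i :* j) :* G)) refl u i j G)
            (*ʳ-mono 0≤G h)) (Geometric.sum≤1 0≤r r≤1 (suc n))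

      4wi²≤1 : ∀ {w} → 0ℚ ≤ w → μ w * μ w ≤ 1ℚ
      4wi²≤1 {w} 0≤w = 0≤q-p⇒p≤q (≤-castʳ (sym (1-μ² 0≤w))
        (0≤* (0≤fromℕ 4) (0≤* (0≤* 0≤w 0≤k) 0≤k)))
        where
        0≤k : 0ℚ ≤ inv (w + 1ℚ)
        0≤k = <⇒≤ (inv-pos (0<a+1 0≤w))

    -- With r the larger of the two μ², the difference 1 - r equals 4 w / (w + 1)² for w = u or w =
    -- v. Either way it is at least 4 u / ((u + 1)(v + 1)). As 1 - r times the geometric sum is at
    -- most 1, the slope is at most 1/u, and u ≥ ½ makes this 2.
    Λ-lip : ∀ n → Λ n v - Λ n u ≤ fromℕ 2 * (v - u)
    Λ-lip n with ≤-total (μ u * μ u) (μ v * μ v)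
    ... | inj₁ h = lip n (4wi²≤1 0≤v) h ≤-refl
      (≤-castʳ (sym (1-μ² 0≤v)) (*ˡ-mono (0≤fromℕ 4) (*ʳ-mono 0≤j ui≤vj)))
    ... | inj₂ h = lip n (4wi²≤1 0≤u) ≤-refl h
      (≤-castʳ (sym (1-μ² 0≤u)) (*ˡ-mono (0≤fromℕ 4) (*ˡ-mono (0≤* 0≤u 0≤i) j≤i)))

  -- The exponent of δ

  module Exponent (x : ℝ) (3≤x : fromℚ (fromℕ 3) ≤ʳ x) where
    L : ℝ
    L = log x (3≤⇒0< x 3≤x)
    1<L : 1ʳ <ʳ L
    1<L = 3≤⇒1<log x (3≤⇒0< x 3≤x) 3≤x
    L₂ : ℝ
    L₂ = log L (1<⇒0< L 1<L)
    0<L₂ : 0ʳ <ʳ L₂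
    0<L₂ = 1<⇒0<log L (1<⇒0< L 1<L) 1<L
    -- `G` is the product (log x)^0.6 (log log x)^(-0.2) occurring in `δ`, and `W` is its logarithm.
    -- Comparing `δ` at two arguments thus comes down to comparing `W`.
    a b W G : ℝ
    a = fromℚ (+ 3 / 5) *ʳ L₂
    b = fromℚ (- (+ 1 / 5)) *ʳ log L₂ 0<L₂
    W = a +ʳ b
    G = exp a *ʳ exp b

    0≤G : 0ʳ ≤ʳ G
    0≤G = 0≤ʳ* (exp a) (exp b) (0≤exp a) (0≤exp b)

    G≈exp : G ≈ʳ exp W
    G≈exp = exp-+ a b

  exp-neg≤1 : ∀ y → 0ʳ ≤ʳ y → exp (-ʳ y) ≤ʳ 1ʳ
  exp-neg≤1 y 0≤y = exp≤1 (-ʳ y) (≤ʳ-trans (-ʳ y) (-ʳ 0ʳ) 0ʳ (-ʳ-antimono 0ʳ y 0≤y) (≤ʳ-pointwise (-ʳ 0ʳ) 0ʳ λ n → ≤-refl))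

  -- Any bound `K` for exp y serves, since exp y times exp (-y) is at least 1. This is positivity of
  -- exp (-y) in the form in which it is used.
  1≤K*exp-neg : ∀ y → ∃ λ K → 0ℚ ≤ K × 1ʳ ≤ʳ fromℚ K *ʳ exp (-ʳ y)
  1≤K*exp-neg y =
    let (K , 0<K , ev) = bounded {seq (exp y)} (isCauchy (exp y)) in
    K , <⇒≤ 0<K , ≤ʳ-trans 1ʳ (exp y *ʳ exp (-ʳ y)) (fromℚ K *ʳ exp (-ʳ y)) (1≤exp*exp y)
      (*ʳ-monoʳ (exp (-ʳ y)) (exp y) (fromℚ K) (0≤exp (-ʳ y))
        (≤ʳ-eventually (exp y) (fromℚ K) (mapᵉ (λ n → ∣p∣≤⇒p≤q) ev)))

  1≤K*-mono : ∀ x y → x ≤ʳ y → (∃ λ K → 0ℚ ≤ K × 1ʳ ≤ʳ fromℚ K *ʳ x) → ∃ λ K → 0ℚ ≤ K × 1ʳ ≤ʳ fromℚ K *ʳ y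
  1≤K*-mono x y x≤y (K , 0≤K , h) = K , 0≤K , ≤ʳ-trans 1ʳ (fromℚ K *ʳ x) (fromℚ K *ʳ y) h
    (*ʳ-monoˡ (fromℚ K) x y (≤ʳ-pointwise 0ʳ (fromℚ K) λ _ → 0≤K) x≤y)

  exp-antimono : ∀ A {g w g′ w′} → 0ʳ ≤ʳ A → g ≈ʳ exp w → g′ ≈ʳ exp w′ → w ≤ʳ w′ →
                 exp (-ʳ (A *ʳ g′)) ≤ʳ exp (-ʳ (A *ʳ g))
  exp-antimono A {g} {w} {g′} {w′} 0≤A g≈ g′≈ w≤w′ = exp-mono (-ʳ (A *ʳ g′)) (-ʳ (A *ʳ g))
    (-ʳ-antimono (A *ʳ g) (A *ʳ g′) (*ʳ-monoˡ A g g′ 0≤A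
      (≤ʳ-trans g (exp w) g′ (≈ʳ⇒≤ʳ g (exp w) g≈)
        (≤ʳ-trans (exp w) (exp w′) g′ (exp-mono w w′ w≤w′) (≈ʳ⇒≤ʳ (exp w′) g′ (≈ʳ-sym g′ (exp w′) g′≈))))))

  module _ (A : ℝ) (0<A : 0ʳ <ʳ A) where

    0≤A : 0ʳ ≤ʳ A
    0≤A = <ʳ⇒≤ʳ 0ʳ A 0<A

    expG : ∀ x (3≤x : fromℚ (fromℕ 3) ≤ʳ x) → ℝ
    expG x 3≤x = exp (-ʳ (A *ʳ Exponent.G x 3≤x))

    δ-seq : ∀ x 3≤x n → seq (δ A x 3≤x) n ≡ seq (expG x 3≤x) n
    δ-seq x 3≤x n = refl

    δ≤expG : ∀ x 3≤x → δ A x 3≤x ≤ʳ expG x 3≤x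
    δ≤expG x 3≤x = ≤ʳ-pointwise (δ A x 3≤x) (expG x 3≤x) λ n → ≤-reflexive (δ-seq x 3≤x n)

    expG≤δ : ∀ x 3≤x → expG x 3≤x ≤ʳ δ A x 3≤x
    expG≤δ x 3≤x = ≤ʳ-pointwise (expG x 3≤x) (δ A x 3≤x) λ n → ≤-reflexive (sym (δ-seq x 3≤x n))

    0≤δ : ∀ x 3≤x → 0ʳ ≤ʳ δ A x 3≤x
    0≤δ x 3≤x = ≤ʳ-trans 0ʳ (expG x 3≤x) (δ A x 3≤x) (0≤exp (-ʳ (A *ʳ Exponent.G x 3≤x))) (expG≤δ x 3≤x)

    δ≤1 : ∀ x 3≤x → δ A x 3≤x ≤ʳ 1ʳ
    δ≤1 x 3≤x = ≤ʳ-trans (δ A x 3≤x) (expG x 3≤x) 1ʳ (δ≤expG x 3≤x)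
      (exp-neg≤1 (A *ʳ Exponent.G x 3≤x) (0≤ʳ* A (Exponent.G x 3≤x) 0≤A (Exponent.0≤G x 3≤x)))

    1≤K*δ : ∀ x 3≤x → ∃ λ K → 0ℚ ≤ K × 1ʳ ≤ʳ fromℚ K *ʳ δ A x 3≤x
    1≤K*δ x 3≤x = 1≤K*-mono (expG x 3≤x) (δ A x 3≤x) (expG≤δ x 3≤x) (1≤K*exp-neg (A *ʳ Exponent.G x 3≤x))

    W≤W⇒δ≥δ : ∀ x 3≤x y 3≤y → Exponent.W x 3≤x ≤ʳ Exponent.W y 3≤y → δ A y 3≤y ≤ʳ δ A x 3≤x
    W≤W⇒δ≥δ x 3≤x y 3≤y h = ≤ʳ-trans (δ A y 3≤y) (expG y 3≤y) (δ A x 3≤x) (δ≤expG y 3≤y)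
      (≤ʳ-trans (expG y 3≤y) (expG x 3≤x) (δ A x 3≤x)
        (exp-antimono A {X.G} {X.W} {Y.G} {Y.W} 0≤A X.G≈exp Y.G≈exp h) (expG≤δ x 3≤x))
      where
      module X = Exponent x 3≤x
      module Y = Exponent y 3≤y

    -- log log 7 > ½, and t ↦ 3 t / 5 - log t / 5 increases for t ≥ ½.
    δ-antimono : ∀ x 3≤x y 3≤y → fromℕ 7 ≤ x → x ≤ y → δ A (fromℚ y) 3≤y ≤ʳ δ A (fromℚ x) 3≤x
    δ-antimono x 3≤x y 3≤y 7≤x x≤y = W≤W⇒δ≥δ (fromℚ x) 3≤x (fromℚ y) 3≤y
      (≤ʳ-eventually X.W Y.W ((evL ⟪ (λ n a b → a , b) ⟫ evL₂) ⟪ (λ n h _ → step n (proj₁ h) (proj₂ h)) ⟫ always λ n → n))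
      where
      module X = Exponent (fromℚ x) 3≤x
      module Y = Exponent (fromℚ y) 3≤y
      ζ₁ ζ₂ : ℚ
      -- `ζ₁` is `μ` at 7, where two terms of the series give log 7 ≥ 57/32. `ζ₂` is `μ` at 57/32,
      -- where two terms give a logarithm above ½.
      ζ₁ = 3 ÷ℕ 4
      ζ₂ = 25 ÷ℕ 89
      evL : Eventually λ n → 57 ÷ℕ 32 ≤ seq X.L n
      evL = mapᵉ (λ n → ≤-trans (from-yes (57 ÷ℕ 32 ≤? fromℕ 2 * (ζ₁ * (1ℚ + (1 ÷ℕ 3) * (ζ₁ * ζ₁))))))
        (log-bound (fromℚ x) (3≤⇒0< (fromℚ x) 3≤x) ζ₁ (from-yes (0ℚ ≤? ζ₁))
          (always λ n → ≤-trans (from-yes (ζ₁ ≤? μ (fromℕ 7))) (μ-mono (0≤fromℕ 7) 7≤x)))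
      evL₂ : Eventually λ n → ½ ≤ seq X.L₂ n
      evL₂ = mapᵉ (λ n → ≤-trans (from-yes (½ ≤? fromℕ 2 * (ζ₂ * (1ℚ + (1 ÷ℕ 3) * (ζ₂ * ζ₂))))))
        (log-bound X.L (1<⇒0< X.L X.1<L) ζ₂ (from-yes (0ℚ ≤? ζ₂))
          (mapᵉ (λ n h → ≤-trans (from-yes (ζ₂ ≤? μ (57 ÷ℕ 32))) (μ-mono (from-yes (0ℚ ≤? 57 ÷ℕ 32)) h)) evL))
      1≤x : 1ℚ ≤ x
      1≤x = ≤-trans (from-yes (1ℚ ≤? fromℕ 7)) 7≤x
      step : ∀ n → 57 ÷ℕ 32 ≤ seq X.L n → ½ ≤ seq X.L₂ n → seq X.W n ≤ seq Y.W n
      -- Of the slope 3/5 the part 2/5 pays for (log t)/5, by the Lipschitz constant 2 on t ≥ ½. The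
      -- remaining 1/5 is slack.
      step n hL hu = ≤-by
        (0≤+ (0≤* (from-yes (0ℚ ≤? + 1 / 5)) (p≤q⇒0≤q-p (Λ-lip hu u≤v n)))
             (0≤* (from-yes (0ℚ ≤? + 1 / 5)) (p≤q⇒0≤q-p u≤v)))
        (solve 4 (λ u v p q → con (+ 1 / 5) :* (con (fromℕ 2) :* (v :+ :- u) :+ :- (q :+ :- p)) :+ con (+ 1 / 5) :* (v :+ :- u)
           := con (+ 3 / 5) :* v :+ con (- (+ 1 / 5)) :* q :+ :- (con (+ 3 / 5) :* u :+ con (- (+ 1 / 5)) :* p))
           refl (seq X.L₂ n) (seq Y.L₂ n) (Λ n (seq X.L₂ n)) (Λ n (seq Y.L₂ n)))
        where
        u≤v : seq X.L₂ n ≤ seq Y.L₂ n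
        u≤v = Λ-mono n (≤-trans (from-yes (1ℚ ≤? 57 ÷ℕ 32)) hL) (Λ-mono n 1≤x x≤y)

    δᵢ : ∀ {i} → 3 ℕ.≤ i → ℝ
    δᵢ {i} 3≤i = δ A (fromℚ (fromℕ i)) (fromℕ-mono-≤ʳ 3≤i)

    -- Plain antitonicity fails just after 3: the exponent t ↦ 3 t / 5 - log t / 5 decreases for t <
    -- 1/3, and log log 3 is less than 1/10.
    QuasiAntimono : ℚ → Set
    QuasiAntimono K = 0ℚ ≤ K × (∀ {i} (3≤i : 3 ℕ.≤ i) x 3≤x → fromℕ i ≤ x → δ A (fromℚ x) 3≤x ≤ʳ fromℚ K *ʳ δᵢ 3≤i)

    K-mono : ∀ {p q i} (3≤i : 3 ℕ.≤ i) → p ≤ q → fromℚ p *ʳ δᵢ 3≤i ≤ʳ fromℚ q *ʳ δᵢ 3≤i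
    K-mono {p} {q} {i} 3≤i p≤q = *ʳ-monoʳ (δᵢ 3≤i) (fromℚ p) (fromℚ q)
      (0≤δ (fromℚ (fromℕ i)) (fromℕ-mono-≤ʳ 3≤i)) (≤ʳ-pointwise (fromℚ p) (fromℚ q) λ _ → p≤q)

    -- Vacuous for i < 3, so that the constants form a sequence on all of ℕ which can be summed over
    -- i < 7.
    LowerBound : ℕ → Set
    LowerBound i = ∃ λ K → 0ℚ ≤ K × ((3≤i : 3 ℕ.≤ i) → 1ʳ ≤ʳ fromℚ K *ʳ δᵢ 3≤i)

    lowerBound-at : ∀ i (3≤i : 3 ℕ.≤ i) → (∃ λ K → 0ℚ ≤ K × 1ʳ ≤ʳ fromℚ K *ʳ δᵢ 3≤i) → LowerBound i
    lowerBound-at i 3≤i (K , 0≤K , h) = K , 0≤K , λ 3≤i′ → subst (λ q → 1ʳ ≤ʳ fromℚ K *ʳ δᵢ q) (ℕₚ.≤-irrelevant 3≤i 3≤i′) h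

    lowerBound : ∀ i → LowerBound i
    lowerBound i = by-cases (3 ℕₚ.≤? i)
      where
      by-cases : Dec (3 ℕ.≤ i) → LowerBound i
      by-cases (yes 3≤i) = lowerBound-at i 3≤i (1≤K*δ (fromℚ (fromℕ i)) (fromℕ-mono-≤ʳ 3≤i))
      by-cases (no  3≰i) = 0ℚ , ≤-refl , λ 3≤i → contradiction 3≤i 3≰i

    -- For i < 7 it suffices that δ(x) ≤ 1 ≤ `k i` δ(i), and from 7 on δ is antitone. `K` dominates
    -- the finitely many constants of the first case and the 1 of the second.
    quasi-antimono : (k : ℕ → ℚ) → (∀ i → 0ℚ ≤ k i) → (∀ {i} (3≤i : 3 ℕ.≤ i) → 1ʳ ≤ʳ fromℚ (k i) *ʳ δᵢ 3≤i) → ∃ QuasiAntimono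
    quasi-antimono k 0≤k h = K , 0≤+ 0≤1 (Σ-nonneg 0≤k 7) , λ {i} 3≤i x 3≤x i≤x → by-cases 3≤i x 3≤x i≤x (7 ℕₚ.≤? i)
      where
      K : ℚ
      K = 1ℚ + Σ[ 7 ] k
      by-cases : ∀ {i} (3≤i : 3 ℕ.≤ i) x 3≤x → fromℕ i ≤ x → Dec (7 ℕ.≤ i) → δ A (fromℚ x) 3≤x ≤ʳ fromℚ K *ʳ δᵢ 3≤i
      by-cases {i} 3≤i x 3≤x i≤x (no 7≰i) = ≤ʳ-trans (δ A (fromℚ x) 3≤x) 1ʳ (fromℚ K *ʳ δᵢ 3≤i) (δ≤1 (fromℚ x) 3≤x)
        (≤ʳ-trans 1ʳ (fromℚ (k i) *ʳ δᵢ 3≤i) (fromℚ K *ʳ δᵢ 3≤i) (h 3≤i) (K-mono {k i} {K} 3≤i k≤K))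
        where
        k≤K : k i ≤ K
        k≤K = ≤-trans (subst (λ m → k i ≤ Σ[ m ] k) (ℕₚ.m∸n+n≡m (ℕₚ.≰⇒> 7≰i)) (term≤Σ 0≤k i (7 ∸ suc i)))
          (≤-castʳ (+-comm (Σ[ 7 ] k) 1ℚ) (p≤p+q 0≤1))
      by-cases {i} 3≤i x 3≤x i≤x (yes 7≤i) = ≤ʳ-trans (δ A (fromℚ x) 3≤x) D (fromℚ K *ʳ D)
          (δ-antimono (fromℕ i) (fromℕ-mono-≤ʳ 3≤i) x 3≤x (fromℕ-mono 7≤i) i≤x)
          (≤ʳ-trans D (1ʳ *ʳ D) (fromℚ K *ʳ D)
            (≤ʳ-pointwise D (1ʳ *ʳ D) λ n → ≤-reflexive (sym (*-identityˡ (seq D n))))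
            (K-mono {1ℚ} {K} 3≤i (p≤p+q (Σ-nonneg 0≤k 7))))
        where
        D : ℝ
        D = δᵢ 3≤i

    δ-quasi-antimono : ∃ QuasiAntimono
    δ-quasi-antimono = quasi-antimono (λ i → proj₁ (lowerBound i)) (λ i → proj₁ (proj₂ (lowerBound i)))
      λ {i} → proj₂ (proj₂ (lowerBound i))

-- Duplicate-free lists, Farey fractions as pairs, integers coprime to n

module Counting where

  open import Data.Bool.Base using (true; false)
  open import Data.List.Base using (List; []; _∷_; _++_; length; filter; map; concatMap; upTo; [_]; _∷ʳ_)
  open import Data.List.Properties using (map-concatMap; concatMap-++; filter-++; length-++; length-map; upTo-∷ʳ; map-++; map-∘; concatMap-cong; ++-identityʳ)
  open import Data.List.Membership.Propositional using (_∈_)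
  open import Data.List.Membership.Propositional.Properties
    using (∈-∃++; ∈-++⁺ˡ; ∈-++⁺ʳ; ∈-++⁻; ∈-map⁺; ∈-map⁻; ∈-filter⁺; ∈-filter⁻; ∈-upTo⁺; ∈-upTo⁻)
  open import Data.List.Relation.Binary.Permutation.Propositional.Properties using (filter-↭; ↭-length)
  open import Data.List.Relation.Unary.All as All using (All)
  open import Data.List.Relation.Unary.AllPairs using ([]; _∷_)
  open import Data.List.Relation.Unary.Any using (here; there)
  open import Data.List.Relation.Unary.Unique.Propositional using (Unique)
  import Data.List.Relation.Unary.Unique.Propositional.Properties as Uniqueₚ
  import Data.List.Sort
  open import Data.Nat.Base
  open import Data.Nat.Coprimality using (Coprime; coprime?)
  open import Data.Nat.Divisibility using (∣m+n∣m⇒∣n; ∣m∣n⇒∣m+n; _∣_)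
  open import Data.Nat.Properties
  open import Data.Product.Base using (∃; _×_; _,_; proj₁; proj₂)
  open import Data.Rational.Base as ℚ using (ℚ) renaming (_≤_ to _≤ℚ_)
  import Data.Rational.Properties as ℚₚ
  open import Data.Sum.Base using (_⊎_; inj₁; inj₂)
  open import Function.Base using (_∘_)
  open import Level using (Level)
  open import Relation.Binary.PropositionalEquality hiding ([_])
  open import Relation.Nullary using (¬_; yes; no; does; contradiction)
  open import Relation.Nullary.Decidable using (_×-dec_; ¬?)
  open import Relation.Unary using (Decidable)

  private variable
    a p : Level
    A B : Set a
    P Q R : A → Set p

  -- Cardinalities of duplicate-free lists

  unique-⊆⇒length≤ : {xs ys : List A} → Unique xs → (∀ {z} → z ∈ xs → z ∈ ys) → length xs ≤ length ys
  unique-⊆⇒length≤ {xs = []} _ _ = z≤n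
  unique-⊆⇒length≤ {xs = x ∷ xs} (x∉xs ∷ u) xs⊆ys with ∈-∃++ (xs⊆ys (here refl))
  ... | as , bs , refl = begin
    suc (length xs)              ≤⟨ s≤s (unique-⊆⇒length≤ u xs⊆as++bs) ⟩
    suc (length (as ++ bs))      ≡⟨ cong suc (length-++ as) ⟩
    suc (length as + length bs)  ≡⟨ sym (+-suc (length as) (length bs)) ⟩
    length as + suc (length bs)  ≡⟨ sym (length-++ as) ⟩
    length (as ++ x ∷ bs)        ∎
    where
    open ≤-Reasoning
    xs⊆as++bs : ∀ {z} → z ∈ xs → z ∈ as ++ bs
    xs⊆as++bs z∈xs with ∈-++⁻ as (xs⊆ys (there z∈xs))
    ... | inj₁ z∈as         = ∈-++⁺ˡ z∈as
    ... | inj₂ (here z≡x)   = contradiction (sym z≡x) (All.lookup x∉xs z∈xs)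
    ... | inj₂ (there z∈bs) = ∈-++⁺ʳ as z∈bs

  bijection⇒length≡ : (f : A → B) → (∀ {x y} → f x ≡ f y → x ≡ y) → {xs : List A} {ys : List B} →
                      Unique xs → Unique ys → (∀ {x} → x ∈ xs → f x ∈ ys) →
                      (∀ {y} → y ∈ ys → ∃ λ x → x ∈ xs × y ≡ f x) → length xs ≡ length ys
  bijection⇒length≡ f inj {xs} {ys} uxs uys to from = trans (sym (length-map f xs))
    (≤-antisym (unique-⊆⇒length≤ (Uniqueₚ.map⁺ inj uxs) into) (unique-⊆⇒length≤ uys onto))
    where
    into : ∀ {z} → z ∈ map f xs → z ∈ ys
    into z∈ with ∈-map⁻ f z∈
    ... | x , x∈xs , refl = to x∈xs
    onto : ∀ {z} → z ∈ ys → z ∈ map f xs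
    onto z∈ with from z∈
    ... | x , x∈xs , refl = ∈-map⁺ f x∈xs

  filter-map-length : (P? : Decidable P) (f : A → B) (xs : List A) →
                      length (filter P? (map f xs)) ≡ length (filter (λ x → P? (f x)) xs)
  filter-map-length P? f []       = refl
  filter-map-length P? f (x ∷ xs) with does (P? (f x))
  ... | true  = cong suc (filter-map-length P? f xs)
  ... | false = filter-map-length P? f xs

  filter-length-split : (P? : Decidable P) (Q? : Decidable Q) → (∀ x → P x → Q x) → (xs : List A) →
    length (filter Q? xs) ≡ length (filter P? xs) + length (filter (λ x → Q? x ×-dec ¬? (P? x)) xs)
  filter-length-split P? Q? P⇒Q []       = refl
  filter-length-split P? Q? P⇒Q (x ∷ xs) with P? x | Q? x
  ... | yes p | yes q = cong suc (filter-length-split P? Q? P⇒Q xs)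
  ... | yes p | no ¬q = contradiction (P⇒Q x p) ¬q
  ... | no ¬p | yes q = trans (cong suc (filter-length-split P? Q? P⇒Q xs)) (sym (+-suc _ _))
  ... | no ¬p | no ¬q = filter-length-split P? Q? P⇒Q xs

  filter-length-∪ : (P? : Decidable P) (Q? : Decidable Q) (R? : Decidable R) → (xs : List A) →
    (∀ {x} → x ∈ xs → P x → Q x ⊎ R x) →
    length (filter P? xs) ≤ length (filter Q? xs) + length (filter R? xs)
  filter-length-∪ P? Q? R? []       h = z≤n
  filter-length-∪ P? Q? R? (x ∷ xs) h with filter-length-∪ P? Q? R? xs (h ∘ there) | P? x | Q? x | R? x
  ... | ih | no _  | no _  | no _  = ih
  ... | ih | no _  | no _  | yes _ = ≤-trans ih (+-monoʳ-≤ _ (n≤1+n _))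
  ... | ih | no _  | yes _ | no _  = m≤n⇒m≤1+n ih
  ... | ih | no _  | yes _ | yes _ = m≤n⇒m≤1+n (≤-trans ih (+-monoʳ-≤ _ (n≤1+n _)))
  ... | ih | yes _ | yes _ | no _  = s≤s ih
  ... | ih | yes _ | yes _ | yes _ = s≤s (≤-trans ih (+-monoʳ-≤ _ (n≤1+n _)))
  ... | ih | yes _ | no _  | yes _ = ≤-trans (s≤s ih) (≤-reflexive (sym (+-suc (length (filter Q? xs)) _)))
  ... | ih | yes p | no ¬q | no ¬r with h (here refl) p
  ...   | inj₁ q = contradiction q ¬q
  ...   | inj₂ r = contradiction r ¬r

  filter-length-cong : (P? : Decidable P) (Q? : Decidable Q) (xs : List A) →
    (∀ {x} → x ∈ xs → (P x → Q x) × (Q x → P x)) → length (filter P? xs) ≡ length (filter Q? xs)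
  filter-length-cong P? Q? []       h = refl
  filter-length-cong P? Q? (x ∷ xs) h with filter-length-cong P? Q? xs (h ∘ there) | P? x | Q? x
  ... | ih | yes _ | yes _ = cong suc ih
  ... | ih | no _  | no _  = ih
  ... | ih | yes p | no ¬q = contradiction (proj₁ (h (here refl)) p) ¬q
  ... | ih | no ¬p | yes q = contradiction (proj₂ (h (here refl)) q) ¬p

  filter-length-∁ : (P? : Decidable P) (xs : List A) →
                    length xs ≡ length (filter P? xs) + length (filter (λ x → ¬? (P? x)) xs)
  filter-length-∁ P? []       = refl
  filter-length-∁ P? (x ∷ xs) with P? x
  ... | yes _ = cong suc (filter-length-∁ P? xs)
  ... | no  _ = trans (cong suc (filter-length-∁ P? xs)) (sym (+-suc _ _))

  oneTo : ℕ → List ℕ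
  oneTo n = map suc (upTo n)

  oneTo-∷ʳ : ∀ n → oneTo (suc n) ≡ oneTo n ∷ʳ suc n
  oneTo-∷ʳ n = trans (cong (map suc) (sym (upTo-∷ʳ n))) (map-++ suc (upTo n) [ n ])

  ∈-oneTo⁺ : ∀ {m n} → 0 < m → m ≤ n → m ∈ oneTo n
  ∈-oneTo⁺ {suc m} _ m<n = ∈-map⁺ suc (∈-upTo⁺ m<n)

  ∈-oneTo⁻ : ∀ {m n} → m ∈ oneTo n → 0 < m × m ≤ n
  ∈-oneTo⁻ {m} {n} m∈ with ∈-map⁻ suc m∈
  ... | k , k∈ , refl = s≤s z≤n , ∈-upTo⁻ k∈

  oneTo-unique : ∀ n → Unique (oneTo n)
  oneTo-unique n = Uniqueₚ.map⁺ suc-injective (Uniqueₚ.upTo⁺ n)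

  pairsOver : List ℕ → (ℕ → List ℕ) → List (ℕ × ℕ)
  pairsOver xs g = concatMap (λ x → map (x ,_) (g x)) xs

  ∈-pairsOver⁺ : ∀ {x y} xs g → x ∈ xs → y ∈ g x → (x , y) ∈ pairsOver xs g
  ∈-pairsOver⁺ (x ∷ xs) g (here refl) y∈ = ∈-++⁺ˡ (∈-map⁺ (x ,_) y∈)
  ∈-pairsOver⁺ (z ∷ xs) g (there x∈)  y∈ = ∈-++⁺ʳ (map (z ,_) (g z)) (∈-pairsOver⁺ xs g x∈ y∈)

  ∈-pairsOver⁻ : ∀ {x y} xs g → (x , y) ∈ pairsOver xs g → x ∈ xs × y ∈ g x
  ∈-pairsOver⁻ (z ∷ xs) g xy∈ with ∈-++⁻ (map (z ,_) (g z)) xy∈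
  ... | inj₂ h = let (x∈ , y∈) = ∈-pairsOver⁻ xs g h in there x∈ , y∈
  ... | inj₁ h with ∈-map⁻ (z ,_) h
  ...   | y , y∈ , refl = here refl , y∈

  pairsOver-unique : ∀ {xs} g → Unique xs → (∀ x → Unique (g x)) → Unique (pairsOver xs g)
  pairsOver-unique {[]}     g _        _  = []
  pairsOver-unique {x ∷ xs} g (x∉ ∷ u) ug = Uniqueₚ.++⁺
    (Uniqueₚ.map⁺ (λ { refl → refl }) (ug x)) (pairsOver-unique g u ug)
    λ { (z∈ , z∈′) → disjoint z∈ z∈′ }
    where
    disjoint : ∀ {z} → z ∈ map (x ,_) (g x) → ¬ z ∈ pairsOver xs g
    disjoint z∈ z∈′ with ∈-map⁻ (x ,_) z∈
    ... | y , _ , refl = All.lookup x∉ (proj₁ (∈-pairsOver⁻ xs g z∈′)) refl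

  length-pairsOver-upTo : ∀ g n → fromℕ (length (pairsOver (upTo n) g)) ≡ Σ[ n ] (λ k → fromℕ (length (g k)))
  length-pairsOver-upTo g zero    = refl
  length-pairsOver-upTo g (suc n) = trans (cong fromℕ eq)
    (trans (ℚ-Lemmas.fromℕ-+ (length (pairsOver (upTo n) g)) (length (g n)))
      (cong (ℚ._+ fromℕ (length (g n))) (length-pairsOver-upTo g n)))
    where
    f : ℕ → List (ℕ × ℕ)
    f x = map (x ,_) (g x)
    eq : length (pairsOver (upTo (suc n)) g) ≡ length (pairsOver (upTo n) g) + length (g n)
    eq = trans (cong (λ l → length (concatMap f l)) (sym (upTo-∷ʳ n)))
      (trans (cong length (concatMap-++ f (upTo n) [ n ]))
        (trans (length-++ (pairsOver (upTo n) g))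
          (cong (length (pairsOver (upTo n) g) +_)
            (trans (cong length (++-identityʳ (f n))) (length-map (n ,_) (g n))))))

  -- The pairs (denominator , numerator) of the Farey fractions

  numerators : ℕ → List ℕ
  numerators b = filter (λ a → coprime? a b) (upTo (suc b))

  fareyPairs : ℕ → List (ℕ × ℕ)
  fareyPairs N = pairsOver (oneTo N) numerators

  fraction : ℕ × ℕ → ℚ
  fraction (b , a) = a ÷ℕ b

  fareyPairs-unique : ∀ N → Unique (fareyPairs N)
  fareyPairs-unique N = pairsOver-unique numerators (oneTo-unique N)
    λ b → Uniqueₚ.filter⁺ (λ a → coprime? a b) (Uniqueₚ.upTo⁺ (suc b))

  ∈-fareyPairs⁺ : ∀ {N b a} → 0 < b → b ≤ N → a ≤ b → Coprime a b → (b , a) ∈ fareyPairs N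
  ∈-fareyPairs⁺ {N} {b} 0<b b≤N a≤b c = ∈-pairsOver⁺ (oneTo N) numerators (∈-oneTo⁺ 0<b b≤N)
    (∈-filter⁺ (λ a → coprime? a b) (∈-upTo⁺ (s≤s a≤b)) λ {d} → c {d})

  ∈-fareyPairs⁻ : ∀ {N b a} → (b , a) ∈ fareyPairs N → 0 < b × b ≤ N × a ≤ b × Coprime a b
  ∈-fareyPairs⁻ {N} {b} ba∈ with ∈-pairsOver⁻ (oneTo N) numerators ba∈
  ... | b∈ , a∈ with ∈-filter⁻ (λ a → coprime? a b) {xs = upTo (suc b)} a∈
  ...   | a∈′ , c = proj₁ (∈-oneTo⁻ b∈) , proj₂ (∈-oneTo⁻ b∈) , s≤s⁻¹ (∈-upTo⁻ a∈′) , λ {d} → c {d}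

  open Data.List.Sort ℚₚ.≤-decTotalOrder using (sort-↭)

  unsorted : ℕ → List ℚ
  unsorted N = concatMap (λ b → map (_÷ℕ b) (numerators b)) (oneTo N)

  unsorted≡ : ∀ N → unsorted N ≡ map fraction (fareyPairs N)
  unsorted≡ N = sym (trans (map-concatMap fraction (λ x → map (x ,_) (numerators x)) (oneTo N))
    (concatMap-cong (λ b → sym (map-∘ (numerators b))) (oneTo N)))

  -- Sorting is a permutation, so the count may be taken over the unsorted pairs.
  rank≡ : ∀ N x → rank N x ≡ length (filter (λ z → fraction z ℚₚ.≤? x) (fareyPairs N))
  rank≡ N x = trans (↭-length (filter-↭ (ℚₚ._≤? x) (sort-↭ (unsorted N))))
    (trans (cong (λ l → length (filter (ℚₚ._≤? x) l)) (unsorted≡ N))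
      (filter-map-length (ℚₚ._≤? x) fraction (fareyPairs N)))

  length-Farey : ∀ N → length (Farey N) ≡ length (fareyPairs N)
  length-Farey N = trans (↭-length (sort-↭ (unsorted N)))
    (trans (cong length (unsorted≡ N)) (length-map fraction (fareyPairs N)))

  -- Counting integers coprime to n

  coprimes : ℕ → ℕ → ℕ
  coprimes n j = length (filter (λ k → coprime? k n) (oneTo j))

  count-∷ʳ : {P : ℕ → Set} (P? : Decidable P) → ∀ j →
             length (filter P? (oneTo (suc j))) ≡ length (filter P? (oneTo j)) + length (filter P? [ suc j ])
  count-∷ʳ P? j = trans (cong (λ l → length (filter P? l)) (oneTo-∷ʳ j))
    (trans (cong length (filter-++ P? (oneTo j) [ suc j ])) (length-++ (filter P? (oneTo j))))

  count-cong₁ : {P Q : ℕ → Set} (P? : Decidable P) (Q? : Decidable Q) → ∀ {j k} → (P j → Q k) → (Q k → P j) →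
                length (filter P? [ j ]) ≡ length (filter Q? [ k ])
  count-cong₁ P? Q? {j} {k} f g with P? j | Q? k
  ... | yes _ | yes _ = refl
  ... | no _  | no _  = refl
  ... | yes p | no ¬q = contradiction (f p) ¬q
  ... | no ¬p | yes q = contradiction (g q) ¬p

  -- Coprimality to n is periodic: the new integer j + n + 1 is coprime to n exactly when j + 1 is.
  coprimes-+ : ∀ n j → coprimes n (j + n) ≡ coprimes n j + φ n
  coprimes-+ n zero    = refl
  coprimes-+ n (suc j) = trans (count-∷ʳ (λ k → coprime? k n) (j + n))
    (trans (cong₂ _+_ (coprimes-+ n j)
      (count-cong₁ (λ k → coprime? k n) (λ k → coprime? k n) {suc (j + n)} {suc j}
        (λ c {d} → λ { (d∣j , d∣n) → c (∣m∣n⇒∣m+n d∣j d∣n , d∣n) })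
        (λ c {d} → λ { (d∣j , d∣n) → c (∣m+n∣m⇒∣n (subst (d ∣_) (+-comm (suc j) n) d∣j) d∣n , d∣n) })))
    (trans (+-assoc (coprimes n j) (φ n) _) (trans (cong (coprimes n j +_) (+-comm (φ n) _))
      (trans (sym (+-assoc (coprimes n j) _ (φ n)))
        (cong (_+ φ n) (sym (count-∷ʳ (λ k → coprime? k n) j)))))))

  coprimes-* : ∀ n k → coprimes n (k * n) ≡ k * φ n
  coprimes-* n zero    = refl
  coprimes-* n (suc k) = trans (cong (coprimes n) (+-comm n (k * n)))
    (trans (coprimes-+ n (k * n)) (trans (cong (_+ φ n) (coprimes-* n k)) (+-comm (k * φ n) (φ n))))

  coprimesAbove? : ∀ n a → Decidable (λ m → a < m × Coprime m n)
  coprimesAbove? n a m = a <? m ×-dec coprime? m n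

  coprimesAbove : ∀ n a k → length (filter (coprimesAbove? n a) (oneTo (k + a))) + coprimes n a ≡ coprimes n (k + a)
  coprimesAbove n a zero    = cong (_+ coprimes n a) (n≤0⇒n≡0 (unique-⊆⇒length≤ {ys = []}
      (Uniqueₚ.filter⁺ (coprimesAbove? n a) (oneTo-unique a)) λ z∈ →
        let (z∈′ , a<z , _) = ∈-filter⁻ (coprimesAbove? n a) {xs = oneTo a} z∈ in
        contradiction (proj₂ (∈-oneTo⁻ z∈′)) (<⇒≱ a<z)))
  coprimesAbove n a (suc k) = trans (cong (_+ coprimes n a) (count-∷ʳ (coprimesAbove? n a) (k + a)))
    (trans (+-assoc c _ _) (trans (cong (c +_) (+-comm _ (coprimes n a))) (trans (sym (+-assoc c _ _))
      (trans (cong₂ _+_ (coprimesAbove n a k)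
        (count-cong₁ (coprimesAbove? n a) (λ k → coprime? k n) {suc (k + a)} {suc (k + a)}
          (λ h {d} → proj₂ h {d}) (λ h → s≤s (m≤n+m a k) , λ {d} → h {d})))
        (sym (count-∷ʳ (λ k → coprime? k n) (k + a)))))))
    where
    c = length (filter (coprimesAbove? n a) (oneTo (k + a)))

  -- The integers above q n and up to (t + q) n make up `t` whole periods, so there is no error
  -- term. This is what divisibility of L by n provides.
  coprimesAbove-* : ∀ n q t → length (filter (coprimesAbove? n (q * n)) (oneTo ((t + q) * n))) ≡ t * φ n
  coprimesAbove-* n q t = +-cancelʳ-≡ (q * φ n) _ _ (begin
    length (filter (coprimesAbove? n (q * n)) (oneTo ((t + q) * n))) + q * φ n
      ≡⟨ cong₂ (λ x y → length (filter (coprimesAbove? n (q * n)) (oneTo x)) + y) (*-distribʳ-+ n t q) (sym (coprimes-* n q)) ⟩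
    length (filter (coprimesAbove? n (q * n)) (oneTo (t * n + q * n))) + coprimes n (q * n)
      ≡⟨ coprimesAbove n (q * n) (t * n) ⟩
    coprimes n (t * n + q * n)
      ≡⟨ cong (coprimes n) (sym (*-distribʳ-+ n t q)) ⟩
    coprimes n ((t + q) * n)
      ≡⟨ coprimes-* n (t + q) ⟩
    (t + q) * φ n
      ≡⟨ *-distribʳ-+ (φ n) t q ⟩
    t * φ n + q * φ n ∎)
    where open ≡-Reasoning

-- Lattice points in a truncated cone, counted column by column

module RankDifference where

  open import Data.List.Base using (List; length; filter; map; upTo; [_])
  open import Data.List.Membership.Propositional using (_∈_)
  open import Data.List.Membership.Propositional.Properties using (∈-map⁺; ∈-filter⁺; ∈-filter⁻; ∈-upTo⁺)
  open import Data.List.Relation.Unary.Any using (here)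
  open import Data.List.Relation.Unary.Unique.Propositional using (Unique)
  import Data.List.Relation.Unary.Unique.Propositional.Properties as Uniqueₚ
  open import Data.Nat.Base
  open import Data.Nat.Coprimality using (Coprime)
  open import Data.Nat.Divisibility using (_∣_; ∣m+n∣m⇒∣n; ∣m∣n⇒∣m+n; ∣n⇒∣m*n; ∣m⇒∣m*n; ∣-refl; _∣0)
  open import Data.Nat.Properties
  open import Data.Nat.Solver
  open import Data.Product.Base using (_×_; _,_; proj₁; proj₂)
  open import Data.Rational.Base as ℚ using (ℚ; 0ℚ; 1ℚ) renaming (_≤_ to _≤ℚ_)
  import Data.Rational.Properties as ℚₚ
  import Data.Rational.Solver
  open import Data.Sum.Base using (_⊎_; inj₁; inj₂)
  open import Relation.Binary.PropositionalEquality hiding ([_])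
  open import Relation.Nullary using (¬_; yes; no; contradiction)
  open import Relation.Nullary.Decidable using (from-yes)
  open import Relation.Unary using (Decidable)
  open +-*-Solver
  open Counting
  open ℚ-Lemmas using (fromℕ-mono; fromℕ-suc; 0≤fromℕ; pos*inv; *ʳ-mono)
  open ExpLemmas using (fromℕ-*; 0<fromℕ)

  fromℕ<fromℕ-suc : ∀ n → fromℕ n ℚ.< fromℕ (suc n)
  fromℕ<fromℕ-suc n = subst₂ ℚ._<_ (ℚₚ.+-identityʳ (fromℕ n)) (sym (fromℕ-suc n)) (ℚₚ.+-monoʳ-< (fromℕ n) (from-yes (0ℚ ℚₚ.<? 1ℚ)))

  fromℕ-cancel-≤ : ∀ {m n} → fromℕ m ≤ℚ fromℕ n → m ≤ n
  fromℕ-cancel-≤ {m} {n} h with m ≤? n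
  ... | yes m≤n = m≤n
  ... | no  m≰n = contradiction refl (ℚₚ.<⇒≢ (ℚₚ.<-≤-trans (fromℕ<fromℕ-suc n) (ℚₚ.≤-trans (fromℕ-mono (≰⇒> m≰n)) h)))

  ÷ℕ-*-cancel : ∀ a {b} → 0 < b → a ÷ℕ b ℚ.* fromℕ b ≡ fromℕ a
  ÷ℕ-*-cancel a {b} 0<b = trans (ℚₚ.*-assoc (fromℕ a) (inv (fromℕ b)) (fromℕ b))
    (trans (cong (fromℕ a ℚ.*_) (trans (ℚₚ.*-comm (inv (fromℕ b)) (fromℕ b)) (pos*inv (0<fromℕ 0<b))))
      (ℚₚ.*-identityʳ (fromℕ a)))

  private
    cross : ∀ a {b} d → 0 < b → a ÷ℕ b ℚ.* fromℕ (b * d) ≡ fromℕ (a * d)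
    cross a {b} d 0<b = trans (cong (a ÷ℕ b ℚ.*_) (fromℕ-* b d))
      (trans (sym (ℚₚ.*-assoc (a ÷ℕ b) (fromℕ b) (fromℕ d)))
        (trans (cong (ℚ._* fromℕ d) (÷ℕ-*-cancel a 0<b)) (sym (fromℕ-* a d))))

    cross′ : ∀ b c {d} → 0 < d → c ÷ℕ d ℚ.* fromℕ (b * d) ≡ fromℕ (c * b)
    cross′ b c {d} 0<d = trans (cong (λ k → c ÷ℕ d ℚ.* fromℕ k) (*-comm b d)) (cross c b 0<d)

  ÷ℕ-≤⁻ : ∀ {a b c d} → 0 < b → 0 < d → a ÷ℕ b ≤ℚ c ÷ℕ d → a * d ≤ c * b
  ÷ℕ-≤⁻ {a} {b} {c} {d} 0<b 0<d h = fromℕ-cancel-≤ (subst₂ _≤ℚ_ (cross a d 0<b) (cross′ b c 0<d)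
    (*ʳ-mono (0≤fromℕ (b * d)) h))

  ÷ℕ-≤⁺ : ∀ {a b c d} → 0 < b → 0 < d → a * d ≤ c * b → a ÷ℕ b ≤ℚ c ÷ℕ d
  ÷ℕ-≤⁺ {a} {b} {c} {d} 0<b 0<d h = ℚₚ.*-cancelʳ-≤-pos (fromℕ (b * d))
    {{ℚ.positive (0<fromℕ (*-mono-≤ 0<b 0<d))}}
    (subst₂ _≤ℚ_ (sym (cross a d 0<b)) (sym (cross′ b c 0<d)) (fromℕ-mono h))

  -- Lattice coordinates with respect to a unimodular basis

  module Unimodular (a₁ b₁ a₂ b₂ : ℕ) (det : a₂ * b₁ ≡ a₁ * b₂ + 1) where

    -- Cramer's rule: the coordinates of (a , b) are n = a b₁ - a₁ b and m = a₂ b - a b₂, written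
    -- additively to stay in ℕ.
    coordinates : ∀ m n → (a₁ * m + a₂ * n) * b₁ ≡ a₁ * (b₁ * m + b₂ * n) + n ×
                          a₂ * (b₁ * m + b₂ * n) ≡ (a₁ * m + a₂ * n) * b₂ + m
    coordinates m n =
      trans (solve 5 (λ a₁ b₁ a₂ m n → (a₁ :* m :+ a₂ :* n) :* b₁ := a₁ :* b₁ :* m :+ (a₂ :* b₁) :* n) refl a₁ b₁ a₂ m n)
        (trans (cong (λ D → a₁ * b₁ * m + D * n) det)
          (solve 5 (λ a₁ b₁ b₂ m n → a₁ :* b₁ :* m :+ (a₁ :* b₂ :+ con 1) :* n := a₁ :* (b₁ :* m :+ b₂ :* n) :+ n) refl a₁ b₁ b₂ m n)) ,
      trans (solve 5 (λ b₁ a₂ b₂ m n → a₂ :* (b₁ :* m :+ b₂ :* n) := (a₂ :* b₁) :* m :+ a₂ :* b₂ :* n) refl b₁ a₂ b₂ m n)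
        (trans (cong (λ D → D * m + a₂ * b₂ * n) det)
          (solve 5 (λ a₁ a₂ b₂ m n → (a₁ :* b₂ :+ con 1) :* m :+ a₂ :* b₂ :* n := (a₁ :* m :+ a₂ :* n) :* b₂ :+ m) refl a₁ a₂ b₂ m n))

    module _ (a b : ℕ) {m n : ℕ} (hn : a * b₁ ≡ a₁ * b + n) (hm : a₂ * b ≡ a * b₂ + m) where

      -- The inverse of `coordinates`. Multiply `a` and `b` by the determinant a₂ b₁ - a₁ b₂ = 1 and
      -- substitute `hn` and `hm`; the cancelled summand carries the negative part.
      point : a ≡ a₁ * m + a₂ * n × b ≡ b₁ * m + b₂ * n
      point = +-cancelˡ-≡ (a₁ * a * b₂) _ _
          (trans (solve 3 (λ a₁ a b₂ → a₁ :* a :* b₂ :+ a := a :* (a₁ :* b₂ :+ con 1)) refl a₁ a b₂)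
          (trans (cong (a *_) (sym det))
          (trans (solve 3 (λ a a₂ b₁ → a :* (a₂ :* b₁) := a₂ :* (a :* b₁)) refl a a₂ b₁)
          (trans (cong (a₂ *_) hn)
          (trans (solve 4 (λ a₂ a₁ b n → a₂ :* (a₁ :* b :+ n) := a₁ :* (a₂ :* b) :+ a₂ :* n) refl a₂ a₁ b n)
          (trans (cong (λ k → a₁ * k + a₂ * n) hm)
            (solve 6 (λ a₁ a b₂ m a₂ n → a₁ :* (a :* b₂ :+ m) :+ a₂ :* n := a₁ :* a :* b₂ :+ (a₁ :* m :+ a₂ :* n)) refl a₁ a b₂ m a₂ n)))))))
        , +-cancelˡ-≡ (a₁ * b * b₂) _ _
          (trans (solve 3 (λ a₁ b b₂ → a₁ :* b :* b₂ :+ b := b :* (a₁ :* b₂ :+ con 1)) refl a₁ b b₂)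
          (trans (cong (b *_) (sym det))
          (trans (solve 3 (λ b a₂ b₁ → b :* (a₂ :* b₁) := b₁ :* (a₂ :* b)) refl b a₂ b₁)
          (trans (cong (b₁ *_) hm)
          (trans (solve 4 (λ b₁ a b₂ m → b₁ :* (a :* b₂ :+ m) := b₂ :* (a :* b₁) :+ b₁ :* m) refl b₁ a b₂ m)
          (trans (cong (λ k → b₂ * k + b₁ * m) hn)
            (solve 6 (λ a₁ b b₂ n b₁ m → b₂ :* (a₁ :* b :+ n) :+ b₁ :* m := a₁ :* b :* b₂ :+ (b₁ :* m :+ b₂ :* n)) refl a₁ b b₂ n b₁ m)))))))

      -- That is, (a₁ q + a₂) b - a (b₁ q + b₂) = m - q n: the position of a / b relative to the
      -- moving endpoint is decided by comparing m with q n.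
      mediant : ∀ q → (a₁ * q + a₂) * b + q * n ≡ a * (b₁ * q + b₂) + m
      mediant q =
        trans (solve 5 (λ a₁ q a₂ b n → (a₁ :* q :+ a₂) :* b :+ q :* n := q :* (a₁ :* b :+ n) :+ a₂ :* b) refl a₁ q a₂ b n)
        (trans (cong₂ (λ x y → q * x + y) (sym hn) hm)
          (solve 5 (λ q a b₁ b₂ m → q :* (a :* b₁) :+ (a :* b₂ :+ m) := a :* (b₁ :* q :+ b₂) :+ m) refl q a b₁ b₂ m))

      coprime-point : Coprime m n → Coprime a b
      coprime-point c {d} (d∣a , d∣b) = c
        ( ∣m+n∣m⇒∣n (subst (d ∣_) hm (∣n⇒∣m*n a₂ d∣b)) (∣m⇒∣m*n b₂ d∣a)
        , ∣m+n∣m⇒∣n (subst (d ∣_) hn (∣m⇒∣m*n b₁ d∣a)) (∣n⇒∣m*n a₁ d∣b))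

      coprime-coordinates : Coprime a b → Coprime m n
      coprime-coordinates c {d} (d∣m , d∣n) = c
        ( subst (d ∣_) (sym (proj₁ point)) (∣m∣n⇒∣m+n (∣n⇒∣m*n a₁ d∣m) (∣n⇒∣m*n a₂ d∣n))
        , subst (d ∣_) (sym (proj₂ point)) (∣m∣n⇒∣m+n (∣n⇒∣m*n b₁ d∣m) (∣n⇒∣m*n b₂ d∣n)))

    point-injective : ∀ {m n m′ n′} → a₁ * m + a₂ * n ≡ a₁ * m′ + a₂ * n′ → b₁ * m + b₂ * n ≡ b₁ * m′ + b₂ * n′ →
                      m ≡ m′ × n ≡ n′
    point-injective {m} {n} {m′} {n′} ha hb =
      +-cancelˡ-≡ ((a₁ * m + a₂ * n) * b₂) _ _
        (trans (sym (proj₂ (coordinates m n))) (trans (cong (a₂ *_) hb)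
          (trans (proj₂ (coordinates m′ n′)) (cong (λ k → k * b₂ + m′) (sym ha))))) ,
      +-cancelˡ-≡ (a₁ * (b₁ * m + b₂ * n)) _ _
        (trans (sym (proj₁ (coordinates m n))) (trans (cong (_* b₁) ha)
          (trans (proj₁ (coordinates m′ n′)) (cong (λ k → a₁ * k + n′) (sym hb)))))

  -- C m differs from "m > q n is coprime to n" only for m = q n and for m close
  -- to the end L = (t + q) n of the range.

  module Column {n q t : ℕ} {C : ℕ → Set} (C? : Decidable C)
    (C⇒ : ∀ {m} → C m → q * n ≤ m × Coprime m n)
    (⇒C : ∀ {m} → m ≤ (t + q) * n → q * n < m → Coprime m n → C m ⊎ (t + q) * n < m + n) where

    private
      L : ℕ
      L = (t + q) * n
      above? : Decidable (λ m → q * n < m × Coprime m n)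
      above? = coprimesAbove? n (q * n)

    column≤ : length (filter C? (oneTo L)) ≤ t * φ n + 1
    column≤ = ≤-trans (filter-length-∪ C? above? (_≟ q * n) (oneTo L) λ _ → split)
      (+-mono-≤ (≤-reflexive (coprimesAbove-* n q t))
        (unique-⊆⇒length≤ {ys = [ q * n ]} (Uniqueₚ.filter⁺ (_≟ q * n) (oneTo-unique L))
          λ z∈ → here (proj₂ (∈-filter⁻ (_≟ q * n) {xs = oneTo L} z∈))))
      where
      split : ∀ {m} → C m → (q * n < m × Coprime m n) ⊎ m ≡ q * n
      split Cm with C⇒ Cm
      ... | qn≤m , c with m≤n⇒m<n∨m≡n qn≤m
      ...   | inj₁ qn<m = inj₁ (qn<m , λ {d} → c {d})
      ...   | inj₂ qn≡m = inj₂ (sym qn≡m)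

    ≤column : t * φ n ≤ length (filter C? (oneTo L)) + n
    ≤column = ≤-trans (≤-reflexive (sym (coprimesAbove-* n q t)))
      (≤-trans (filter-length-∪ above? C? (λ m → L <? m + n) (oneTo L) λ m∈ h → ⇒C (proj₂ (∈-oneTo⁻ m∈)) (proj₁ h) (λ {d} → proj₂ h {d}))
        (+-monoʳ-≤ (length (filter C? (oneTo L))) (≤-trans
          (unique-⊆⇒length≤ {ys = map (L ∸_) (upTo n)} (Uniqueₚ.filter⁺ (λ m → L <? m + n) (oneTo-unique L)) near-L)
          (≤-reflexive (trans (length-map (L ∸_) (upTo n)) (length-upTo n))))))
      where
      open import Data.List.Properties using (length-map; length-upTo)
      near-L : ∀ {z} → z ∈ filter (λ m → L <? m + n) (oneTo L) → z ∈ map (L ∸_) (upTo n)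
      near-L {z} z∈ with ∈-filter⁻ (λ m → L <? m + n) {xs = oneTo L} z∈
      ... | z∈′ , L<z+n = subst (_∈ map (L ∸_) (upTo n)) (m∸[m∸n]≡n z≤L)
          (∈-map⁺ (L ∸_) (∈-upTo⁺ (+-cancelʳ-< z (L ∸ z) n (subst₂ _<_ (sym (m∸n+n≡m z≤L)) (+-comm z n) L<z+n))))
        where
        z≤L : z ≤ L
        z≤L = proj₂ (∈-oneTo⁻ z∈′)

  coprime-0⇒≡1 : ∀ {m} → Coprime m 0 → m ≡ 1
  coprime-0⇒≡1 {m} c = c (∣-refl , m ∣0)

  weightedTotient totient : ℕ → ℚ
  weightedTotient i = Σ[ i ] (λ k → φ (suc k) ÷ℕ suc k)
  totient i = Σ[ i ] (λ k → fromℕ (φ (suc k)))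

  -- Bounds for a number of lattice points (n , m) with m ≥ q n, m coprime to n
  -- and b₁ m + b₂ n ≤ b₁ L

  module Region (b₁ b₂ q L i : ℕ) (b₂<b₁ : b₂ < b₁)
    (t : ℕ → ℕ) (t-eq : ∀ {n} → 0 < n → n ≤ i → L ≡ (t n + q) * n)
    {C : ℕ → ℕ → Set} (C? : ∀ n → Decidable (C n))
    (C⇒ : ∀ {n m} → C n m → q * n ≤ m × Coprime m n)
    (⇒C : ∀ {n m} → 0 < n → q * n < m → Coprime m n → b₁ * m + b₂ * n ≤ b₁ * L → C n m) where

    column : ℕ → List ℕ
    column n = filter (C? n) (oneTo L)

    region : List (ℕ × ℕ)
    region = pairsOver (upTo (suc i)) column

    region-unique : Unique region
    region-unique = pairsOver-unique column (Uniqueₚ.upTo⁺ (suc i)) λ n → Uniqueₚ.filter⁺ (C? n) (oneTo-unique L)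

    ∈-region⁺ : ∀ {n m} → n ≤ i → 0 < m → m ≤ L → C n m → (n , m) ∈ region
    ∈-region⁺ {n} n≤i 0<m m≤L c = ∈-pairsOver⁺ (upTo (suc i)) column (∈-upTo⁺ (s≤s n≤i))
      (∈-filter⁺ (C? n) (∈-oneTo⁺ 0<m m≤L) c)

    ∈-region⁻ : ∀ {n m} → (n , m) ∈ region → 0 < m × C n m
    ∈-region⁻ {n} nm∈ with ∈-pairsOver⁻ (upTo (suc i)) column nm∈
    ... | n∈ , m∈ with ∈-filter⁻ (C? n) {xs = oneTo L} m∈
    ...   | m∈′ , c = proj₁ (∈-oneTo⁻ m∈′) , c

    -- Here `b₂<b₁` enters: b₁ m + b₂ n is at most b₁ (m + n), so only the last n values of m up to
    -- L can violate the bound on the denominator.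
    far : ∀ {n m} → ¬ (b₁ * m + b₂ * n ≤ b₁ * L) → L < m + n
    far {n} {m} h = *-cancelˡ-< b₁ L (m + n) (<-≤-trans (≰⇒> h)
      (≤-trans (+-monoʳ-≤ (b₁ * m) (*-monoˡ-≤ n (<⇒≤ b₂<b₁))) (≤-reflexive (sym (*-distribˡ-+ b₁ m n)))))

    column-bounds : ∀ {n} → 0 < n → n ≤ i → length (column n) ≤ t n * φ n + 1 × t n * φ n ≤ length (column n) + n
    column-bounds {n} 0<n n≤i = subst (λ l → length (filter (C? n) (oneTo l)) ≤ t n * φ n + 1 × t n * φ n ≤ length (filter (C? n) (oneTo l)) + n)
      (sym eq) (Column.column≤ {n} {q} {t n} (C? n) C⇒ back , Column.≤column {n} {q} {t n} (C? n) C⇒ back)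
      where
      eq : L ≡ (t n + q) * n
      eq = t-eq 0<n n≤i
      back : ∀ {m} → m ≤ (t n + q) * n → q * n < m → Coprime m n → C n m ⊎ (t n + q) * n < m + n
      back {m} _ qn<m c with b₁ * m + b₂ * n ≤? b₁ * L
      ... | yes h = inj₁ (⇒C 0<n qn<m (λ {d} → c {d}) h)
      ... | no ¬h = inj₂ (subst (_< m + n) eq (far {n} ¬h))

    -- Only m = 1 is coprime to 0. The pair n = 0, m = 1 represents a₁ / b₁ itself.
    column-0 : length (column 0) ≤ 1
    column-0 = unique-⊆⇒length≤ {ys = [ 1 ]} (Uniqueₚ.filter⁺ (C? 0) (oneTo-unique L))
      λ z∈ → here (coprime-0⇒≡1 (λ {d} → proj₂ (C⇒ (proj₂ (∈-filter⁻ (C? 0) {xs = oneTo L} z∈))) {d}))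

    -- The expected size (L/n - q) φ(n) of column n, kept as a combination of φ(n)/n and φ(n) so
    -- that the sum yields the two totient sums.
    γ : ℕ → ℚ
    γ zero    = 0ℚ
    γ (suc k) = fromℕ L ℚ.* (φ (suc k) ÷ℕ suc k) ℚ.- fromℕ q ℚ.* fromℕ (φ (suc k))

    γ-suc : ∀ {k} → k < i → γ (suc k) ≡ fromℕ (t (suc k) * φ (suc k))
    γ-suc {k} k<i = trans (cong (λ l → l ℚ.* (φ (suc k) ÷ℕ suc k) ℚ.- fromℕ q ℚ.* F)
        (trans (cong fromℕ (t-eq (s≤s z≤n) k<i)) (trans (fromℕ-* (T + q) (suc k)) (cong (ℚ._* n) (ℚ-Lemmas.fromℕ-+ T q)))))
      (trans (Q.solve 5 (λ t q n F i → ((t Q.:+ q) Q.:* n) Q.:* (F Q.:* i) Q.:+ Q.:- (q Q.:* F)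
           Q.:= (t Q.:+ q) Q.:* F Q.:* (n Q.:* i) Q.:+ Q.:- (q Q.:* F)) refl (fromℕ T) (fromℕ q) n F (inv n))
      (trans (cong (λ u → (fromℕ T ℚ.+ fromℕ q) ℚ.* F ℚ.* u ℚ.- fromℕ q ℚ.* F) (pos*inv (0<fromℕ {suc k} (s≤s z≤n))))
      (trans (Q.solve 3 (λ t q F → (t Q.:+ q) Q.:* F Q.:* Q.con 1ℚ Q.:+ Q.:- (q Q.:* F) Q.:= t Q.:* F) refl (fromℕ T) (fromℕ q) F)
        (sym (fromℕ-* T (φ (suc k)))))))
      where
      module Q = Data.Rational.Solver.+-*-Solver
      T = t (suc k)
      n = fromℕ (suc k)
      F = fromℕ (φ (suc k))

    Σγ : ∀ j → Σ[ suc j ] γ ≡ fromℕ L ℚ.* weightedTotient j ℚ.- fromℕ q ℚ.* totient j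
    Σγ zero    = Q.solve 2 (λ l q → Q.con 0ℚ Q.:+ Q.con 0ℚ Q.:= l Q.:* Q.con 0ℚ Q.:+ Q.:- (q Q.:* Q.con 0ℚ)) refl (fromℕ L) (fromℕ q)
      where module Q = Data.Rational.Solver.+-*-Solver
    Σγ (suc j) = trans (cong (ℚ._+ γ (suc j)) (Σγ j))
      (Q.solve 6 (λ l q T S f g → (l Q.:* T Q.:+ Q.:- (q Q.:* S)) Q.:+ (l Q.:* f Q.:+ Q.:- (q Q.:* g))
          Q.:= l Q.:* (T Q.:+ f) Q.:+ Q.:- (q Q.:* (S Q.:+ g))) refl
          (fromℕ L) (fromℕ q) (weightedTotient j) (totient j) (φ (suc j) ÷ℕ suc j) (fromℕ (φ (suc j))))
      where module Q = Data.Rational.Solver.+-*-Solver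

    term-bound : ∀ n → n < suc i → ℚ.∣ fromℕ (length (column n)) ℚ.- γ n ∣ ≤ℚ fromℕ (suc i)
    term-bound zero    _ = subst (_≤ℚ fromℕ (suc i))
      (sym (trans (cong ℚ.∣_∣ (ℚₚ.+-identityʳ (fromℕ (length (column 0))))) (ℚₚ.0≤p⇒∣p∣≡p (0≤fromℕ (length (column 0))))))
      (fromℕ-mono {length (column 0)} {suc i} (≤-trans column-0 (s≤s z≤n)))
    term-bound (suc k) (s≤s k<i) = subst (λ g → ℚ.∣ fromℕ c ℚ.- g ∣ ≤ℚ fromℕ (suc i)) (sym (γ-suc k<i))
      (ℚ-Lemmas.∣p∣≤ (diff c g (≤-trans (proj₁ bounds) (+-monoʳ-≤ g (s≤s z≤n))))
        (subst (_≤ℚ fromℕ (suc i)) (Q.solve 2 (λ g c → g Q.:+ Q.:- c Q.:= Q.:- (c Q.:+ Q.:- g)) refl (fromℕ g) (fromℕ c))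
          (diff g c (≤-trans (proj₂ bounds) (+-monoʳ-≤ c (m≤n⇒m≤1+n k<i))))))
      where
      module Q = Data.Rational.Solver.+-*-Solver
      c = length (column (suc k))
      g = t (suc k) * φ (suc k)
      bounds = column-bounds (s≤s z≤n) k<i
      diff : ∀ x y → x ≤ y + suc i → fromℕ x ℚ.- fromℕ y ≤ℚ fromℕ (suc i)
      diff x y h = ℚₚ.≤-trans (ℚₚ.+-monoˡ-≤ (ℚ.- fromℕ y) (subst (fromℕ x ≤ℚ_) (ℚ-Lemmas.fromℕ-+ y (suc i)) (fromℕ-mono h)))
        (ℚₚ.≤-reflexive (Q.solve 2 (λ y i → y Q.:+ i Q.:+ Q.:- y Q.:= i) refl (fromℕ y) (fromℕ (suc i))))

    partial-bound : ∀ j → j ≤ suc i → ℚ.∣ Σ[ j ] (λ n → fromℕ (length (column n))) ℚ.- Σ[ j ] γ ∣ ≤ℚ fromℕ (j * suc i)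
    partial-bound zero    _ = ℚₚ.≤-refl
    partial-bound (suc j) h = subst₂ _≤ℚ_
      (cong ℚ.∣_∣ (Q.solve 4 (λ s g c d → (s Q.:+ Q.:- g) Q.:+ (c Q.:+ Q.:- d) Q.:= (s Q.:+ c) Q.:+ Q.:- (g Q.:+ d)) refl
        (Σ[ j ] (λ n → fromℕ (length (column n)))) (Σ[ j ] γ) (fromℕ (length (column j))) (γ j)))
      (trans (sym (ℚ-Lemmas.fromℕ-+ (j * suc i) (suc i))) (cong fromℕ (+-comm (j * suc i) (suc i))))
      (ℚₚ.≤-trans (ℚₚ.∣p+q∣≤∣p∣+∣q∣ (Σ[ j ] (λ n → fromℕ (length (column n))) ℚ.- Σ[ j ] γ) (fromℕ (length (column j)) ℚ.- γ j))
        (ℚₚ.+-mono-≤ (partial-bound j (<⇒≤ h)) (term-bound j h)))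
      where module Q = Data.Rational.Solver.+-*-Solver

    -- There are i + 1 columns, each off by at most i + 1.
    region-estimate : ℚ.∣ fromℕ (length region) ℚ.- (fromℕ L ℚ.* weightedTotient i ℚ.- fromℕ q ℚ.* totient i) ∣
                      ≤ℚ fromℕ (suc i * suc i)
    region-estimate = subst₂ (λ x y → ℚ.∣ x ℚ.- y ∣ ≤ℚ fromℕ (suc i * suc i))
      (sym (length-pairsOver-upTo column (suc i))) (Σγ i) (partial-bound (suc i) ≤-refl)

-- Ranks of Farey fractions next to a₁ / b₁, and at 0 and 1/2

module RankEstimate where

  open import Data.Bool.Base using (if_then_else_)
  open import Data.List.Base using (length; filter; map; [_])
  open import Data.List.Membership.Propositional using (_∈_)
  open import Data.List.Membership.Propositional.Properties using (∈-map⁻; ∈-filter⁺; ∈-filter⁻)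
  open import Data.List.Properties using (length-map)
  open import Data.List.Relation.Unary.Any using (here)
  import Data.List.Relation.Unary.Unique.Propositional.Properties as Uniqueₚ
  open import Data.Nat.Base
  open import Data.Nat.Coprimality using (Coprime; coprime?)
  import Data.Nat.Coprimality as Coprimality
  open import Data.Nat.Divisibility using (_∣_; ∣m+n∣m⇒∣n; ∣-refl; _∣0; m∣m*n)
  open import Data.Nat.DivMod using (m*n/n≡m; /-monoˡ-≤; m/n*n≡m)
  open import Data.Nat.Properties
  open import Data.Nat.Solver
  open import Data.Product.Base using (∃; _×_; _,_; proj₁; proj₂)
  open import Data.Rational.Base as ℚ using (ℚ; 0ℚ; 1ℚ; ½) renaming (_≤_ to _≤ℚ_)
  import Data.Rational.Properties as ℚₚ
  import Data.Rational.Solver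
  open import Data.Sum.Base using (_⊎_; inj₁; inj₂)
  open import Relation.Binary.PropositionalEquality hiding ([_])
  open import Relation.Nullary using (¬_; yes; no; contradiction)
  open import Relation.Nullary.Decidable using (_×-dec_; ¬?; dec-true; dec-false; from-yes)
  open import Relation.Unary using (Decidable)
  open +-*-Solver
  open Counting
  open RankDifference
  open ℚ-Lemmas using (fromℕ-mono)

  Below : (P Q : ℕ) → ℕ × ℕ → Set
  Below P Q (b , a) = a * Q ≤ P * b

  below? : ∀ P Q → Decidable (Below P Q)
  below? P Q (b , a) = a * Q ≤? P * b

  rank-÷ : ∀ N P {Q} → 0 < Q → rank N (P ÷ℕ Q) ≡ length (filter (below? P Q) (fareyPairs N))
  rank-÷ N P {Q} 0<Q = trans (rank≡ N (P ÷ℕ Q))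
    (filter-length-cong (λ z → fraction z ℚₚ.≤? P ÷ℕ Q) (below? P Q) (fareyPairs N) equiv)
    where
    equiv : ∀ {z} → z ∈ fareyPairs N → (fraction z ≤ℚ P ÷ℕ Q → Below P Q z) × (Below P Q z → fraction z ≤ℚ P ÷ℕ Q)
    equiv {b , a} z∈ = ÷ℕ-≤⁻ {a} {b} {P} {Q} 0<b 0<Q , ÷ℕ-≤⁺ {a} {b} {P} {Q} 0<b 0<Q
      where
      0<b : 0 < b
      0<b = proj₁ (∈-fareyPairs⁻ {N} z∈)

  Between : (P Q P′ Q′ : ℕ) → ℕ × ℕ → Set
  Between P Q P′ Q′ z = Below P′ Q′ z × ¬ Below P Q z

  between? : ∀ P Q P′ Q′ → Decidable (Between P Q P′ Q′)
  between? P Q P′ Q′ z = below? P′ Q′ z ×-dec ¬? (below? P Q z)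

  rank-split : ∀ N P {Q} P′ {Q′} → 0 < Q → 0 < Q′ → P * Q′ ≤ P′ * Q →
    rank N (P′ ÷ℕ Q′) ≡ rank N (P ÷ℕ Q) + length (filter (between? P Q P′ Q′) (fareyPairs N))
  rank-split N P {Q} P′ {Q′} 0<Q 0<Q′ h = trans (rank-÷ N P′ 0<Q′)
    (trans (filter-length-split (below? P Q) (below? P′ Q′) below-trans (fareyPairs N))
      (cong (_+ length (filter (between? P Q P′ Q′) (fareyPairs N))) (sym (rank-÷ N P 0<Q))))
    where
    below-trans : ∀ z → Below P Q z → Below P′ Q′ z
    below-trans (b , a) aQ≤Pb = *-cancelʳ-≤ (a * Q′) (P′ * b) Q {{>-nonZero 0<Q}} (begin
      a * Q′ * Q   ≡⟨ solve 3 (λ a Q Q′ → a :* Q′ :* Q := a :* Q :* Q′) refl a Q Q′ ⟩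
      a * Q * Q′   ≤⟨ *-monoˡ-≤ Q′ aQ≤Pb ⟩
      P * b * Q′   ≡⟨ solve 3 (λ P b Q′ → P :* b :* Q′ := P :* Q′ :* b) refl P b Q′ ⟩
      P * Q′ * b   ≤⟨ *-monoˡ-≤ b h ⟩
      P′ * Q * b   ≡⟨ solve 3 (λ P′ Q b → P′ :* Q :* b := P′ :* b :* Q) refl P′ Q b ⟩
      P′ * b * Q   ∎)
      where open ≤-Reasoning

  side-pos : ∀ {a₁ b₁ a₂ b₂} → a₁ * b₂ < a₂ * b₁ → side a₁ b₁ a₂ b₂ ≡ 1ℚ
  side-pos {a₁} {b₁} {a₂} {b₂} h = cong (if_then 1ℚ else ℚ.- 1ℚ) (dec-true (a₁ * b₂ <? a₂ * b₁) h)

  side-neg : ∀ {a₁ b₁ a₂ b₂} → ¬ (a₁ * b₂ < a₂ * b₁) → side a₁ b₁ a₂ b₂ ≡ ℚ.- 1ℚ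
  side-neg {a₁} {b₁} {a₂} {b₂} h = cong (if_then 1ℚ else ℚ.- 1ℚ) (dec-false (a₁ * b₂ <? a₂ * b₁) h)

  -- The condition on a₁ + a₂ stands in for a₂ ≤ b₂, which fails for 1/0, and so treats the
  -- exceptional pair together with the others.
  module Strip (a₁ b₁ a₂ b₂ q i L : ℕ) (b₂<b₁ : b₂ < b₁) (a₁≤b₁ : a₁ ≤ b₁) (a₁+a₂≤b₁+b₂ : a₁ + a₂ ≤ b₁ + b₂)
    (0<q : 0 < q) (N<b₁q[i+1] : b₁ * L < b₁ * q * suc i)
    (∣L : ∀ {n} → 0 < n → n ≤ suc i → n ∣ L) (qi≤L : q * i ≤ L) where

    N P Q : ℕ
    N = b₁ * L
    P = a₁ * q + a₂
    Q = b₁ * q + b₂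

    old new : ℚ
    old = a₁ ÷ℕ b₁
    new = P ÷ℕ Q

    0<b₁ : 0 < b₁
    0<b₁ = ≤-trans (s≤s z≤n) b₂<b₁

    instance
      b₁≢0 : NonZero b₁
      b₁≢0 = >-nonZero 0<b₁

    0<Q : 0 < Q
    0<Q = ≤-trans (*-mono-≤ 0<b₁ 0<q) (m≤m+n (b₁ * q) b₂)

    t : ℕ → ℕ
    t zero    = 0
    t (suc k) = L / suc k ∸ q

    t-eq : ∀ {n} → 0 < n → n ≤ i → L ≡ (t n + q) * n
    t-eq {suc k} 0<n n≤i = sym (trans (cong (_* suc k) (m∸n+n≡m q≤L/n)) (m/n*n≡m (∣L 0<n (m≤n⇒m≤1+n n≤i))))
      where
      q≤L/n : q ≤ L / suc k
      q≤L/n = ≤-trans (≤-reflexive (sym (m*n/n≡m q (suc k)))) (/-monoˡ-≤ (suc k) (≤-trans (*-monoʳ-≤ q n≤i) qi≤L))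

    module _ {m n : ℕ} (qn≤m : q * n ≤ m) where

      -- As m ≥ n, the point is n times the mediant (a₁ + a₂ , b₁ + b₂) plus m - n times (a₁ , b₁),
      -- and both of these represent fractions in [0, 1].
      point-proper : a₁ * m + a₂ * n ≤ b₁ * m + b₂ * n
      point-proper = subst₂ _≤_ (eq a₁ a₂) (eq b₁ b₂)
        (+-mono-≤ (*-monoˡ-≤ n a₁+a₂≤b₁+b₂) (*-monoˡ-≤ (m ∸ n) a₁≤b₁))
        where
        n≤m : n ≤ m
        n≤m = ≤-trans (≤-trans (≤-reflexive (sym (*-identityˡ n))) (*-monoˡ-≤ n 0<q)) qn≤m
        eq : ∀ c₁ c₂ → (c₁ + c₂) * n + c₁ * (m ∸ n) ≡ c₁ * m + c₂ * n
        eq c₁ c₂ = trans (solve 4 (λ c₁ c₂ n r → (c₁ :+ c₂) :* n :+ c₁ :* r := c₁ :* (n :+ r) :+ c₂ :* n) refl c₁ c₂ n (m ∸ n))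
          (cong (λ k → c₁ * k + c₂ * n) (m+[n∸m]≡n n≤m))

      module _ (b≤N : b₁ * m + b₂ * n ≤ N) where

        m≤L : m ≤ L
        m≤L = *-cancelˡ-≤ b₁ (≤-trans (m≤m+n (b₁ * m) (b₂ * n)) b≤N)

        n≤i : n ≤ i
        n≤i = s≤s⁻¹ (*-cancelˡ-< (b₁ * q) n (suc i) (≤-<-trans
          (≤-trans (≤-reflexive (*-assoc b₁ q n)) (≤-trans (*-monoʳ-≤ b₁ qn≤m) (≤-trans (m≤m+n (b₁ * m) (b₂ * n)) b≤N)))
          N<b₁q[i+1]))

    0<point : ∀ {m} n → 0 < m → 0 < b₁ * m + b₂ * n
    0<point {m} n 0<m = ≤-trans (*-mono-≤ 0<b₁ 0<m) (m≤m+n (b₁ * m) (b₂ * n))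

    point : ℕ × ℕ → ℕ × ℕ
    point (n , m) = b₁ * m + b₂ * n , a₁ * m + a₂ * n

    main : ℚ
    main = fromℕ L ℚ.* weightedTotient i ℚ.- fromℕ q ℚ.* totient i

    module Positive (det : a₂ * b₁ ≡ a₁ * b₂ + 1) where

      module U = Unimodular a₁ b₁ a₂ b₂ det

      -- Lattice form of the interval that excludes `old` and includes `new`: 0 < n says a / b > a₁
      -- / b₁, and q n ≤ m says a / b ≤ P / Q.
      C : ℕ → ℕ → Set
      C n m = (0 < n × q * n ≤ m) × (Coprime m n × b₁ * m + b₂ * n ≤ N)

      C? : ∀ n → Decidable (C n)
      C? n m = ((0 <? n) ×-dec (q * n ≤? m)) ×-dec (coprime? m n ×-dec (b₁ * m + b₂ * n ≤? N))

      C⇒ : ∀ {n m} → C n m → q * n ≤ m × Coprime m n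
      C⇒ ((_ , h) , c , _) = h , λ {d} → c {d}

      ⇒C : ∀ {n m} → 0 < n → q * n < m → Coprime m n → b₁ * m + b₂ * n ≤ N → C n m
      ⇒C 0<n h c h′ = (0<n , <⇒≤ h) , (λ {d} → c {d}) , h′

      open Region b₁ b₂ q L i b₂<b₁ t t-eq C? C⇒ ⇒C

      old≤new : a₁ * Q ≤ P * b₁
      old≤new = begin
        a₁ * (b₁ * q + b₂)     ≡⟨ solve 4 (λ a₁ b₁ q b₂ → a₁ :* (b₁ :* q :+ b₂) := a₁ :* q :* b₁ :+ a₁ :* b₂) refl a₁ b₁ q b₂ ⟩
        a₁ * q * b₁ + a₁ * b₂  ≤⟨ +-monoʳ-≤ (a₁ * q * b₁) (≤-trans (m≤m+n (a₁ * b₂) 1) (≤-reflexive (sym det))) ⟩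
        a₁ * q * b₁ + a₂ * b₁  ≡⟨ sym (*-distribʳ-+ b₁ (a₁ * q) a₂) ⟩
        (a₁ * q + a₂) * b₁     ∎
        where open ≤-Reasoning

      to : ∀ {z} → z ∈ region → point z ∈ filter (between? a₁ b₁ P Q) (fareyPairs N)
      to {n , m} z∈ with ∈-region⁻ z∈
      ... | 0<m , (0<n , qn≤m) , c , b≤N = ∈-filter⁺ (between? a₁ b₁ P Q)
          (∈-fareyPairs⁺ 0<b b≤N (point-proper qn≤m) λ {d} → U.coprime-point a b hn hm (λ {e} → c {e}) {d})
          (aQ≤Pb , <⇒≱ a₁b<ab₁)
        where
        a = a₁ * m + a₂ * n
        b = b₁ * m + b₂ * n
        0<b : 0 < b
        0<b = 0<point n 0<m
        hn : a * b₁ ≡ a₁ * b + n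
        hn = proj₁ (U.coordinates m n)
        hm : a₂ * b ≡ a * b₂ + m
        hm = proj₂ (U.coordinates m n)
        a₁b<ab₁ : a₁ * b < a * b₁
        a₁b<ab₁ = subst (a₁ * b <_) (sym hn) (subst (_≤ a₁ * b + n) (+-comm (a₁ * b) 1) (+-monoʳ-≤ (a₁ * b) 0<n))
        aQ≤Pb : a * Q ≤ P * b
        aQ≤Pb = +-cancelʳ-≤ m (a * Q) (P * b) (≤-trans (≤-reflexive (sym (U.mediant a b hn hm q))) (+-monoʳ-≤ (P * b) qn≤m))

      from : ∀ {z} → z ∈ filter (between? a₁ b₁ P Q) (fareyPairs N) → ∃ λ w → w ∈ region × z ≡ point w
      from {b , a} z∈ with ∈-filter⁻ (between? a₁ b₁ P Q) {xs = fareyPairs N} z∈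
      ... | z∈′ , ≤new , ≰old with ∈-fareyPairs⁻ {N} z∈′
      ...   | 0<b , b≤N , a≤b , c = (n , m) ,
          ∈-region⁺ (n≤i qn≤m b≤N′) 0<m (m≤L qn≤m b≤N′) ((0<n , qn≤m) , (λ {d} → U.coprime-coordinates a b hn hm (λ {e} → c {e}) {d}) , b≤N′) ,
          cong₂ _,_ (proj₂ (U.point a b hn hm)) (proj₁ (U.point a b hn hm))
        where
        a₁b<ab₁ : a₁ * b < a * b₁
        a₁b<ab₁ = ≰⇒> ≰old
        aQ≤Pb : a * Q ≤ P * b
        aQ≤Pb = ≤new
        n m : ℕ
        n = a * b₁ ∸ a₁ * b
        hn : a * b₁ ≡ a₁ * b + n
        hn = sym (m+[n∸m]≡n (<⇒≤ a₁b<ab₁))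
        0<n : 0 < n
        0<n = m<n⇒0<n∸m a₁b<ab₁
        -- Proved before `m` is introduced: it makes the truncated subtraction in `m` exact, and its
        -- margin q n becomes the bound `qn≤m`.
        ab₂+qn≤a₂b : a * b₂ + q * n ≤ a₂ * b
        ab₂+qn≤a₂b = +-cancelˡ-≤ (q * (a₁ * b)) _ _ (begin
          q * (a₁ * b) + (a * b₂ + q * n)  ≡⟨ solve 4 (λ q x y n → q :* x :+ (y :+ q :* n) := q :* (x :+ n) :+ y) refl q (a₁ * b) (a * b₂) n ⟩
          q * (a₁ * b + n) + a * b₂        ≡⟨ cong (λ k → q * k + a * b₂) (sym hn) ⟩
          q * (a * b₁) + a * b₂            ≡⟨ solve 4 (λ q a b₁ b₂ → q :* (a :* b₁) :+ a :* b₂ := a :* (b₁ :* q :+ b₂)) refl q a b₁ b₂ ⟩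
          a * Q                            ≤⟨ aQ≤Pb ⟩
          P * b                            ≡⟨ solve 4 (λ a₁ q a₂ b → (a₁ :* q :+ a₂) :* b := q :* (a₁ :* b) :+ a₂ :* b) refl a₁ q a₂ b ⟩
          q * (a₁ * b) + a₂ * b            ∎)
          where open ≤-Reasoning
        m = a₂ * b ∸ a * b₂
        hm : a₂ * b ≡ a * b₂ + m
        hm = sym (m+[n∸m]≡n (≤-trans (m≤m+n (a * b₂) (q * n)) ab₂+qn≤a₂b))
        qn≤m : q * n ≤ m
        qn≤m = +-cancelˡ-≤ (a * b₂) _ _ (≤-trans ab₂+qn≤a₂b (≤-reflexive hm))
        0<m : 0 < m
        0<m = ≤-trans (*-mono-≤ 0<q 0<n) qn≤m
        b≤N′ : b₁ * m + b₂ * n ≤ N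
        b≤N′ = subst (_≤ N) (proj₂ (U.point a b hn hm)) b≤N

      point-inj : ∀ {z w} → point z ≡ point w → z ≡ w
      point-inj h = let (hm , hn) = U.point-injective (cong proj₂ h) (cong proj₁ h) in cong₂ _,_ hn hm

      rank-new : rank N new ≡ rank N old + length region
      rank-new = trans (rank-split N a₁ P 0<b₁ 0<Q old≤new) (cong (rank N old +_) (sym (bijection⇒length≡ point point-inj
        region-unique (Uniqueₚ.filter⁺ (between? a₁ b₁ P Q) (fareyPairs-unique N)) to from)))

      estimate : ℚ.∣ fromℕ (rank N new) ℚ.- fromℕ (rank N old) ℚ.- 1ℚ ℚ.* main ∣ ≤ℚ fromℕ (suc i * suc i)
      estimate = subst (_≤ℚ fromℕ (suc i * suc i))
        (cong ℚ.∣_∣ (trans (S.solve 3 (λ r l m → l S.:+ S.:- m S.:= (r S.:+ l) S.:+ S.:- r S.:+ S.:- (S.con 1ℚ S.:* m)) refl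
            (fromℕ (rank N old)) (fromℕ (length region)) main)
          (cong (λ x → x ℚ.- fromℕ (rank N old) ℚ.- 1ℚ ℚ.* main)
            (sym (trans (cong fromℕ rank-new) (ℚ-Lemmas.fromℕ-+ (rank N old) (length region)))))))
        region-estimate
        where module S = Data.Rational.Solver.+-*-Solver

    module Negative (det : a₁ * b₂ ≡ a₂ * b₁ + 1) where

      -- The roles of numerators and denominators are exchanged.
      module U = Unimodular b₁ a₁ b₂ a₂ (trans (*-comm b₂ a₁) (trans det (cong (_+ 1) (*-comm a₂ b₁))))

      C : ℕ → ℕ → Set
      C n m = q * n < m × (Coprime m n × b₁ * m + b₂ * n ≤ N)

      C? : ∀ n → Decidable (C n)
      C? n m = (q * n <? m) ×-dec (coprime? m n ×-dec (b₁ * m + b₂ * n ≤? N))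

      C⇒ : ∀ {n m} → C n m → q * n ≤ m × Coprime m n
      C⇒ (h , c , _) = <⇒≤ h , λ {d} → c {d}

      ⇒C : ∀ {n m} → 0 < n → q * n < m → Coprime m n → b₁ * m + b₂ * n ≤ N → C n m
      ⇒C _ h c h′ = h , (λ {d} → c {d}) , h′

      open Region b₁ b₂ q L i b₂<b₁ t t-eq C? C⇒ ⇒C

      new≤old : P * b₁ ≤ a₁ * Q
      new≤old = begin
        (a₁ * q + a₂) * b₁     ≡⟨ *-distribʳ-+ b₁ (a₁ * q) a₂ ⟩
        a₁ * q * b₁ + a₂ * b₁  ≤⟨ +-monoʳ-≤ (a₁ * q * b₁) (≤-trans (m≤m+n (a₂ * b₁) 1) (≤-reflexive (sym det))) ⟩
        a₁ * q * b₁ + a₁ * b₂  ≡⟨ solve 4 (λ a₁ b₁ q b₂ → a₁ :* q :* b₁ :+ a₁ :* b₂ := a₁ :* (b₁ :* q :+ b₂)) refl a₁ b₁ q b₂ ⟩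
        a₁ * (b₁ * q + b₂)     ∎
        where open ≤-Reasoning

      to : ∀ {z} → z ∈ region → point z ∈ filter (between? P Q a₁ b₁) (fareyPairs N)
      to {n , m} z∈ with ∈-region⁻ z∈
      ... | 0<m , qn<m , c , b≤N = ∈-filter⁺ (between? P Q a₁ b₁)
          (∈-fareyPairs⁺ 0<b b≤N (point-proper (<⇒≤ qn<m)) λ {d} → Coprimality.sym (λ {e} → U.coprime-point b a hn hm (λ {k} → c {k}) {e}) {d})
          (ab₁≤a₁b , <⇒≱ Pb<aQ)
        where
        a = a₁ * m + a₂ * n
        b = b₁ * m + b₂ * n
        0<b : 0 < b
        0<b = 0<point n 0<m
        hn : b * a₁ ≡ b₁ * a + n
        hn = proj₁ (U.coordinates m n)
        hm : b₂ * a ≡ b * a₂ + m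
        hm = proj₂ (U.coordinates m n)
        ab₁≤a₁b : a * b₁ ≤ a₁ * b
        ab₁≤a₁b = subst₂ _≤_ (*-comm b₁ a) (trans (sym hn) (*-comm b a₁)) (m≤m+n (b₁ * a) n)
        Pb<aQ : P * b < a * Q
        Pb<aQ = +-cancelʳ-< (q * n) (P * b) (a * Q) (subst (P * b + q * n <_)
          (trans (cong (_+ m) (*-comm P b)) (trans (sym (U.mediant b a hn hm q)) (cong (_+ q * n) (*-comm Q a))))
          (+-monoʳ-< (P * b) qn<m))

      from : ∀ {z} → z ∈ filter (between? P Q a₁ b₁) (fareyPairs N) → ∃ λ w → w ∈ region × z ≡ point w
      from {b , a} z∈ with ∈-filter⁻ (between? P Q a₁ b₁) {xs = fareyPairs N} z∈
      ... | z∈′ , ≤old , ≰new with ∈-fareyPairs⁻ {N} z∈′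
      ...   | 0<b , b≤N , a≤b , c = (n , m) ,
          ∈-region⁺ (n≤i (<⇒≤ qn<m) b≤N′) (≤-trans (s≤s z≤n) qn<m) (m≤L (<⇒≤ qn<m) b≤N′)
            (qn<m , (λ {d} → U.coprime-coordinates b a hn hm (λ {k} → Coprimality.sym (λ {e} → c {e}) {k}) {d}) , b≤N′) ,
          cong₂ _,_ (proj₁ (U.point b a hn hm)) (proj₂ (U.point b a hn hm))
        where
        b₁a≤ba₁ : b₁ * a ≤ b * a₁
        b₁a≤ba₁ = subst₂ _≤_ (*-comm a b₁) (*-comm a₁ b) ≤old
        bP<Qa : b * P < Q * a
        bP<Qa = subst₂ _<_ (*-comm P b) (*-comm a Q) (≰⇒> ≰new)
        n m : ℕ
        n = b * a₁ ∸ b₁ * a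
        hn : b * a₁ ≡ b₁ * a + n
        hn = sym (m+[n∸m]≡n b₁a≤ba₁)
        ba₂+qn<b₂a : b * a₂ + q * n < b₂ * a
        ba₂+qn<b₂a = +-cancelˡ-< (q * (b₁ * a)) _ _ (begin-strict
          q * (b₁ * a) + (b * a₂ + q * n)  ≡⟨ solve 4 (λ q x y n → q :* x :+ (y :+ q :* n) := q :* (x :+ n) :+ y) refl q (b₁ * a) (b * a₂) n ⟩
          q * (b₁ * a + n) + b * a₂        ≡⟨ cong (λ k → q * k + b * a₂) (sym hn) ⟩
          q * (b * a₁) + b * a₂            ≡⟨ solve 4 (λ q b a₁ a₂ → q :* (b :* a₁) :+ b :* a₂ := b :* (a₁ :* q :+ a₂)) refl q b a₁ a₂ ⟩
          b * P                            <⟨ bP<Qa ⟩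
          Q * a                            ≡⟨ solve 4 (λ b₁ q b₂ a → (b₁ :* q :+ b₂) :* a := q :* (b₁ :* a) :+ b₂ :* a) refl b₁ q b₂ a ⟩
          q * (b₁ * a) + b₂ * a            ∎)
          where open ≤-Reasoning
        m = b₂ * a ∸ b * a₂
        hm : b₂ * a ≡ b * a₂ + m
        hm = sym (m+[n∸m]≡n (≤-trans (m≤m+n (b * a₂) (q * n)) (<⇒≤ ba₂+qn<b₂a)))
        qn<m : q * n < m
        qn<m = +-cancelˡ-< (b * a₂) _ _ (<-≤-trans ba₂+qn<b₂a (≤-reflexive hm))
        b≤N′ : b₁ * m + b₂ * n ≤ N
        b≤N′ = subst (_≤ N) (proj₁ (U.point b a hn hm)) b≤N

      point-inj : ∀ {z w} → point z ≡ point w → z ≡ w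
      point-inj h = let (hm , hn) = U.point-injective (cong proj₁ h) (cong proj₂ h) in cong₂ _,_ hn hm

      rank-old : rank N old ≡ rank N new + length region
      rank-old = trans (rank-split N P a₁ 0<Q 0<b₁ new≤old) (cong (rank N new +_) (sym (bijection⇒length≡ point point-inj
        region-unique (Uniqueₚ.filter⁺ (between? P Q a₁ b₁) (fareyPairs-unique N)) to from)))

      estimate : ℚ.∣ fromℕ (rank N new) ℚ.- fromℕ (rank N old) ℚ.- (ℚ.- 1ℚ) ℚ.* main ∣ ≤ℚ fromℕ (suc i * suc i)
      estimate = subst (_≤ℚ fromℕ (suc i * suc i))
        (trans (sym (ℚₚ.∣-p∣≡∣p∣ _)) (cong ℚ.∣_∣ (trans (S.solve 3 (λ r l m → S.:- (l S.:+ S.:- m) S.:= r S.:+ S.:- (r S.:+ l) S.:+ S.:- (S.con (ℚ.- 1ℚ) S.:* m)) refl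
            (fromℕ (rank N new)) (fromℕ (length region)) main)
          (cong (λ x → fromℕ (rank N new) ℚ.- x ℚ.- (ℚ.- 1ℚ) ℚ.* main)
            (sym (trans (cong fromℕ rank-old) (ℚ-Lemmas.fromℕ-+ (rank N new) (length region))))))))
        region-estimate
        where module S = Data.Rational.Solver.+-*-Solver

    Estimate : ℚ → Set
    Estimate s = ℚ.∣ fromℕ (rank N new) ℚ.- fromℕ (rank N old) ℚ.- s ℚ.* main ∣ ≤ℚ fromℕ (suc i * suc i)

    rank-estimate : ∣ a₁ * b₂ - a₂ * b₁ ∣ ≡ 1 → Estimate (side a₁ b₁ a₂ b₂)
    rank-estimate h = by-order (≤-total (a₁ * b₂) (a₂ * b₁))
      where
      by-order : a₁ * b₂ ≤ a₂ * b₁ ⊎ a₂ * b₁ ≤ a₁ * b₂ → Estimate (side a₁ b₁ a₂ b₂)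
      by-order (inj₁ x≤y) = subst Estimate (sym (side-pos {a₁} {b₁} {a₂} {b₂} x<y)) (Positive.estimate det)
        where
        det : a₂ * b₁ ≡ a₁ * b₂ + 1
        det = trans (sym (m+[n∸m]≡n x≤y)) (cong (a₁ * b₂ +_) (trans (sym (m≤n⇒∣m-n∣≡n∸m x≤y)) h))
        x<y : a₁ * b₂ < a₂ * b₁
        x<y = ≤-reflexive (trans (+-comm 1 (a₁ * b₂)) (sym det))
      by-order (inj₂ y≤x) = subst Estimate (sym (side-neg {a₁} {b₁} {a₂} {b₂} (≤⇒≯ y≤x))) (Negative.estimate det)
        where
        det : a₁ * b₂ ≡ a₂ * b₁ + 1
        det = trans (sym (m+[n∸m]≡n y≤x)) (cong (a₂ * b₁ +_) (trans (sym (m≤n⇒∣n-m∣≡n∸m y≤x)) h))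

  -- Allows the rank of 0/1 to be replaced by 0 in the formula for 1/q; the loss goes into the error
  -- term.
  rank-0≤1 : ∀ N → rank N (0 ÷ℕ 1) ≤ 1
  rank-0≤1 N = ≤-trans (≤-reflexive (rank-÷ N 0 {1} (s≤s z≤n))) (unique-⊆⇒length≤ {ys = [ (1 , 0) ]}
    (Uniqueₚ.filter⁺ (below? 0 1) (fareyPairs-unique N)) only)
    where
    only : ∀ {z} → z ∈ filter (below? 0 1) (fareyPairs N) → z ∈ [ (1 , 0) ]
    only {b , a} z∈ with ∈-filter⁻ (below? 0 1) {xs = fareyPairs N} z∈
    ... | z∈′ , h with ∈-fareyPairs⁻ {N} z∈′
    ...   | _ , _ , _ , c with n≤0⇒n≡0 (subst (_≤ 0) (*-identityʳ a) h)
    ...     | refl = here (cong (_, 0) (c (_ ∣0 , ∣-refl)))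

  -- The symmetry a/b ↦ 1 - a/b of the Farey sequence, extended by the identity
  -- to an involution of all pairs
  reflect : ℕ × ℕ → ℕ × ℕ
  reflect (b , a) with a ≤? b
  ... | yes _ = b , b ∸ a
  ... | no  _ = b , a

  reflect-≤ : ∀ {b a} → a ≤ b → reflect (b , a) ≡ (b , b ∸ a)
  reflect-≤ {b} {a} a≤b with a ≤? b
  ... | yes _  = refl
  ... | no a≰b = contradiction a≤b a≰b

  reflect-involutive : ∀ z → reflect (reflect z) ≡ z
  reflect-involutive (b , a) with a ≤? b
  ... | yes a≤b = trans (reflect-≤ (m∸n≤m b a)) (cong (b ,_) (m∸[m∸n]≡n a≤b))
  ... | no a≰b with a ≤? b
  ...   | yes a≤b = contradiction a≤b a≰b
  ...   | no _    = refl

  near-half : ∀ {r l} x y → r ≡ x → l ≡ x + y → x ≤ y + 1 → y ≤ x + 1 → ℚ.∣ fromℕ r ℚ.- l ÷ℕ 2 ∣ ≤ℚ 1ℚ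
  near-half x y refl refl x≤y+1 y≤x+1 = subst (λ s → ℚ.∣ s ∣ ≤ℚ 1ℚ) eq
    (ℚ-Lemmas.∣p∣≤ (ℚₚ.≤-trans (half x y x≤y+1) (from-yes (½ ℚ.* 1ℚ ℚₚ.≤? 1ℚ)))
      (subst (_≤ℚ 1ℚ) (S.solve 2 (λ x y → S.con ½ S.:* (y S.:+ S.:- x) S.:= S.:- (S.con ½ S.:* (x S.:+ S.:- y))) refl (fromℕ x) (fromℕ y))
        (ℚₚ.≤-trans (half y x y≤x+1) (from-yes (½ ℚ.* 1ℚ ℚₚ.≤? 1ℚ)))))
    where
    module S = Data.Rational.Solver.+-*-Solver
    half : ∀ x y → x ≤ y + 1 → ½ ℚ.* (fromℕ x ℚ.- fromℕ y) ≤ℚ ½ ℚ.* 1ℚ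
    half x y h = ℚ-Lemmas.*ˡ-mono (from-yes (0ℚ ℚₚ.≤? ½)) (ℚₚ.≤-trans
      (ℚₚ.+-monoˡ-≤ (ℚ.- fromℕ y) (subst (fromℕ x ≤ℚ_) (ℚ-Lemmas.fromℕ-+ y 1) (fromℕ-mono {x} {y + 1} h)))
      (ℚₚ.≤-reflexive (S.solve 1 (λ y → y S.:+ S.con 1ℚ S.:+ S.:- y S.:= S.con 1ℚ) refl (fromℕ y))))
    eq : ½ ℚ.* (fromℕ x ℚ.- fromℕ y) ≡ fromℕ x ℚ.- (x + y) ÷ℕ 2
    eq = trans (S.solve 2 (λ x y → S.con ½ S.:* (x S.:+ S.:- y) S.:= x S.:+ S.:- ((x S.:+ y) S.:* S.con ½)) refl (fromℕ x) (fromℕ y))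
      (cong (λ l → fromℕ x ℚ.- l ℚ.* ½) (sym (ℚ-Lemmas.fromℕ-+ x y)))

  module Symmetry (N : ℕ) where

    ≤½? : Decidable (Below 1 2)
    ≤½? = below? 1 2

    >½? : Decidable (λ z → ¬ Below 1 2 z)
    >½? z = ¬? (≤½? z)

    <½? : Decidable (λ z → proj₂ z * 2 < proj₁ z)
    <½? (b , a) = a * 2 <? b

    =½? : Decidable (λ z → proj₂ z * 2 ≡ proj₁ z)
    =½? (b , a) = a * 2 ≟ b

    reflect-length≤ : {P Q : ℕ × ℕ → Set} (P? : Decidable P) (Q? : Decidable Q) →
      (∀ {b a} → 0 < b → a ≤ b → P (b , a) → Q (b , b ∸ a)) →
      length (filter P? (fareyPairs N)) ≤ length (filter Q? (fareyPairs N))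
    reflect-length≤ {P} P? Q? h = ≤-trans (≤-reflexive (sym (length-map reflect (filter P? (fareyPairs N)))))
      (unique-⊆⇒length≤ (Uniqueₚ.map⁺ (λ {z} {w} e → trans (sym (reflect-involutive z)) (trans (cong reflect e) (reflect-involutive w)))
          (Uniqueₚ.filter⁺ P? (fareyPairs-unique N))) into)
      where
      into : ∀ {z} → z ∈ map reflect (filter P? (fareyPairs N)) → z ∈ filter Q? (fareyPairs N)
      into z∈ with ∈-map⁻ reflect z∈
      ... | (b , a) , w∈ , refl with ∈-filter⁻ P? {xs = fareyPairs N} w∈
      ...   | w∈′ , p with ∈-fareyPairs⁻ {N} w∈′
      ...     | 0<b , b≤N , a≤b , c = subst (_∈ filter Q? (fareyPairs N)) (sym (reflect-≤ a≤b))
                (∈-filter⁺ Q? (∈-fareyPairs⁺ 0<b b≤N (m∸n≤m b a) coprime) (h 0<b a≤b p))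
        where
        coprime : Coprime (b ∸ a) b
        coprime {d} (d∣b-a , d∣b) = c (∣m+n∣m⇒∣n (subst (d ∣_) (sym (m∸n+n≡m a≤b)) d∣b) d∣b-a , d∣b)

    twice : ∀ {a b} → a ≤ b → (b ∸ a) * 2 + a * 2 ≡ b + b
    twice {a} {b} a≤b = trans (sym (*-distribʳ-+ 2 (b ∸ a) a)) (trans (cong (_* 2) (m∸n+n≡m a≤b))
      (solve 1 (λ b → b :* con 2 := b :+ b) refl b))

    >½≤≤½ : length (filter >½? (fareyPairs N)) ≤ length (filter ≤½? (fareyPairs N))
    >½≤≤½ = reflect-length≤ >½? ≤½? λ {b} {a} 0<b a≤b h → +-cancelʳ-≤ (a * 2) _ _
      (≤-trans (≤-reflexive (trans (twice a≤b) (cong (_+ b) (sym (*-identityˡ b)))))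
        (+-monoʳ-≤ (1 * b) (≤-trans (≤-reflexive (sym (*-identityˡ b))) (<⇒≤ (≰⇒> h)))))

    <½≤>½ : length (filter <½? (fareyPairs N)) ≤ length (filter >½? (fareyPairs N))
    <½≤>½ = reflect-length≤ <½? >½? λ {b} {a} 0<b a≤b h k → contradiction
      (≤-trans (≤-reflexive (sym (twice a≤b))) (+-monoˡ-≤ (a * 2) k))
      (<⇒≱ (<-≤-trans (+-monoʳ-< (1 * b) h) (≤-reflexive (cong (_+ b) (*-identityˡ b)))))

    =½≤1 : length (filter =½? (fareyPairs N)) ≤ 1
    =½≤1 = unique-⊆⇒length≤ {ys = [ (2 , 1) ]} (Uniqueₚ.filter⁺ =½? (fareyPairs-unique N)) only
      where
      only : ∀ {z} → z ∈ filter =½? (fareyPairs N) → z ∈ [ (2 , 1) ]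
      only {b , a} z∈ with ∈-filter⁻ =½? {xs = fareyPairs N} z∈
      ... | z∈′ , refl with ∈-fareyPairs⁻ {N} z∈′
      -- With b = 2 a the numerator is itself a common divisor, hence a = 1.
      ...   | _ , _ , _ , c with c (∣-refl {a} , m∣m*n 2)
      ...     | refl = here refl

    ≤½≤>½+1 : length (filter ≤½? (fareyPairs N)) ≤ length (filter >½? (fareyPairs N)) + 1
    ≤½≤>½+1 = ≤-trans (filter-length-∪ ≤½? <½? =½? (fareyPairs N) split) (+-mono-≤ <½≤>½ =½≤1)
      where
      split : ∀ {z} → z ∈ fareyPairs N → Below 1 2 z → proj₂ z * 2 < proj₁ z ⊎ proj₂ z * 2 ≡ proj₁ z
      split {b , a} z∈ h = m≤n⇒m<n∨m≡n (≤-trans h (≤-reflexive (*-identityˡ b)))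

    -- Reflection pairs the fractions below 1/2 with those above and leaves only 1/2 unpaired. The
    -- numbers of fractions up to 1/2 and beyond it therefore differ by at most 1, and their sum is
    -- the length of the sequence.
    rank-½ : ℚ.∣ fromℕ (rank N (1 ÷ℕ 2)) ℚ.- length (Farey N) ÷ℕ 2 ∣ ≤ℚ 1ℚ
    rank-½ = near-half (length (filter ≤½? (fareyPairs N))) (length (filter >½? (fareyPairs N)))
      (rank-÷ N 1 {2} (s≤s z≤n)) (trans (length-Farey N) (filter-length-∁ ≤½? (fareyPairs N)))
      ≤½≤>½+1 (≤-trans >½≤≤½ (m≤m+n _ 1))

-- Size of the lcm, and the exact value of N / (b q) and its fractional part

module Arithmetic where

  open import Data.Integer.Base as ℤ using (+_; -[1+_])
  import Data.Integer.Properties as ℤₚ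
  open import Data.List.Base using (_∷_; foldr)
  open import Data.List.Membership.Propositional using (_∈_)
  open import Data.List.Relation.Unary.Any using (here; there)
  open import Data.Nat.Base
  open import Data.Nat.Coprimality using (Coprime; coprime-divisor)
  open import Data.Nat.DivMod using (m*n/n≡m; /-monoˡ-≤; m<n*o⇒m/o<n)
  open import Data.Nat.Divisibility using (_∣_; divides; ∣m+n∣m⇒∣n; ∣⇒≤; ∣-trans; ∣1⇒≡1)
  open import Data.Nat.LCM using (lcm; m∣lcm[m,n]; n∣lcm[m,n])
  open import Data.Nat.Properties
  open import Data.Nat.Solver
  open import Data.Product.Base using (_,_)
  open import Data.Rational.Base as ℚ using (ℚ; mkℚ) renaming (_≤_ to _≤ℚ_; _<_ to _<ℚ_)
  import Data.Rational.Properties as ℚₚ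
  import Data.Rational.Solver
  import Data.Rational.Unnormalised.Base as ℚᵘ
  import Data.Rational.Unnormalised.Properties as ℚᵘₚ
  open import Relation.Binary.PropositionalEquality
  open import Relation.Nullary using (contradiction)
  open +-*-Solver
  open Counting
  open RankDifference
  open ℚ-Lemmas using (fromℕ-mono; 0≤fromℕ; pos*inv; *ʳ-mono)
  open ExpLemmas using (fromℕ-*; 0<fromℕ)

  floor-unique : ∀ p i → fromℕ i ≤ℚ p → p <ℚ fromℕ (suc i) → ℚ.floor p ≡ + i
  floor-unique p@(mkℚ (+ a) d c) i i≤p p<i+1 = trans (ℤₚ.*-identityˡ (+ (a / suc d))) (cong +_ (≤-antisym
      (s≤s⁻¹ (m<n*o⇒m/o<n (drop-< (ℚᵘₚ.<-respʳ-≃ (ℚₚ.toℚᵘ-fromℚᵘ (ℚᵘ.mkℚᵘ (+ suc i) 0)) (ℚₚ.toℚᵘ-mono-< p<i+1)))))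
      (≤-trans (≤-reflexive (sym (m*n/n≡m i (suc d)))) (/-monoˡ-≤ (suc d)
        (drop-≤ (ℚᵘₚ.≤-respˡ-≃ (ℚₚ.toℚᵘ-fromℚᵘ (ℚᵘ.mkℚᵘ (+ i) 0)) (ℚₚ.toℚᵘ-mono-≤ i≤p)))))))
    where
    drop-≤ : ∀ {m} → ℚᵘ.mkℚᵘ (+ m) 0 ℚᵘ.≤ ℚᵘ.mkℚᵘ (+ a) d → m * suc d ≤ a
    drop-≤ {m} h = ℤₚ.drop‿+≤+ (subst₂ ℤ._≤_ (sym (ℤₚ.pos-* m (suc d))) (ℤₚ.*-identityʳ (+ a)) (ℚᵘₚ.drop-*≤* h))
    drop-< : ∀ {m} → ℚᵘ.mkℚᵘ (+ a) d ℚᵘ.< ℚᵘ.mkℚᵘ (+ m) 0 → a < m * suc d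
    drop-< {m} h = ℤₚ.drop‿+<+ (subst₂ ℤ._<_ (ℤₚ.*-identityʳ (+ a)) (sym (ℤₚ.pos-* m (suc d))) (ℚᵘₚ.drop-*<* h))
  floor-unique p@(mkℚ -[1+ a ] d c) i i≤p p<i+1 = contradiction refl
    (ℚₚ.<⇒≢ (ℚₚ.<-≤-trans (ℚₚ.negative⁻¹ p) (ℚₚ.≤-trans (0≤fromℕ i) i≤p)))

  ÷ℕ-unique : ∀ m {n} z → 0 < n → z ℚ.* fromℕ n ≡ fromℕ m → m ÷ℕ n ≡ z
  ÷ℕ-unique m {n} z 0<n h = trans (cong (ℚ._* inv (fromℕ n)) (sym h))
    (trans (ℚₚ.*-assoc z (fromℕ n) (inv (fromℕ n))) (trans (cong (z ℚ.*_) (pos*inv (0<fromℕ 0<n))) (ℚₚ.*-identityʳ z)))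

  fromℕ-cancel-< : ∀ {m n} → fromℕ m <ℚ fromℕ n → m < n
  fromℕ-cancel-< {m} {n} h = ≰⇒> λ n≤m → ℚₚ.<⇒≢ (ℚₚ.<-≤-trans h (fromℕ-mono n≤m)) refl

  ÷ℕ<⁻ : ∀ m {n} q → 0 < n → m ÷ℕ n <ℚ fromℕ q → m < q * n
  ÷ℕ<⁻ m {n} q 0<n h = fromℕ-cancel-< {m} {q * n} (subst₂ _<ℚ_ (÷ℕ-*-cancel m 0<n) (sym (fromℕ-* q n))
    (ℚₚ.*-monoˡ-<-pos (fromℕ n) {{ℚ.positive (0<fromℕ 0<n)}} h))

  ≤÷ℕ⁻ : ∀ m {n} q → 0 < n → fromℕ q ≤ℚ m ÷ℕ n → q * n ≤ m
  ≤÷ℕ⁻ m {n} q 0<n h = fromℕ-cancel-≤ {q * n} {m} (subst₂ _≤ℚ_ (sym (fromℕ-* q n)) (÷ℕ-*-cancel m 0<n)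
    (*ʳ-mono (0≤fromℕ n) h))

  ∣foldr-lcm : ∀ {n xs} → n ∈ xs → n ∣ foldr lcm 1 xs
  ∣foldr-lcm {xs = x ∷ xs} (here refl) = m∣lcm[m,n] x (foldr lcm 1 xs)
  ∣foldr-lcm {xs = x ∷ xs} (there n∈)  = ∣-trans (∣foldr-lcm n∈) (n∣lcm[m,n] x (foldr lcm 1 xs))

  ∣lcmUpTo : ∀ {n k} → 0 < n → n ≤ k → n ∣ lcmUpTo k
  ∣lcmUpTo 0<n n≤k = ∣foldr-lcm (∈-oneTo⁺ 0<n n≤k)

  coprime-suc : ∀ j → Coprime j (suc j)
  coprime-suc j {d} (d∣j , d∣1+j) = ∣1⇒≡1 (∣m+n∣m⇒∣n (subst (d ∣_) (+-comm 1 j) d∣1+j) d∣j)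

  -- (j + 2) L - j L = 2 L, where L is a multiple of j (j + 1) and of (j + 1) (j + 2).
  three-consecutive : ∀ {j L} → j ∣ L → suc j ∣ L → suc (suc j) ∣ L → j * suc j * suc (suc j) ∣ 2 * L
  three-consecutive {j} {L} j∣L (divides v L≡v[j+1]) (divides w L≡w[j+2])
    with coprime-divisor {j} {suc j} {v} (coprime-suc j) (subst (j ∣_) (trans L≡v[j+1] (*-comm v (suc j))) j∣L)
       | coprime-divisor {suc j} {suc (suc j)} {w} (coprime-suc (suc j))
           (subst (suc j ∣_) (trans L≡w[j+2] (*-comm w (suc (suc j)))) (divides v L≡v[j+1]))
  ... | divides c v≡cj | divides d w≡d[j+1] = ∣m+n∣m⇒∣n (divides c (trans (sym (*-distribʳ-+ L j 2))
        (trans (cong ((j + 2) *_) (trans L≡v[j+1] (cong (_* suc j) v≡cj)))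
          (solve 2 (λ j c → (j :+ con 2) :* (c :* j :* (con 1 :+ j)) := c :* (j :* (con 1 :+ j) :* (con 2 :+ j))) refl j c))))
      (divides d (trans (cong (j *_) (trans L≡w[j+2] (cong (_* suc (suc j)) w≡d[j+1])))
          (solve 2 (λ j d → j :* (d :* (con 1 :+ j) :* (con 2 :+ j)) := d :* (j :* (con 1 :+ j) :* (con 2 :+ j))) refl j d)))

  -- The left side is the counting error times i. For i ≥ 3 it is at most 3 (i - 1) i (i + 1), and
  -- this product of three consecutive integers divides, hence is at most, 2 L.
  cube≤6L : ∀ {i L} → 3 ≤ i → 0 < L → (∀ {n} → 0 < n → n ≤ suc i → n ∣ L) → (suc i * suc i + 1) * i ≤ 6 * L
  cube≤6L {suc (suc (suc k))} {L} (s≤s (s≤s (s≤s z≤n))) 0<L h = begin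
    (suc i * suc i + 1) * i
      -- The summand added is the difference of the two cubics written in k = i - 3, where all its
      -- coefficients are positive.
      ≤⟨ m≤m+n _ (2 * (k * k * k) + 16 * (k * k) + 37 * k + 21) ⟩
    (suc i * suc i + 1) * i + (2 * (k * k * k) + 16 * (k * k) + 37 * k + 21)
      ≡⟨ solve 1 (λ k → ((con 4 :+ k) :* (con 4 :+ k) :+ con 1) :* (con 3 :+ k) :+ (con 2 :* (k :* k :* k) :+ con 16 :* (k :* k) :+ con 37 :* k :+ con 21)
           := con 3 :* ((con 2 :+ k) :* (con 3 :+ k) :* (con 4 :+ k))) refl k ⟩
    3 * (j * suc j * suc (suc j))
      ≤⟨ *-monoʳ-≤ 3 (∣⇒≤ {{>-nonZero (*-mono-≤ {1} {2} (s≤s z≤n) 0<L)}} (three-consecutive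
           (h (s≤s z≤n) (m≤n⇒m≤1+n (n≤1+n j))) (h (s≤s z≤n) (n≤1+n (suc j))) (h (s≤s z≤n) ≤-refl))) ⟩
    3 * (2 * L)
      ≡⟨ sym (*-assoc 3 2 L) ⟩
    6 * L ∎
    where
    open ≤-Reasoning
    i j : ℕ
    i = suc (suc (suc k))
    j = suc (suc k)

  module _ {b q L i : ℕ} (0<b : 0 < b) (0<q : 0 < q) (qi≤L : q * i ≤ L) (L<q[i+1] : L < q * suc i) where

    private
      x : ℚ
      x = L ÷ℕ q
      0<bq : 0 < b * q
      0<bq = *-mono-≤ 0<b 0<q
      xq≡L : x ℚ.* fromℕ q ≡ fromℕ L
      xq≡L = ÷ℕ-*-cancel L 0<q
      x*bq : x ℚ.* fromℕ (b * q) ≡ fromℕ (b * L)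
      x*bq = trans (cong (x ℚ.*_) (fromℕ-* b q)) (trans (S.solve 3 (λ x b q → x S.:* (b S.:* q) S.:= b S.:* (x S.:* q)) refl x (fromℕ b) (fromℕ q))
        (trans (cong (fromℕ b ℚ.*_) xq≡L) (sym (fromℕ-* b L))))
        where module S = Data.Rational.Solver.+-*-Solver

    i≤L÷q : fromℕ i ≤ℚ x
    i≤L÷q = ℚₚ.*-cancelʳ-≤-pos (fromℕ q) {{ℚ.positive (0<fromℕ 0<q)}}
      (subst₂ _≤ℚ_ (fromℕ-* i q) (sym xq≡L) (fromℕ-mono (subst (_≤ L) (*-comm q i) qi≤L)))

    L÷q<i+1 : x <ℚ fromℕ (suc i)
    L÷q<i+1 = ℚₚ.*-cancelʳ-<-nonNeg (fromℕ q) {{ℚ.nonNegative (0≤fromℕ q)}}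
      (subst₂ _<ℚ_ (sym xq≡L) (fromℕ-* (suc i) q) (ℚₚ.<-≤-trans (fromℕ<fromℕ-suc L) (fromℕ-mono (subst (suc L ≤_) (*-comm q (suc i)) L<q[i+1]))))

    -- The factor b cancels, leaving x = L / q, and the range of q places x in [i, i + 1).
    frac-x : frac ((b * L) ÷ℕ (b * q)) ≡ x ℚ.- fromℕ i
    frac-x = trans (cong frac (÷ℕ-unique (b * L) x 0<bq x*bq)) (cong (λ z → x ℚ.- z ℚ./ 1) (floor-unique x i i≤L÷q L÷q<i+1))

    square-x : ((b * L) ^ 2) ÷ℕ (b ^ 2 * q ^ 2) ≡ x ℚ.* x
    square-x = ÷ℕ-unique ((b * L) ^ 2) (x ℚ.* x) (subst (0 <_) (sym eq) (*-mono-≤ 0<bq 0<bq)) (begin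
      x ℚ.* x ℚ.* fromℕ (b ^ 2 * q ^ 2)              ≡⟨ cong (λ k → x ℚ.* x ℚ.* fromℕ k) eq ⟩
      x ℚ.* x ℚ.* fromℕ (b * q * (b * q))            ≡⟨ cong (x ℚ.* x ℚ.*_) (fromℕ-* (b * q) (b * q)) ⟩
      x ℚ.* x ℚ.* (fromℕ (b * q) ℚ.* fromℕ (b * q))  ≡⟨ S.solve 2 (λ x y → x S.:* x S.:* (y S.:* y) S.:= (x S.:* y) S.:* (x S.:* y)) refl x (fromℕ (b * q)) ⟩
      (x ℚ.* fromℕ (b * q)) ℚ.* (x ℚ.* fromℕ (b * q)) ≡⟨ cong₂ ℚ._*_ x*bq x*bq ⟩
      fromℕ (b * L) ℚ.* fromℕ (b * L)                ≡⟨ sym (fromℕ-* (b * L) (b * L)) ⟩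
      fromℕ (b * L * (b * L))                        ≡⟨ cong (λ k → fromℕ (b * L * k)) (sym (*-identityʳ (b * L))) ⟩
      fromℕ ((b * L) ^ 2)                            ∎)
      where
      open ≡-Reasoning
      module S = Data.Rational.Solver.+-*-Solver
      eq : b ^ 2 * q ^ 2 ≡ b * q * (b * q)
      eq = solve 2 (λ b q → b :* (b :* con 1) :* (q :* (q :* con 1)) := b :* q :* (b :* q)) refl b q

    mainTerm-coefficient : fromℕ q ℚ.* (((b * L) ^ 2) ÷ℕ (b ^ 2 * q ^ 2) ℚ.- frac ((b * L) ÷ℕ (b * q)) ^ℚ 2)
                           ≡ fromℕ q ℚ.* (x ℚ.* x ℚ.- (x ℚ.- fromℕ i) ℚ.* (x ℚ.- fromℕ i))
    mainTerm-coefficient = cong (fromℕ q ℚ.*_) (cong₂ ℚ._-_ square-x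
      (trans (cong (_^ℚ 2) frac-x) (cong ((x ℚ.- fromℕ i) ℚ.*_) (ℚₚ.*-identityʳ (x ℚ.- fromℕ i)))))

-- From Walfisz's estimate to the error term

module Asymptotics where

  open import Data.Nat.Base as ℕ using (ℕ; suc; z≤n; s≤s)
  open import Data.Nat.Divisibility using (_∣_)
  import Data.Nat.Properties as ℕₚ
  open import Data.Product.Base using (_×_; _,_; proj₁; proj₂)
  open import Data.Rational.Base
  open import Data.Rational.Properties
  open import Data.Rational.Solver
  open import Relation.Binary.PropositionalEquality
  open import Relation.Nullary.Decidable using (from-yes)
  open +-*-Solver
  open ℚ-Lemmas
  open ℝ-Lemmas
  open ExpLemmas
  open LeibnizLemmas using (split; t; t-bounds; leibniz≥½)
  open Analysis
  open Delta
  open RankDifference using (totient; weightedTotient; ÷ℕ-*-cancel)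
  open Arithmetic

  leibniz≤1 : ∀ n → leibniz n ≤ 1ℚ
  leibniz≤1 n = ≤-trans (≤-reflexive (trans (cong leibniz (sym (ℕₚ.+-identityʳ n))) (trans (split n 0)
      (trans (+-identityˡ (1ℚ * t 0 n)) (*-identityˡ (t 0 n))))))
    (≤-trans (proj₂ (t-bounds n 0)) (from-yes (LeibnizLemmas.a 0 ≤? 1ℚ)))

  -- From π ≤ 4, as all partial sums of the Leibniz series are at most 1. The bound holds for the
  -- approximations themselves from n = 1 on.
  3/π²≥ : ∀ n → 1 ℕ.≤ n → 3 ÷ℕ 16 ≤ seq 3/π² n
  3/π²≥ n 1≤n = ≤-trans (from-yes (3 ÷ℕ 16 ≤? fromℕ 3 * (inv (fromℕ 4) * inv (fromℕ 4))))
    (*ˡ-mono (0≤fromℕ 3) (*-mono 0≤¼ (≤-trans 0≤¼ ¼≤) ¼≤ ¼≤))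
    where
    0≤¼ : 0ℚ ≤ inv (fromℕ 4)
    0≤¼ = from-yes (0ℚ ≤? inv (fromℕ 4))
    0<πₙ : 0ℚ < seq π n
    0<πₙ = <-≤-trans (from-yes (0ℚ <? fromℕ 4 * ½)) (*ˡ-mono (0≤fromℕ 4) (leibniz≥½ n 1≤n))
    ¼≤ : inv (fromℕ 4) ≤ inv (seq π n)
    ¼≤ = inv-antimono 0<πₙ (≤-castʳ (*-identityʳ (fromℕ 4)) (*ˡ-mono (0≤fromℕ 4) (leibniz≤1 n)))

  seq-∣∣ : ∀ x n q → seq x n ≡ q → seq ∣ x ∣ʳ n ≡ ∣ q ∣
  seq-∣∣ x n q = cong ∣_∣ {seq x n} {q}

  -- E(x) - x H(x) as a polynomial in x ∈ [i, i + 1)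
  errorPoly : (p S T x : ℚ) → ℚ
  errorPoly p S T x = S + - (p * (x * x)) + - (x * (T + - (fromℕ 2 * p * x)))

  -- An upper bound m for ∣ errorPoly ∣ at i, i + ¼ and i + ½ bounds the leading
  -- coefficient p, by a second difference, and the slope T - 2 p i.
  module Interpolation (p S T i : ℚ) {m : ℚ}
    (h₀ : ∣ errorPoly p S T i ∣ ≤ m)
    (h₁ : ∣ errorPoly p S T (i + 1 ÷ℕ 4) ∣ ≤ m)
    (h₂ : ∣ errorPoly p S T (i + ½) ∣ ≤ m) where

    private
      f₀ f₁ f₂ : ℚ
      f₀ = errorPoly p S T i
      f₁ = errorPoly p S T (i + 1 ÷ℕ 4)
      f₂ = errorPoly p S T (i + ½)
      E₀ : ∀ {n} (p S T x : Polynomial n) → Polynomial n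
      E₀ p S T x = S :+ :- (p :* (x :* x)) :+ :- (x :* (T :+ :- (con (fromℕ 2) :* p :* x)))
      0≤m-f : ∀ {f} → ∣ f ∣ ≤ m → 0ℚ ≤ m - f
      0≤m-f h = p≤q⇒0≤q-p (∣p∣≤⇒p≤q h)
      0≤m+f : ∀ {f} → ∣ f ∣ ≤ m → 0ℚ ≤ m + f
      0≤m+f {f} h = ≤-castʳ (solve 2 (λ f m → f :+ :- (:- m) := m :+ f) refl f m) (p≤q⇒0≤q-p (∣p∣≤⇒-q≤p h))

    -- With step ¼ the second difference is p/8, and its weights 1, -2, 1 have absolute sum 4; hence
    -- 8 times 4.
    p≤32m : p ≤ fromℕ 32 * m
    p≤32m = ≤-castˡ second (≤-by
      (0≤* (0≤fromℕ 8) (0≤+ (0≤+ (0≤m-f h₀) (0≤* (0≤fromℕ 2) (0≤m+f h₁))) (0≤m-f h₂)))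
      (solve 4 (λ a b c m → con (fromℕ 8) :* ((m :+ :- a) :+ con (fromℕ 2) :* (m :+ b) :+ (m :+ :- c))
         := con (fromℕ 32) :* m :+ :- (con (fromℕ 8) :* (a :+ :- (con (fromℕ 2) :* b) :+ c))) refl f₀ f₁ f₂ m))
      where
      second : fromℕ 8 * (f₀ - fromℕ 2 * f₁ + f₂) ≡ p
      second = solve 4 (λ p S T i → con (fromℕ 8) :* (E₀ p S T i :+ :- (con (fromℕ 2) :* E₀ p S T (i :+ con (1 ÷ℕ 4))) :+ E₀ p S T (i :+ con ½))
        := p) refl p S T i

    -- The quantity is minus the derivative of the quadratic at i, recovered exactly by a
    -- three-point forward difference. The weights 6, -8, 2 have absolute sum 16.
    slope : ∣ T - fromℕ 2 * p * i ∣ ≤ fromℕ 16 * m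
    slope = ≤-castˡ (cong ∣_∣ eq) (∣p∣≤
      (≤-by (0≤+ (0≤+ (0≤* (0≤fromℕ 2) (0≤m-f h₂)) (0≤* (0≤fromℕ 6) (0≤m-f h₀))) (0≤* (0≤fromℕ 8) (0≤m+f h₁)))
        (solve 4 (λ a b c m → con (fromℕ 2) :* (m :+ :- c) :+ con (fromℕ 6) :* (m :+ :- a) :+ con (fromℕ 8) :* (m :+ b)
           := con (fromℕ 16) :* m :+ :- (con (fromℕ 2) :* c :+ con (fromℕ 6) :* a :+ :- (con (fromℕ 8) :* b))) refl f₀ f₁ f₂ m))
      (≤-by (0≤+ (0≤+ (0≤* (0≤fromℕ 2) (0≤m+f h₂)) (0≤* (0≤fromℕ 6) (0≤m+f h₀))) (0≤* (0≤fromℕ 8) (0≤m-f h₁)))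
        (solve 4 (λ a b c m → con (fromℕ 2) :* (m :+ c) :+ con (fromℕ 6) :* (m :+ a) :+ con (fromℕ 8) :* (m :+ :- b)
           := con (fromℕ 16) :* m :+ :- (:- (con (fromℕ 2) :* c :+ con (fromℕ 6) :* a :+ :- (con (fromℕ 8) :* b)))) refl f₀ f₁ f₂ m)))
      where
      eq : fromℕ 2 * f₂ + fromℕ 6 * f₀ - fromℕ 8 * f₁ ≡ T - fromℕ 2 * p * i
      eq = solve 4 (λ p S T i → con (fromℕ 2) :* E₀ p S T (i :+ con ½) :+ con (fromℕ 6) :* E₀ p S T i :+ :- (con (fromℕ 8) :* E₀ p S T (i :+ con (1 ÷ℕ 4)))
        := T :+ :- (con (fromℕ 2) :* p :* i)) refl p S T i

    -- With L = q x: the difference is q ((x - i) (T - 2 p i) - f₀).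
    main-difference : ∀ {q x L} → 0ℚ ≤ q → i ≤ x → x ≤ i + 1ℚ → x * q ≡ L →
      ∣ L * T - q * S - p * (q * (x * x - (x - i) * (x - i))) ∣ ≤ fromℕ 17 * q * m
    main-difference {q} {x} 0≤q i≤x x≤i+1 refl = ≤-castˡ (cong ∣_∣ eq)
      (≤-castˡ (sym (trans (∣p*q∣≡∣p∣*∣q∣ q ((x - i) * s - f₀)) (cong (_* ∣ (x - i) * s - f₀ ∣) (0≤p⇒∣p∣≡p 0≤q))))
        (≤-castʳ (solve 2 (λ q m → q :* (con 1ℚ :* (con (fromℕ 16) :* m) :+ m) := con (fromℕ 17) :* q :* m) refl q m)
          (*ˡ-mono 0≤q (≤-trans (∣p+q∣≤∣p∣+∣q∣ ((x - i) * s) (- f₀))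
            (+-mono-≤
              (≤-castˡ (sym (trans (∣p*q∣≡∣p∣*∣q∣ (x - i) s) (cong (_* ∣ s ∣) (0≤p⇒∣p∣≡p 0≤x-i))))
                (*-mono 0≤x-i (≤-trans (0≤∣p∣ s) slope) x-i≤1 slope))
              (≤-castˡ (sym (∣-p∣≡∣p∣ f₀)) h₀))))))
      where
      s : ℚ
      s = T - fromℕ 2 * p * i
      0≤x-i : 0ℚ ≤ x - i
      0≤x-i = p≤q⇒0≤q-p i≤x
      x-i≤1 : x - i ≤ 1ℚ
      x-i≤1 = ≤-by (p≤q⇒0≤q-p x≤i+1) (solve 2 (λ x i → i :+ con 1ℚ :+ :- x := con 1ℚ :+ :- (x :+ :- i)) refl x i)
      eq : q * ((x - i) * s - f₀) ≡ x * q * T - q * S - p * (q * (x * x - (x - i) * (x - i)))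
      eq = solve 6 (λ p S T i q x → q :* ((x :+ :- i) :* (T :+ :- (con (fromℕ 2) :* p :* i)) :+ :- E₀ p S T i)
        := x :* q :* T :+ :- (q :* S) :+ :- (p :* (q :* (x :* x :+ :- ((x :+ :- i) :* (x :+ :- i)))))) refl p S T i q x

  -- Gathers the facts needed at a single index n; `1≤n` is there for the lower bound `3/π²≥`.
  record Bounded₃ (f₀ f₁ f₂ m : ℚ) (n : ℕ) : Set where
    constructor mkBounded₃
    field
      at₀ : ∣ f₀ ∣ ≤ m
      at₁ : ∣ f₁ ∣ ≤ m
      at₂ : ∣ f₂ ∣ ≤ m
      1≤n : 1 ℕ.≤ n

  bounded₃ : ∀ f₀ f₁ f₂ (m : ℕ → ℚ) →
    Eventually (λ n → ∣ f₀ n ∣ ≤ m n) → Eventually (λ n → ∣ f₁ n ∣ ≤ m n) → Eventually (λ n → ∣ f₂ n ∣ ≤ m n) →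
    Eventually λ n → Bounded₃ (f₀ n) (f₁ n) (f₂ n) (m n) n
  bounded₃ f₀ f₁ f₂ m ev₀ ev₁ ev₂ =
    _⟪_⟫_ {≤m f₀} {λ n → ≤m f₁ n × ≤m f₂ n × 1 ℕ.≤ n} ev₀ (λ n a (b , c , d) → mkBounded₃ a b c d)
      (_⟪_⟫_ {≤m f₁} {λ n → ≤m f₂ n × 1 ℕ.≤ n} ev₁ (λ n → _,_) (_⟪_⟫_ {≤m f₂} {1 ℕ.≤_} ev₂ (λ n → _,_) (1 , λ n h → h)))
    where
    ≤m : (ℕ → ℚ) → ℕ → Set
    ≤m f n = ∣ f n ∣ ≤ m n

  module Estimate (A : ℝ) (0<A : 0ʳ <ʳ A) (C : ℝ)
    (walfisz : ∀ (x : ℝ) (n : ℕ) (3≤x : fromℚ (fromℕ 3) ≤ʳ x) → fromℚ (fromℕ n) ≤ʳ x → x <ʳ fromℚ (fromℕ (suc n)) →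
               ∣ E x n -ʳ x *ʳ H x n ∣ʳ ≤ʳ C *ʳ (x *ʳ δ A x 3≤x))
    (K : ℚ) (0≤K : 0ℚ ≤ K) (∣C∣≤K : Eventually λ n → ∣ seq C n ∣ ≤ K)
    (Kδ : ℚ) (quasi : QuasiAntimono A 0<A Kδ) where

    private
      D : ∀ {i} → 3 ℕ.≤ i → ℝ
      D = δᵢ A 0<A
      0≤D : ∀ {i} (3≤i : 3 ℕ.≤ i) → 0ʳ ≤ʳ D 3≤i
      0≤D {i} 3≤i = 0≤δ A 0<A (fromℚ (fromℕ i)) (fromℕ-mono-≤ʳ 3≤i)
      0≤Kδ : 0ℚ ≤ Kδ
      0≤Kδ = proj₁ quasi

    -- `K` bounds Walfisz's constant, `Kδ` is the price of moving δ from x to i, and 2 comes from x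
    -- ≤ 2 i.
    κ : ℚ
    κ = fromℕ 2 * K * Kδ

    0≤κ : 0ℚ ≤ κ
    0≤κ = 0≤* (0≤* (0≤fromℕ 2) 0≤K) 0≤Kδ

    M : ∀ {i} → 3 ℕ.≤ i → ℝ
    M {i} 3≤i = fromℚ (κ * fromℕ i) *ʳ D 3≤i

    F : ℚ → ℕ → ℝ
    F x i = E (fromℚ x) i -ʳ fromℚ x *ʳ H (fromℚ x) i

    -- Since i ≤ x ≤ i + ½ < i + 1, the integer part in Walfisz's estimate is i, and
    -- quasi-antitonicity lets one bound serve all x in this range.
    F-bound : ∀ {i} (3≤i : 3 ℕ.≤ i) x → fromℕ i ≤ x → x ≤ fromℕ i + ½ → ∣ F x i ∣ʳ ≤ʳ M 3≤i
    F-bound {i} 3≤i x i≤x x≤i+½ = ≤ʳ-trans ∣ F x i ∣ʳ (C *ʳ xδ) (M 3≤i)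
        (walfisz (fromℚ x) i 3≤x (≤ʳ-pointwise (fromℚ (fromℕ i)) (fromℚ x) λ _ → i≤x) x<i+1)
      (≤ʳ-trans (C *ʳ xδ) (fromℚ K *ʳ xδ) (M 3≤i)
        (*ʳ-monoʳ xδ C (fromℚ K) 0≤xδ (≤ʳ-eventually C (fromℚ K) (mapᵉ (λ n → ∣p∣≤⇒p≤q) ∣C∣≤K)))
      (≤ʳ-trans (fromℚ K *ʳ xδ) (fromℚ K *ʳ (fromℚ x *ʳ (fromℚ Kδ *ʳ D 3≤i))) (M 3≤i)
        (*ʳ-monoˡ (fromℚ K) xδ (fromℚ x *ʳ (fromℚ Kδ *ʳ D 3≤i)) (≤ʳ-pointwise 0ʳ (fromℚ K) λ _ → 0≤K)
          (*ʳ-monoˡ (fromℚ x) Dx (fromℚ Kδ *ʳ D 3≤i) (≤ʳ-pointwise 0ʳ (fromℚ x) λ _ → 0≤x)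
            (proj₂ quasi 3≤i x 3≤x i≤x)))
      (≤ʳ-trans (fromℚ K *ʳ (fromℚ x *ʳ (fromℚ Kδ *ʳ D 3≤i))) (fromℚ (K * x * Kδ) *ʳ D 3≤i) (M 3≤i)
        (≤ʳ-pointwise (fromℚ K *ʳ (fromℚ x *ʳ (fromℚ Kδ *ʳ D 3≤i))) (fromℚ (K * x * Kδ) *ʳ D 3≤i) λ n → ≤-reflexive
          (solve 4 (λ k x d y → k :* (x :* (d :* y)) := k :* x :* d :* y) refl K x Kδ (seq (D 3≤i) n)))
        (*ʳ-monoʳ (D 3≤i) (fromℚ (K * x * Kδ)) (fromℚ (κ * fromℕ i)) (0≤D 3≤i)
          (≤ʳ-pointwise (fromℚ (K * x * Kδ)) (fromℚ (κ * fromℕ i)) λ _ → ≤-castʳ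
            (solve 3 (λ k i d → k :* (con (fromℕ 2) :* i) :* d := con (fromℕ 2) :* k :* d :* i) refl K (fromℕ i) Kδ)
            (*ʳ-mono 0≤Kδ (*ˡ-mono 0≤K x≤2i)))))))
      where
      3≤x : fromℚ (fromℕ 3) ≤ʳ fromℚ x
      3≤x = ≤ʳ-pointwise (fromℚ (fromℕ 3)) (fromℚ x) λ _ → ≤-trans (fromℕ-mono 3≤i) i≤x
      0≤x : 0ℚ ≤ x
      0≤x = ≤-trans (0≤fromℕ i) i≤x
      Dx xδ : ℝ
      Dx = δ A (fromℚ x) 3≤x
      xδ = fromℚ x *ʳ Dx
      0≤xδ : 0ʳ ≤ʳ xδ
      0≤xδ = 0≤ʳ* (fromℚ x) Dx (≤ʳ-pointwise 0ʳ (fromℚ x) λ _ → 0≤x) (0≤δ A 0<A (fromℚ x) 3≤x)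
      x<i+1 : fromℚ x <ʳ fromℚ (fromℕ (suc i))
      x<i+1 = ½ , from-yes (0ℚ <? ½) , always λ _ → ≤-trans (+-monoˡ-≤ ½ x≤i+½)
        (≤-reflexive (trans (solve 1 (λ i → i :+ con ½ :+ con ½ := i :+ con 1ℚ) refl (fromℕ i)) (sym (fromℕ-suc i))))
      x≤2i : x ≤ fromℕ 2 * fromℕ i
      x≤2i = ≤-trans x≤i+½ (≤-by (≤-trans (from-yes (0ℚ ≤? fromℕ 3 - ½)) (+-monoˡ-≤ (- ½) (fromℕ-mono 3≤i)))
        (solve 1 (λ i → i :+ :- con ½ := con (fromℕ 2) :* i :+ :- (i :+ con ½)) refl (fromℕ i)))

    seq-F : ∀ x i n → seq (F x i) n ≡ errorPoly (seq 3/π² n) (totient i) (weightedTotient i) x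
    seq-F x i n = refl

    fₙ : ℕ → ℚ → ℕ → ℚ
    fₙ i x n = errorPoly (seq 3/π² n) (totient i) (weightedTotient i) x

    near-eventually : ∀ {i} (3≤i : 3 ℕ.≤ i) x ε → 0ℚ < ε → fromℕ i ≤ x → x ≤ fromℕ i + ½ →
                      Eventually λ n → ∣ fₙ i x n ∣ ≤ seq (M 3≤i) n + ε
    near-eventually {i} 3≤i x ε 0<ε h h′ = mapᵉ {λ n → seq ∣ F x i ∣ʳ n ≤ seq (M 3≤i) n + ε} {λ n → ∣ fₙ i x n ∣ ≤ seq (M 3≤i) n + ε}
      (λ n → subst (_≤ seq (M 3≤i) n + ε) (seq-∣∣ (F x i) n (fₙ i x n) (seq-F x i n)))
      (F-bound 3≤i x h h′ ε 0<ε)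

    bounds : ∀ {i} (3≤i : 3 ℕ.≤ i) ε → 0ℚ < ε →
      Eventually λ n → Bounded₃ (fₙ i (fromℕ i) n) (fₙ i (fromℕ i + 1 ÷ℕ 4) n) (fₙ i (fromℕ i + ½) n) (seq (M 3≤i) n + ε) n
    bounds {i} 3≤i ε 0<ε = bounded₃ (fₙ i (fromℕ i)) (fₙ i (fromℕ i + 1 ÷ℕ 4)) (fₙ i (fromℕ i + ½)) (λ n → seq (M 3≤i) n + ε)
      (near-eventually 3≤i (fromℕ i) ε 0<ε ≤-refl (p≤p+q (from-yes (0ℚ ≤? ½))))
      (near-eventually 3≤i (fromℕ i + 1 ÷ℕ 4) ε 0<ε (p≤p+q (from-yes (0ℚ ≤? 1 ÷ℕ 4))) (+-monoʳ-≤ (fromℕ i) (from-yes (1 ÷ℕ 4 ≤? ½))))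
      (near-eventually 3≤i (fromℕ i + ½) ε 0<ε (p≤p+q (from-yes (0ℚ ≤? ½))) ≤-refl)

    -- 1217 = 200 * 6 + 17: the factor 200 of `1≤200m` times the 6 of `cube≤6L`, plus the 17 of
    -- `main-difference`.
    implied : ℝ
    implied = fromℚ (fromℕ 1217 * κ)

    module _ {b q L i : ℕ} (3≤i : 3 ℕ.≤ i) (0<b : 0 ℕ.< b) (0<q : 0 ℕ.< q)
      (qi≤L : q ℕ.* i ℕ.≤ L) (L<q[i+1] : L ℕ.< q ℕ.* suc i)
      (∣L : ∀ {n} → 0 ℕ.< n → n ℕ.≤ suc i → n ∣ L) where

      private
        N : ℕ
        N = b ℕ.* L
        e : ℕ
        -- The lattice count costs (i + 1)²; the extra 1 pays for replacing the rank of a₁ / b₁ by a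
        -- nearby number.
        e = suc i ℕ.* suc i ℕ.+ 1
        x R main : ℚ
        x = L ÷ℕ q
        R = fromℕ q * ((N ℕ.^ 2) ÷ℕ (b ℕ.^ 2 ℕ.* q ℕ.^ 2) - frac (N ÷ℕ (b ℕ.* q)) ^ℚ 2)
        main = fromℕ L * weightedTotient i - fromℕ q * totient i
        W : ℚ
        -- The total error measured in units of m: `e` is converted by 1 ≤ 200 m, and the analytic
        -- part is 17 q m.
        W = fromℕ 200 * fromℕ e + fromℕ 17 * fromℕ q
        0≤W : 0ℚ ≤ W
        0≤W = 0≤+ (0≤* (0≤fromℕ 200) (0≤fromℕ e)) (0≤* (0≤fromℕ 17) (0≤fromℕ q))

        module _ {r base s ε : ℚ} {n : ℕ} (∣s∣≤1 : ∣ s ∣ ≤ 1ℚ) (h : ∣ r - base - s * main ∣ ≤ fromℕ e)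
                 (B : Bounded₃ (fₙ i (fromℕ i) n) (fₙ i (fromℕ i + 1 ÷ℕ 4) n) (fₙ i (fromℕ i + ½) n) (seq (M 3≤i) n + ε) n) where
          open Bounded₃ B
          p m : ℚ
          p = seq 3/π² n
          m = seq (M 3≤i) n + ε
          open Interpolation p (totient i) (weightedTotient i) (fromℕ i) {m} (at₀) (at₁) (at₂)

          0≤m : 0ℚ ≤ m
          0≤m = ≤-trans (0≤∣p∣ (errorPoly p (totient i) (weightedTotient i) (fromℕ i))) (at₀)

          -- The lower bound for i δ(i): from 3/16 ≤ p ≤ 32 m follows 1 ≤ (512/3) m, with the
          -- coefficient rounded up to 200.
          1≤200m : 1ℚ ≤ fromℕ 200 * m
          1≤200m = ≤-trans (≤-trans (from-yes (1ℚ ≤? 16 ÷ℕ 3 * (3 ÷ℕ 16)))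
              (*ˡ-mono (from-yes (0ℚ ≤? 16 ÷ℕ 3)) (≤-trans (3/π²≥ n 1≤n) p≤32m)))
            (≤-castˡ (solve 1 (λ m → con (16 ÷ℕ 3 * fromℕ 32) :* m := con (16 ÷ℕ 3) :* (con (fromℕ 32) :* m)) refl m)
              (*ʳ-mono 0≤m (from-yes (16 ÷ℕ 3 * fromℕ 32 ≤? fromℕ 200))))

          main≈ : ∣ main - p * R ∣ ≤ fromℕ 17 * fromℕ q * m
          main≈ = subst (λ R → ∣ main - p * R ∣ ≤ fromℕ 17 * fromℕ q * m)
            (sym (mainTerm-coefficient {b} {q} {L} {i} 0<b 0<q qi≤L L<q[i+1]))
            (main-difference {fromℕ q} {x} {fromℕ L} (0≤fromℕ q) (i≤L÷q {b} {q} {L} {i} 0<b 0<q qi≤L L<q[i+1])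
              (≤-trans (<⇒≤ (L÷q<i+1 {b} {q} {L} {i} 0<b 0<q qi≤L L<q[i+1])) (≤-reflexive (fromℕ-suc i)))
              (÷ℕ-*-cancel L 0<q))

          rational-estimate : ∣ r - (base + s * (p * R)) ∣ ≤ W * seq (M 3≤i) n + W * ε
          rational-estimate = begin
            ∣ r - (base + s * (p * R)) ∣
              ≡⟨ cong ∣_∣ (solve 5 (λ r b s m y → r :+ :- (b :+ s :* y) := (r :+ :- b :+ :- (s :* m)) :+ s :* (m :+ :- y)) refl r base s main (p * R)) ⟩
            ∣ (r - base - s * main) + s * (main - p * R) ∣
              ≤⟨ ∣p+q∣≤∣p∣+∣q∣ (r - base - s * main) (s * (main - p * R)) ⟩
            ∣ r - base - s * main ∣ + ∣ s * (main - p * R) ∣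
              ≤⟨ +-mono-≤
                   (≤-trans h (≤-castˡ (*-identityʳ (fromℕ e)) (*ˡ-mono (0≤fromℕ e) 1≤200m)))
                   (≤-castˡ (sym (∣p*q∣≡∣p∣*∣q∣ s (main - p * R))) (≤-castʳ (*-identityˡ (fromℕ 17 * fromℕ q * m))
                     (*-mono (0≤∣p∣ s) (≤-trans (0≤∣p∣ (main - p * R)) main≈) ∣s∣≤1 main≈))) ⟩
            fromℕ e * (fromℕ 200 * m) + fromℕ 17 * fromℕ q * m
              ≡⟨ solve 4 (λ e q m ε → e :* (con (fromℕ 200) :* (m :+ ε)) :+ con (fromℕ 17) :* q :* (m :+ ε)
                   := (con (fromℕ 200) :* e :+ con (fromℕ 17) :* q) :* m :+ (con (fromℕ 200) :* e :+ con (fromℕ 17) :* q) :* ε)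
                   refl (fromℕ e) (fromℕ q) (seq (M 3≤i) n) ε ⟩
            W * seq (M 3≤i) n + W * ε ∎
            where open ≤-Reasoning

        -- The bound `M` carries a factor i. It turns `e` into a cube, absorbed by the size of the
        -- lcm, and q into q i ≤ L ≤ N.
        W*i≤ : W * (κ * fromℕ i) ≤ fromℕ 1217 * κ * fromℕ N
        W*i≤ = begin
          W * (κ * fromℕ i)
            ≡⟨ solve 4 (λ e q k i → (con (fromℕ 200) :* e :+ con (fromℕ 17) :* q) :* (k :* i)
                 := k :* (con (fromℕ 200) :* (e :* i) :+ con (fromℕ 17) :* (q :* i))) refl (fromℕ e) (fromℕ q) κ (fromℕ i) ⟩
          κ * (fromℕ 200 * (fromℕ e * fromℕ i) + fromℕ 17 * (fromℕ q * fromℕ i))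
            ≤⟨ *ˡ-mono 0≤κ (+-mono-≤ (*ˡ-mono (0≤fromℕ 200) ei≤) (*ˡ-mono (0≤fromℕ 17) qi≤)) ⟩
          κ * (fromℕ 200 * (fromℕ 6 * fromℕ N) + fromℕ 17 * fromℕ N)
            ≡⟨ solve 2 (λ k n → k :* (con (fromℕ 200) :* (con (fromℕ 6) :* n) :+ con (fromℕ 17) :* n) := con (fromℕ 1217) :* k :* n) refl κ (fromℕ N) ⟩
          fromℕ 1217 * κ * fromℕ N ∎
          where
          open ≤-Reasoning
          L≤N : fromℕ L ≤ fromℕ N
          L≤N = fromℕ-mono (ℕₚ.m≤n*m L b {{ℕ.>-nonZero 0<b}})
          0<L : 0 ℕ.< L
          0<L = ℕₚ.≤-trans (ℕₚ.*-mono-≤ 0<q (ℕₚ.≤-trans (s≤s z≤n) 3≤i)) qi≤L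
          ei≤ : fromℕ e * fromℕ i ≤ fromℕ 6 * fromℕ N
          ei≤ = ≤-castˡ (fromℕ-* e i) (≤-trans (fromℕ-mono (cube≤6L 3≤i 0<L ∣L))
            (≤-castˡ (sym (fromℕ-* 6 L)) (*ˡ-mono (0≤fromℕ 6) L≤N)))
          qi≤ : fromℕ q * fromℕ i ≤ fromℕ N
          qi≤ = ≤-castˡ (fromℕ-* q i) (≤-trans (fromℕ-mono qi≤L) L≤N)

      real-estimate : ∀ r base s → ∣ s ∣ ≤ 1ℚ → ∣ r - base - s * main ∣ ≤ fromℕ e →
        ∣ fromℚ r -ʳ (fromℚ base +ʳ fromℚ s *ʳ mainTerm b q N) ∣ʳ ≤ʳ implied *ʳ (fromℚ (fromℕ N) *ʳ D 3≤i)
      real-estimate r base s ∣s∣≤1 h = ≤ʳ-trans Z (fromℚ W *ʳ M 3≤i) (implied *ʳ (fromℚ (fromℕ N) *ʳ D 3≤i))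
        (≤ʳᴷ Z (fromℚ W *ʳ M 3≤i) W 0≤W λ ε 0<ε → mapᵉ
          {λ n → Bounded₃ (fₙ i (fromℕ i) n) (fₙ i (fromℕ i + 1 ÷ℕ 4) n) (fₙ i (fromℕ i + ½) n) (seq (M 3≤i) n + ε) n}
          {λ n → seq Z n ≤ W * seq (M 3≤i) n + W * ε}
          (λ n B → subst (_≤ W * seq (M 3≤i) n + W * ε) (sym (seq-∣∣ Y n (r - (base + s * (seq 3/π² n * R))) refl))
            (rational-estimate {r} {base} {s} {ε} {n} ∣s∣≤1 h B))
          (bounds 3≤i ε 0<ε))
        (≤ʳ-trans (fromℚ W *ʳ M 3≤i) (fromℚ (W * (κ * fromℕ i)) *ʳ D 3≤i) (implied *ʳ (fromℚ (fromℕ N) *ʳ D 3≤i))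
          (≤ʳ-pointwise (fromℚ W *ʳ M 3≤i) (fromℚ (W * (κ * fromℕ i)) *ʳ D 3≤i) λ n → ≤-reflexive
            (sym (*-assoc W (κ * fromℕ i) (seq (D 3≤i) n))))
        (≤ʳ-trans (fromℚ (W * (κ * fromℕ i)) *ʳ D 3≤i) (fromℚ (fromℕ 1217 * κ * fromℕ N) *ʳ D 3≤i) (implied *ʳ (fromℚ (fromℕ N) *ʳ D 3≤i))
          (*ʳ-monoʳ (D 3≤i) (fromℚ (W * (κ * fromℕ i))) (fromℚ (fromℕ 1217 * κ * fromℕ N)) (0≤D 3≤i)
            (≤ʳ-pointwise (fromℚ (W * (κ * fromℕ i))) (fromℚ (fromℕ 1217 * κ * fromℕ N)) λ _ → W*i≤))
          (≤ʳ-pointwise (fromℚ (fromℕ 1217 * κ * fromℕ N) *ʳ D 3≤i) (implied *ʳ (fromℚ (fromℕ N) *ʳ D 3≤i)) λ n → ≤-reflexive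
            (*-assoc (fromℕ 1217 * κ) (fromℕ N) (seq (D 3≤i) n)))))
        where
        Y Z : ℝ
        Y = fromℚ r -ʳ (fromℚ base +ʳ fromℚ s *ʳ mainTerm b q N)
        Z = ∣ Y ∣ʳ

-- Specialisation to the three statements

module Corollary where

  open import Data.Bool.Base using (true; false)
  open import Data.List.Base using (length)
  open import Data.Nat.Base
  open import Data.Nat.Divisibility using (_∣_)
  open import Data.Nat.Properties
  open import Data.Nat.Solver
  open import Data.Product.Base using (∃; _×_; _,_; proj₁; proj₂)
  open import Data.Rational.Base as ℚ using (ℚ; 0ℚ; 1ℚ) renaming (_≤_ to _≤ℚ_; _<_ to _<ℚ_)
  import Data.Rational.Properties as ℚₚ
  import Data.Rational.Solver
  open import Data.Sum.Base using (inj₁; inj₂)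
  open import Relation.Binary.PropositionalEquality
  open import Relation.Nullary using (does)
  open import Relation.Nullary.Decidable using (from-yes)
  open +-*-Solver
  open ℚ-Lemmas using (fromℕ-mono; 0≤fromℕ)
  open ℝ-Lemmas using (bounded)
  open Counting
  open RankDifference
  open RankEstimate
  open Analysis
  open Delta using (QuasiAntimono; δ-quasi-antimono)
  open Arithmetic
  open Asymptotics

  private module S = Data.Rational.Solver.+-*-Solver

  ∣side∣≤1 : ∀ a₁ b₁ a₂ b₂ → ℚ.∣ side a₁ b₁ a₂ b₂ ∣ ≤ℚ 1ℚ
  ∣side∣≤1 a₁ b₁ a₂ b₂ with does (a₁ * b₂ <? a₂ * b₁)
  ... | true  = ℚₚ.≤-refl
  ... | false = ℚₚ.≤-refl

  -- Serves all three statements, whose leading terms are the rank of a₁ / b₁ itself, 0, and half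
  -- the length of the Farey sequence.
  change-base : ∀ {r base base′ y k} → ℚ.∣ r ℚ.- base ℚ.- y ∣ ≤ℚ fromℕ k → ℚ.∣ base ℚ.- base′ ∣ ≤ℚ 1ℚ →
                ℚ.∣ r ℚ.- base′ ℚ.- y ∣ ≤ℚ fromℕ (k + 1)
  change-base {r} {base} {base′} {y} {k} h h′ = subst₂ _≤ℚ_
    (cong ℚ.∣_∣ (S.solve 4 (λ r b c y → (r S.:+ S.:- b S.:+ S.:- y) S.:+ (b S.:+ S.:- c) S.:= r S.:+ S.:- c S.:+ S.:- y) refl r base base′ y))
    (sym (ℚ-Lemmas.fromℕ-+ k 1))
    (ℚₚ.≤-trans (ℚₚ.∣p+q∣≤∣p∣+∣q∣ (r ℚ.- base ℚ.- y) (base ℚ.- base′)) (ℚₚ.+-mono-≤ h h′))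

  drop-1* : ∀ x b y → ∣ x -ʳ (b +ʳ y) ∣ʳ ≤ʳ ∣ x -ʳ (b +ʳ fromℚ 1ℚ *ʳ y) ∣ʳ
  drop-1* x b y = ≤ʳ-pointwise (∣ x -ʳ (b +ʳ y) ∣ʳ) (∣ x -ʳ (b +ʳ fromℚ 1ℚ *ʳ y) ∣ʳ) λ n → ℚₚ.≤-reflexive
    (cong (λ t → ℚ.∣ seq x n ℚ.- (seq b n ℚ.+ t) ∣) (sym (ℚₚ.*-identityˡ (seq y n))))

  drop-0+1* : ∀ x y → ∣ x -ʳ y ∣ʳ ≤ʳ ∣ x -ʳ (fromℚ 0ℚ +ʳ fromℚ 1ℚ *ʳ y) ∣ʳ
  drop-0+1* x y = ≤ʳ-pointwise (∣ x -ʳ y ∣ʳ) (∣ x -ʳ (fromℚ 0ℚ +ʳ fromℚ 1ℚ *ʳ y) ∣ʳ) λ n → ℚₚ.≤-reflexive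
    (cong (λ t → ℚ.∣ seq x n ℚ.- t ∣) (sym (trans (ℚₚ.+-identityˡ (1ℚ ℚ.* seq y n)) (ℚₚ.*-identityˡ (seq y n)))))

  record Range (q i L : ℕ) : Set where
    field
      0<q      : 0 < q
      qi≤L     : q * i ≤ L
      L<q[i+1] : L < q * suc i

  range : ∀ {q i L} → L < q * suc i → q * i ≤ L → Range q i L
  range {zero}  () _
  range {suc q} h h′ = record { 0<q = s≤s z≤n ; qi≤L = h′ ; L<q[i+1] = h }

  scaled-range : ∀ {b q i L} → 0 < b → 0 < i → (b * L) ÷ℕ (b * (i + 1)) <ℚ fromℕ q → fromℕ q ≤ℚ (b * L) ÷ℕ (b * i) → Range q i L
  scaled-range {b} {q} {i} {L} 0<b 0<i h h′ = range
    (*-cancelˡ-< b L (q * suc i) (subst (b * L <_) (trans (cong (λ k → q * (b * k)) (+-comm i 1)) (swap (suc i)))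
      (÷ℕ<⁻ (b * L) q (*-mono-≤ 0<b (m≤n+m 1 i)) h)))
    (*-cancelˡ-≤ b {{>-nonZero 0<b}} (subst (_≤ b * L) (swap i) (≤÷ℕ⁻ (b * L) q (*-mono-≤ 0<b 0<i) h′)))
    where
    swap : ∀ k → q * (b * k) ≡ b * (q * k)
    swap k = solve 3 (λ q b k → q :* (b :* k) := b :* (q :* k)) refl q b k

  module _ (A implied : ℝ) where

    General UnitFractions NearHalf : Set
    General =
      ∀ (a₁ b₁ a₂ b₂ : ℕ) → FareyPair a₁ b₁ a₂ b₂ → b₂ < b₁ →
      ∀ (imax i N q : ℕ) (3≤i : 3 ≤ i) → i < imax → N ≡ b₁ * lcmUpTo imax →
      N ÷ℕ (b₁ * (i + 1)) <ℚ fromℕ q → fromℕ q ≤ℚ N ÷ℕ (b₁ * i) →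
      ∣ fromℚ (fromℕ (rank N ((a₁ * q + a₂) ÷ℕ (b₁ * q + b₂))))
        -ʳ (fromℚ (fromℕ (rank N (a₁ ÷ℕ b₁))) +ʳ fromℚ (side a₁ b₁ a₂ b₂) *ʳ mainTerm b₁ q N) ∣ʳ
        ≤ʳ implied *ʳ (fromℚ (fromℕ N) *ʳ δ A (fromℚ (fromℕ i)) (fromℕ-mono-≤ʳ 3≤i))
    UnitFractions =
      ∀ (imax i N q : ℕ) (3≤i : 3 ≤ i) → i < imax → N ≡ lcmUpTo imax →
      N ÷ℕ (i + 1) <ℚ fromℕ q → fromℕ q ≤ℚ N ÷ℕ i →
      ∣ fromℚ (fromℕ (rank N (1 ÷ℕ q))) -ʳ mainTerm 1 q N ∣ʳ
        ≤ʳ implied *ʳ (fromℚ (fromℕ N) *ʳ δ A (fromℚ (fromℕ i)) (fromℕ-mono-≤ʳ 3≤i))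
    NearHalf =
      ∀ (imax i N q : ℕ) (3≤i : 3 ≤ i) → i < imax → N ≡ 2 * lcmUpTo imax →
      N ÷ℕ (2 * (i + 1)) <ℚ fromℕ q → fromℕ q ≤ℚ N ÷ℕ (2 * i) →
      ∣ fromℚ (fromℕ (rank N ((q + 1) ÷ℕ (2 * q + 1)))) -ʳ (fromℚ (length (Farey N) ÷ℕ 2) +ʳ mainTerm 2 q N) ∣ʳ
        ≤ʳ implied *ʳ (fromℚ (fromℕ N) *ʳ δ A (fromℚ (fromℕ i)) (fromℕ-mono-≤ʳ 3≤i))

  module _ (A : ℝ) (0<A : 0ʳ <ʳ A) where

    -- The constants are variables here, so that their values are never unfolded.
    module WithConstants (C : ℝ)
      (walfisz : ∀ (x : ℝ) (n : ℕ) (3≤x : fromℚ (fromℕ 3) ≤ʳ x) → fromℚ (fromℕ n) ≤ʳ x → x <ʳ fromℚ (fromℕ (suc n)) →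
                 ∣ E x n -ʳ x *ʳ H x n ∣ʳ ≤ʳ C *ʳ (x *ʳ δ A x 3≤x))
      (K : ℚ) (0≤K : 0ℚ ≤ℚ K) (∣C∣≤K : Eventually λ n → ℚ.∣ seq C n ∣ ≤ℚ K)
      (Kδ : ℚ) (quasi : QuasiAntimono A 0<A Kδ) where

      open Estimate A 0<A C walfisz K 0≤K ∣C∣≤K Kδ quasi using (implied; real-estimate)

      module _ {a₁ b₁ a₂ b₂ q i imax : ℕ} (b₂<b₁ : b₂ < b₁) (a₁≤b₁ : a₁ ≤ b₁) (a₁+a₂≤b₁+b₂ : a₁ + a₂ ≤ b₁ + b₂)
        (det : ∣ a₁ * b₂ - a₂ * b₁ ∣ ≡ 1) (3≤i : 3 ≤ i) (i<imax : i < imax) (R : Range q i (lcmUpTo imax)) where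

        open Range R

        private
          L : ℕ
          L = lcmUpTo imax
          0<b₁ : 0 < b₁
          0<b₁ = ≤-trans (s≤s z≤n) b₂<b₁
          N<b₁q[i+1] : b₁ * L < b₁ * q * suc i
          N<b₁q[i+1] = subst (b₁ * L <_) (sym (*-assoc b₁ q (suc i))) (*-monoʳ-< b₁ {{>-nonZero 0<b₁}} L<q[i+1])

          ∣L : ∀ {n} → 0 < n → n ≤ suc i → n ∣ L
          ∣L 0<n n≤i+1 = ∣lcmUpTo 0<n (≤-trans n≤i+1 i<imax)

        open Strip a₁ b₁ a₂ b₂ q i L b₂<b₁ a₁≤b₁ a₁+a₂≤b₁+b₂ 0<q N<b₁q[i+1] ∣L qi≤L using (N; new; old; rank-estimate)

        based-estimate : ∀ base → ℚ.∣ fromℕ (rank N old) ℚ.- base ∣ ≤ℚ 1ℚ →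
          ∣ fromℚ (fromℕ (rank N new)) -ʳ (fromℚ base +ʳ fromℚ (side a₁ b₁ a₂ b₂) *ʳ mainTerm b₁ q N) ∣ʳ
          ≤ʳ implied *ʳ (fromℚ (fromℕ N) *ʳ δ A (fromℚ (fromℕ i)) (fromℕ-mono-≤ʳ 3≤i))
        based-estimate base h = real-estimate {b₁} {q} {L} {i} 3≤i 0<b₁ 0<q qi≤L L<q[i+1]
          ∣L
          (fromℕ (rank N new)) base (side a₁ b₁ a₂ b₂) (∣side∣≤1 a₁ b₁ a₂ b₂)
          (change-base {fromℕ (rank N new)} {fromℕ (rank N old)} {base} {side a₁ b₁ a₂ b₂ ℚ.* (fromℕ L ℚ.* weightedTotient i ℚ.- fromℕ q ℚ.* totient i)} {suc i * suc i}
            (rank-estimate det) h)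

      general : General A implied
      general a₁ b₁ a₂ b₂ pair b₂<b₁ imax i N q 3≤i i<imax refl h h′ =
        based-estimate {a₁} {b₁} {a₂} {b₂} {q} {i} {imax} b₂<b₁ (proj₁ (shape pair)) (proj₁ (proj₂ (shape pair))) (proj₂ (proj₂ (shape pair)))
          3≤i i<imax (scaled-range (≤-trans (s≤s z≤n) b₂<b₁) (≤-trans (s≤s z≤n) 3≤i) h h′)
          (fromℕ (rank (b₁ * lcmUpTo imax) (a₁ ÷ℕ b₁)))
          (ℚₚ.≤-trans (ℚₚ.≤-reflexive (cong ℚ.∣_∣ (ℚₚ.+-inverseʳ (fromℕ (rank (b₁ * lcmUpTo imax) (a₁ ÷ℕ b₁)))))) (from-yes (0ℚ ℚₚ.≤? 1ℚ)))
        where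
        shape : ∀ {a₁ b₁ a₂ b₂} → FareyPair a₁ b₁ a₂ b₂ → a₁ ≤ b₁ × a₁ + a₂ ≤ b₁ + b₂ × ∣ a₁ * b₂ - a₂ * b₁ ∣ ≡ 1
        shape (inj₁ ((_ , a₁≤b₁ , _) , (_ , a₂≤b₂ , _) , det)) = a₁≤b₁ , +-mono-≤ a₁≤b₁ a₂≤b₂ , det
        -- For 0/1 and 1/0 the mediant is 1/1, so the condition on sums holds with equality.
        shape (inj₂ (refl , refl , refl , refl)) = z≤n , s≤s z≤n , refl

      unit-fractions : UnitFractions A implied
      unit-fractions imax i N q 3≤i i<imax refl h h′ =
        ≤ʳ-trans (∣ r -ʳ mainTerm 1 q N ∣ʳ) (∣ r -ʳ (fromℚ 0ℚ +ʳ fromℚ 1ℚ *ʳ mainTerm 1 q N) ∣ʳ) (bound N) (drop-0+1* r (mainTerm 1 q N))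
          -- The instance for 0/1 and 1/0 has `1 * N` for N and `1 * q + 0` as the denominator.
          (subst₂ (λ n d → ∣ fromℚ (fromℕ (rank n (1 ÷ℕ d))) -ʳ (fromℚ 0ℚ +ʳ fromℚ 1ℚ *ʳ mainTerm 1 q n) ∣ʳ ≤ʳ bound n)
            (*-identityˡ N) (trans (+-identityʳ (1 * q)) (*-identityˡ q))
            (based-estimate {0} {1} {1} {0} {q} {i} {imax} (s≤s z≤n) z≤n (s≤s z≤n) refl 3≤i i<imax
              (range (subst (λ k → N < q * k) (+-comm i 1) (÷ℕ<⁻ N q (m≤n+m 1 i) h)) (≤÷ℕ⁻ N q (≤-trans (s≤s z≤n) 3≤i) h′))
              0ℚ (subst (λ x → ℚ.∣ x ∣ ≤ℚ 1ℚ) (sym (ℚₚ.+-identityʳ (fromℕ (rank (1 * N) (0 ÷ℕ 1)))))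
                (subst (_≤ℚ 1ℚ) (sym (ℚₚ.0≤p⇒∣p∣≡p (0≤fromℕ (rank (1 * N) (0 ÷ℕ 1)))))
                  (fromℕ-mono {rank (1 * N) (0 ÷ℕ 1)} {1} (rank-0≤1 (1 * N)))))))
        where
        r : ℝ
        r = fromℚ (fromℕ (rank N (1 ÷ℕ q)))
        bound : ℕ → ℝ
        bound n = implied *ʳ (fromℚ (fromℕ n) *ʳ δ A (fromℚ (fromℕ i)) (fromℕ-mono-≤ʳ 3≤i))

      near-½ : NearHalf A implied
      near-½ imax i N q 3≤i i<imax refl h h′ =
        ≤ʳ-trans (∣ r (q + 1) -ʳ (base +ʳ mainTerm 2 q N) ∣ʳ) (∣ r (q + 1) -ʳ (base +ʳ fromℚ 1ℚ *ʳ mainTerm 2 q N) ∣ʳ) bound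
          (drop-1* (r (q + 1)) base (mainTerm 2 q N))
          (subst (λ p → ∣ r p -ʳ (base +ʳ fromℚ 1ℚ *ʳ mainTerm 2 q N) ∣ʳ ≤ʳ bound) (cong (_+ 1) (*-identityˡ q))
            (based-estimate {1} {2} {1} {1} {q} {i} {imax} (s≤s (s≤s z≤n)) (s≤s z≤n) (s≤s (s≤s z≤n)) refl 3≤i i<imax
              (scaled-range {2} (s≤s z≤n) (≤-trans (s≤s z≤n) 3≤i) h h′)
              (length (Farey N) ÷ℕ 2) (Symmetry.rank-½ N)))
        where
        r : ℕ → ℝ
        r p = fromℚ (fromℕ (rank N (p ÷ℕ (2 * q + 1))))
        base bound : ℝ
        base = fromℚ (length (Farey N) ÷ℕ 2)
        bound = implied *ʳ (fromℚ (fromℕ N) *ʳ δ A (fromℚ (fromℕ i)) (fromℕ-mono-≤ʳ 3≤i))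

    Conclusion : Set
    Conclusion = ∃ (General A) × ∃ (UnitFractions A) × ∃ (NearHalf A)

    conclude : (C : ℝ) →
      (∀ (x : ℝ) (n : ℕ) (3≤x : fromℚ (fromℕ 3) ≤ʳ x) → fromℚ (fromℕ n) ≤ʳ x → x <ʳ fromℚ (fromℕ (suc n)) →
       ∣ E x n -ʳ x *ʳ H x n ∣ʳ ≤ʳ C *ʳ (x *ʳ δ A x 3≤x)) →
      (∃ λ K → 0ℚ <ℚ K × Eventually λ n → ℚ.∣ seq C n ∣ ≤ℚ K) → ∃ (QuasiAntimono A 0<A) → Conclusion
    conclude C walfisz (K , 0<K , ∣C∣≤K) (Kδ , quasi) = (implied , general) , (implied , unit-fractions) , (implied , near-½)
      where open WithConstants C walfisz K (ℚₚ.<⇒≤ 0<K) ∣C∣≤K Kδ quasi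
            open Estimate A 0<A C walfisz K (ℚₚ.<⇒≤ 0<K) ∣C∣≤K Kδ quasi using (implied)

    corollary : WalfiszEstimate A → Conclusion
    corollary (C , walfisz) = conclude C walfisz (bounded {seq C} (isCauchy C)) (δ-quasi-antimono A 0<A)

open import Data.Nat.Base using (ℕ; _+_; _*_; _≤_; _<_)
open import Data.List.Base using (length)
open import Data.Product.Base using (∃; _×_)
open import Data.Rational.Base using () renaming (_≤_ to _≤ℚ_; _<_ to _<ℚ_)
open import Relation.Binary.PropositionalEquality using (_≡_)

corollary3p4 : (A : ℝ) → 0ʳ <ʳ A → WalfiszEstimate A →
    (∃ λ (C : ℝ) →
    ∀ (a₁ b₁ a₂ b₂ : ℕ) → FareyPair a₁ b₁ a₂ b₂ → b₂ < b₁ →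
    ∀ (imax i N q : ℕ) (3≤i : 3 ≤ i) → i < imax → N ≡ b₁ * lcmUpTo imax →
    N ÷ℕ (b₁ * (i + 1)) <ℚ fromℕ q → fromℕ q ≤ℚ N ÷ℕ (b₁ * i) →
    ∣ fromℚ (fromℕ (rank N ((a₁ * q + a₂) ÷ℕ (b₁ * q + b₂))))
    -ʳ (fromℚ (fromℕ (rank N (a₁ ÷ℕ b₁))) +ʳ fromℚ (side a₁ b₁ a₂ b₂) *ʳ mainTerm b₁ q N) ∣ʳ
    ≤ʳ C *ʳ (fromℚ (fromℕ N) *ʳ δ A (fromℚ (fromℕ i)) (fromℕ-mono-≤ʳ 3≤i)))
    ×
    (∃ λ (C : ℝ) →
    ∀ (imax i N q : ℕ) (3≤i : 3 ≤ i) → i < imax → N ≡ lcmUpTo imax →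
    N ÷ℕ (i + 1) <ℚ fromℕ q → fromℕ q ≤ℚ N ÷ℕ i →
    ∣ fromℚ (fromℕ (rank N (1 ÷ℕ q))) -ʳ mainTerm 1 q N ∣ʳ
    ≤ʳ C *ʳ (fromℚ (fromℕ N) *ʳ δ A (fromℚ (fromℕ i)) (fromℕ-mono-≤ʳ 3≤i)))
    ×
    (∃ λ (C : ℝ) →
    ∀ (imax i N q : ℕ) (3≤i : 3 ≤ i) → i < imax → N ≡ 2 * lcmUpTo imax →
    N ÷ℕ (2 * (i + 1)) <ℚ fromℕ q → fromℕ q ≤ℚ N ÷ℕ (2 * i) →
    ∣ fromℚ (fromℕ (rank N ((q + 1) ÷ℕ (2 * q + 1))))
    -ʳ (fromℚ (length (Farey N) ÷ℕ 2) +ʳ mainTerm 2 q N) ∣ʳ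
    ≤ʳ C *ʳ (fromℚ (fromℕ N) *ʳ δ A (fromℚ (fromℕ i)) (fromℕ-mono-≤ʳ 3≤i)))
corollary3p4 = Corollary.corollary
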